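{- Let $p>155$ be a prime and let $G$ be a cyclic group of order $p$. Let $S$ be an unsplittable minimal zero-sum sequence over $G$ of length $|S|=\frac{p-1}{2}$. Then there is $g\in G$ such that $S$ is one of the sequences $$g^{\frac{p-11}{2}}\Big(\tfrac{p+3}{2}g\Big)^4\Big(\tfrac{p-1}{2}g\Big)\quad\text{or}\quad g^{\frac{p-7}{2}}\Big(\tfrac{p+5}{2}g\Big)^2\Big(\tfrac{p-3}{2}g\Big).$$ Moreover $\operatorname{ind}(S)=2$.
   Context: A sequence over an abelian group $G$ is a finite unordered list of elements of $G$ with repetition allowed, written multiplicatively as $S=g_1\cdots g_\ell=\prod_{g\in G}g^{\mathsf v_g(S)}$; $|S|=\ell$ is its length, $\mathsf v_g(S)$ the multiplicity of $g$, $\operatorname{supp}(S)=\{g:\mathsf v_g(S)>0\}$, and $\sigma(S)=g_1+\dots+g_\ell$. For an integer $t$, $tg$ denotes the $t$-fold multiple of $g$. $S$ is a minimal zero-sum sequence if $\sigma(S)=0$ and no subsequence $T$ with $1\le |T|<|S|$ has $\sigma(T)=0$. A minimal zero-sum sequence $S$ is splittable if there exist $g\in\operatorname{supp}(S)$ and $x,y\in G$ with $x+y=g$ such that the sequence obtained from $S$ by removing one copy of $g$ and adding $x$ and $y$ is again a minimal zero-sum sequence; otherwise $S$ is unsplittable. For $g\in G$ nonzero of order $n$ and $S=(x_1g)\cdots(x_lg)$ with $1\le x_i\le n$, the $g$-norm is $\|S\|_g=(x_1+\dots+x_l)/n$. If $\langle\operatorname{supp}(S)\rangle$ is a nontrivial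 finite cyclic group, the index is $\operatorname{ind}(S)=\min\{\|S\|_g: g\in G,\ \langle\operatorname{supp}(S)\rangle=\langle g\rangle\}$. -}

module Defs where

open import Algebra.Bundles using (AbelianGroup)
import Algebra.Definitions.RawMonoid as RawMonoidDefs
open import Data.Fin.Properties using (≡-setoid)
open import Data.Integer using (+_)
open import Data.List using (List; []; _∷_; _++_; length; foldr; sum)
import Data.List.Membership.Setoid as Membership
import Data.List.Relation.Binary.Permutation.Setoid as Permutation
open import Data.List.Relation.Binary.Pointwise using (Pointwise)
open import Data.List.Relation.Unary.Any using (_─_)
open import Data.Nat using (ℕ; NonZero)
import Data.Nat as ℕ
open import Data.Product using (_×_; ∃; ∃-syntax; Σ-syntax)
open import Data.Rational using (ℚ; _/_; _≤_)
open import Function.Bundles using (Bijection)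
open import Level using (Level; _⊔_)
open import Relation.Binary.PropositionalEquality using (_≡_)
open import Relation.Nullary using (¬_)
open import Relation.Unary using (Pred; _≐_)

module ZeroSum {c ℓ : Level} (G : AbelianGroup c ℓ) where

  open AbelianGroup G public
    using (Carrier; _≈_; setoid)
    renaming (_∙_ to _+ᴳ_; ε to 0ᴳ; _⁻¹ to -ᴳ_)

  open RawMonoidDefs (AbelianGroup.rawMonoid G) public
    using () renaming (_×_ to _·_)

  data ⟨_⟩ (P : Pred Carrier (c ⊔ ℓ)) : Pred Carrier (c ⊔ ℓ) where
    incl : ∀ {x} → P x → ⟨ P ⟩ x
    zer  : ⟨ P ⟩ 0ᴳ
    add  : ∀ {x y} → ⟨ P ⟩ x → ⟨ P ⟩ y → ⟨ P ⟩ (x +ᴳ y)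
    neg  : ∀ {x} → ⟨ P ⟩ x → ⟨ P ⟩ (-ᴳ x)
    resp : ∀ {x y} → x ≈ y → ⟨ P ⟩ x → ⟨ P ⟩ y

  -- Sequences are unordered: lists are only ever compared up to _↭_,
  -- permutation modulo the equality of G.
  Sequence : Set c
  Sequence = List Carrier

  open Permutation setoid public using (_↭_)
  open Membership setoid public using (_∈_)

  supp : Sequence → Pred Carrier (c ⊔ ℓ)
  supp S g = g ∈ S

  ⟨_⟩₁ : Carrier → Pred Carrier (c ⊔ ℓ)
  ⟨ g ⟩₁ = ⟨ supp (g ∷ []) ⟩

  CyclicOfOrder : ℕ → Set (c ⊔ ℓ)
  CyclicOfOrder n = (∃[ g ] ∀ h → ⟨ g ⟩₁ h) × Bijection (≡-setoid n) setoid

  σ : Sequence → Carrier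
  σ = foldr _+ᴳ_ 0ᴳ

  _∣_ : Sequence → Sequence → Set (c ⊔ ℓ)
  T ∣ S = ∃[ R ] (T ++ R) ↭ S

  MinimalZeroSum : Sequence → Set (c ⊔ ℓ)
  MinimalZeroSum S =
    σ S ≈ 0ᴳ ×
    (∀ T → T ∣ S → 1 ℕ.≤ length T → length T ℕ.< length S → ¬ (σ T ≈ 0ᴳ))

  Splittable : Sequence → Set (c ⊔ ℓ)
  Splittable S =
    ∃[ g ] Σ[ g∈S ∈ g ∈ S ] ∃[ x ] ∃[ y ]
      (x +ᴳ y) ≈ g × MinimalZeroSum (x ∷ y ∷ (S ─ g∈S))

  Unsplittable : Sequence → Set (c ⊔ ℓ)
  Unsplittable S = MinimalZeroSum S × ¬ Splittable S

  ElementOrder : Carrier → ℕ → Set ℓ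
  ElementOrder g n =
    1 ℕ.≤ n × (n · g) ≈ 0ᴳ × (∀ m → 1 ℕ.≤ m → (m · g) ≈ 0ᴳ → n ℕ.≤ m)

  -- ‖ S ‖_g = q.  A relation rather than a function, since the norm is
  -- defined only if g has finite order and every term of S is a multiple of g.
  record Norm (S : Sequence) (g : Carrier) (q : ℚ) : Set (c ⊔ ℓ) where
    field
      nonzero      : ¬ (g ≈ 0ᴳ)
      n            : ℕ
      ⦃ n≢0 ⦄      : NonZero n
      order        : ElementOrder g n
      coefficients : List ℕ
      represents   : Pointwise (λ x s → 1 ℕ.≤ x × x ℕ.≤ n × s ≈ (x · g))
                               coefficients S
      value        : q ≡ (+ sum coefficients) / n

  -- ind(S) = q.  The first component also says that ⟨supp(S)⟩ is a nontrivial
  -- finite cyclic group, which the definition of the index presupposes.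
  Index : Sequence → ℚ → Set (c ⊔ ℓ)
  Index S q =
    (∃[ g ] ⟨ supp S ⟩ ≐ ⟨ g ⟩₁ × Norm S g q) ×
    (∀ g r → ⟨ supp S ⟩ ≐ ⟨ g ⟩₁ → Norm S g r → q ≤ r)

{-# OPTIONS --safe #-}
-- Let S be unsplittable of length (p - 1)/2. Splitting a term g into -x and g + x can fail only if x
-- is a subset sum of the other terms, so all of G consists of subset sums of S without g. In
-- particular S cannot contain both a^k and sa with 2 ≤ s ≤ k + 1.
--
-- If U is part of S and at least two different terms are left over, then U has fewer than 2|U| + 4
-- subset sums (counting 0): a new term d contributes at least two new sums unless the sums so far
-- form a progression 0, d, …, Bd, and this happens for at most one value d, so one could
-- continue until there are more sums than residue classes.
--
-- If no term occurs more than five times, four of the many distinct terms have 12 sums, a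
-- contradiction. Otherwise let a occur at least six times. The sums of a^5 bc show that any two
-- other terms are b = ((p + y)/2)a and c = ((p + y')/2)a with y, y' in {-3, -1, 3, 5}, at most one
-- of them negative, and those of a^5 and five terms with y > 0 show that there are at most five
-- of the latter. Then σ(S) = 0 determines the multiplicities up to the two sequences of the
-- theorem and a third one, for which not all elements are subset sums. Both have norm 2 with
-- respect to a/2, and norm 1 would make S splittable.

module Submission where

open import Defs

-- The threshold 2|U| + 4 comes from p = 2|K| + 1: gaining two sums per term until only two terms c
-- ≠ d are left gives 2(|K| - 2) + 4 = p - 1 sums, and - c and - d are two further classes, p + 1 in
-- all. The gain of two per term is no use without this initial surplus of four, so each structural
-- statement comes from a short U that has it: 12 sums for four terms, 18 for a^5 bc, 24 for a^5 and
-- five more terms.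
--
-- The obstacle is a value d whose copies may fail to enlarge U, because the sums are 0, d, ..., Bd.
-- Then other terms are added and copies of d are saved for the end; the case in which all remaining
-- terms but one equal d needs its own count (`stuck`).
--
-- The combinatorics takes place on integer representatives in 1, ..., p. Subset sums are decidable
-- there, which turns the negative hypothesis that no splitting works into the positive statement
-- `full`; and equal elements of G become equal integers, so multiplicities can be read off a list.

module UnsplittableSequences where

  open import Algebra.Bundles using (AbelianGroup)
  import Algebra.Properties.Group as GroupProperties
  import Algebra.Properties.Monoid.Mult as Mult
  open import Data.Bool using (Bool; true; false)
  open import Data.Empty using (⊥; ⊥-elim)
  open import Data.Fin as Fin using (Fin; fromℕ<; toℕ)
  import Data.Fin.Properties as Fin
  open import Data.Integer as ℤ using (ℤ; +_; -_; _+_; _-_; _*_; ∣_∣; 0ℤ)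
  open import Data.Integer.DivMod using (_%ℕ_; _/ℕ_; n%ℕd<d; a≡a%ℕn+[a/ℕn]*n)
  open import Data.Integer.Divisibility.Signed
    using (_∣_; divides; _∣?_; ∣⇒∣ᵤ; ∣ᵤ⇒∣; ∣m∣n⇒∣m+n; ∣m∣n⇒∣m-n; ∣m⇒∣-m; ∣n⇒∣m*n)
  import Data.Integer.Properties as ℤ
  open import Data.Integer.Tactic.RingSolver using (solve-∀)
  open import Data.List as List using (List; []; [_]; _∷_; _++_; length; foldr; replicate; applyUpTo; lookup)
  open import Data.List.Membership.Propositional using (_∈_)
  open import Data.List.Membership.Propositional.Properties using (∈-lookup; ∈-++⁺ˡ; ∈-++⁺ʳ; ∈-++⁻)
  import Data.List.Properties as List
  import Data.List.Relation.Binary.Equality.Setoid as ≋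
  open import Data.List.Relation.Binary.Permutation.Propositional as ↭
    using (_↭_; ↭-refl; ↭-sym; ↭-trans; prep; swap; ↭⇒↭ₛ′)
  import Data.List.Relation.Binary.Permutation.Propositional.Properties as ↭
  import Data.List.Relation.Binary.Permutation.Setoid as Permutationᴳ
  import Data.List.Relation.Binary.Permutation.Setoid.Properties as PermutationPropertiesᴳ
  open import Data.List.Relation.Binary.Pointwise as Pointwise using (Pointwise; []; _∷_; Pointwise-length)
  open import Data.List.Relation.Unary.All as All using (All; []; _∷_)
  import Data.List.Relation.Unary.All.Properties as All
  open import Data.List.Relation.Unary.AllPairs as AllPairs using (AllPairs; []; _∷_)
  import Data.List.Relation.Unary.AllPairs.Properties as AllPairs
  open import Data.List.Relation.Unary.Any as Any using (here; there; _─_)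
  import Data.List.Relation.Unary.Any.Properties as Any
  open import Data.Nat as ℕ using (ℕ; zero; suc; NonZero; z≤n; s≤s)
  open import Data.Nat.Coprimality using (prime⇒coprime; coprime-Bézout)
  import Data.Nat.Divisibility as ℕ
  import Data.Nat.DivMod as ℕ
  open import Data.Nat.GCD using (module Bézout)
  open import Data.Nat.ListAction using (sum)
  open import Data.Nat.ListAction.Properties using (sum-++; sum-↭)
  open import Data.Nat.Primality using (Prime; prime⇒nonZero; prime⇒irreducible; euclidsLemma)
  import Data.Nat.Properties as ℕ
  import Data.Nat.Tactic.RingSolver as ℕ-Ring
  open import Data.Product using (_×_; _,_; ∃₂; ∃-syntax; proj₁; proj₂)
  import Data.Rational as ℚ
  import Data.Rational.Properties as ℚ
  open import Data.Rational.Unnormalised as ℚᵘ using (mkℚᵘ)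
  import Data.Rational.Unnormalised.Properties as ℚᵘ
  open import Data.Sum using (_⊎_; inj₁; inj₂; [_,_]′)
  open import Data.Vec as Vec using (Vec; []; _∷_; toList)
  open import Function using (_∘_; case_of_)
  open import Function.Bundles using (Bijection)
  open import Level using (_⊔_)
  open import Relation.Binary.PropositionalEquality
    using (_≡_; _≢_; refl; sym; trans; cong; cong₂; subst; subst₂)
  import Relation.Binary.Reasoning.Setoid as ≈-Reasoning
  open import Relation.Nullary using (¬_; Dec; yes; no; contradiction)
  open import Relation.Nullary.Decidable using (map′; ¬?; decidable-stable; _×-dec_; _⊎-dec_)

  import Algebra.Solver.CommutativeMonoid (↭.++-commutativeMonoid {A = ℤ}) as Perm
  open Perm using (_⊕_; _⊜_)

  -- Totals of integer lists and a pigeonhole principle.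

  total : List ℤ → ℤ
  total = foldr _+_ 0ℤ

  total-++ : ∀ U V → total (U ++ V) ≡ total U + total V
  total-++ []      V = sym (ℤ.+-identityˡ _)
  total-++ (u ∷ U) V = trans (cong (_+_ u) (total-++ U V)) (sym (ℤ.+-assoc u (total U) (total V)))

  total-↭ : ∀ {U V} → U ↭ V → total U ≡ total V
  total-↭ ↭.refl         = refl
  total-↭ (prep x π)     = cong (_+_ x) (total-↭ π)
  total-↭ (swap {ys = V} x y π) = trans (cong (λ z → x + (y + z)) (total-↭ π)) (e x y (total V))
    where e : ∀ x y z → x + (y + z) ≡ y + (x + z)
          e = solve-∀
  total-↭ (↭.trans π π′) = trans (total-↭ π) (total-↭ π′)

  total-replicate : ∀ k d → total (replicate k d) ≡ + k * d
  total-replicate zero    d = sym (ℤ.*-zeroˡ d)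
  total-replicate (suc k) d = trans (cong (_+_ d) (total-replicate k d)) (sym (ℤ.suc-* (+ k) d))

  pigeonhole-list : ∀ {A : Set} {R : A → A → Set} {P : A → ℕ → Set} {N} (L : List A) →
    AllPairs (λ x y → ¬ R x y) L → All (λ x → ∃[ i ] i ℕ.< N × P x i) L →
    (∀ {x y i} → P x i → P y i → R x y) → length L ℕ.≤ N
  pigeonhole-list {A} {R} {P} {N} L distinct index same =
    ℕ.≮⇒≥ λ N<∣L∣ → let i , j , i<j , eq = Fin.pigeonhole N<∣L∣ box in
      apart distinct i j i<j (same (inBox i) (subst (P (lookup L j)) (toℕ-eq eq) (inBox j)))
    where
    at : ∀ i → ∃[ k ] k ℕ.< N × P (lookup L i) k
    at i = All.lookup index (∈-lookup i)
    box : Fin (length L) → Fin N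
    box i = fromℕ< (at i .proj₂ .proj₁)
    inBox : ∀ i → P (lookup L i) (at i .proj₁)
    inBox i = at i .proj₂ .proj₂
    toℕ-eq : ∀ {i j} → box i ≡ box j → at j .proj₁ ≡ at i .proj₁
    toℕ-eq {i} {j} eq = trans (sym (Fin.toℕ-fromℕ< (at j .proj₂ .proj₁)))
      (trans (cong toℕ (sym eq)) (Fin.toℕ-fromℕ< (at i .proj₂ .proj₁)))
    apart : ∀ {L : List A} → AllPairs (λ x y → ¬ R x y) L → ∀ i j → i Fin.< j → ¬ R (lookup L i) (lookup L j)
    apart (r ∷ _)  Fin.zero    (Fin.suc j) _         = All.lookup r (∈-lookup j)
    apart (_ ∷ rs) (Fin.suc i) (Fin.suc j) (s≤s i<j) = apart rs i j i<j

  -- Congruence modulo p and subset sums.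

  module Residues (p : ℕ) (prime : Prime p) where

    instance
      p≢0 : NonZero p
      p≢0 = prime⇒nonZero prime

    Z : ℤ → Set
    Z x = + p ∣ x

    -- A record instead of a synonym for `Z (x - y)`, so that unification can recover `x` and `y`.
    infix 4 _~_
    record _~_ (x y : ℤ) : Set where
      constructor mk~
      field un~ : Z (x - y)
    open _~_ public

    Z? : ∀ x → Dec (Z x)
    Z? x = + p ∣? x

    infix 4 _~?_
    _~?_ : ∀ x y → Dec (x ~ y)
    x ~? y = map′ mk~ un~ (Z? (x - y))

    Z-≡ : ∀ {x y} → x ≡ y → Z x → Z y
    Z-≡ = subst Z

    Z-0 : Z 0ℤ
    Z-0 = divides 0ℤ refl

    Z-p : Z (+ p)
    Z-p = divides (+ 1) (sym (ℤ.*-identityˡ (+ p)))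

    ~-reflexive : ∀ {x y} → x ≡ y → x ~ y
    ~-reflexive {x} refl = mk~ (Z-≡ (sym (ℤ.+-inverseʳ x)) Z-0)

    ~-refl : ∀ {x} → x ~ x
    ~-refl = ~-reflexive refl

    ~-sym : ∀ {x y} → x ~ y → y ~ x
    ~-sym {x} {y} (mk~ z) = mk~ (Z-≡ (e x y) (∣m⇒∣-m z))
      where e : ∀ x y → - (x - y) ≡ y - x
            e = solve-∀

    ~-trans : ∀ {x y w} → x ~ y → y ~ w → x ~ w
    ~-trans {x} {y} {w} (mk~ z) (mk~ z′) = mk~ (Z-≡ (e x y w) (∣m∣n⇒∣m+n z z′))
      where e : ∀ x y w → (x - y) + (y - w) ≡ x - w
            e = solve-∀

    ~-+ : ∀ {x y x′ y′} → x ~ x′ → y ~ y′ → x + y ~ x′ + y′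
    ~-+ {x} {y} {x′} {y′} (mk~ z) (mk~ z′) = mk~ (Z-≡ (e x y x′ y′) (∣m∣n⇒∣m+n z z′))
      where e : ∀ x y x′ y′ → (x - x′) + (y - y′) ≡ (x + y) - (x′ + y′)
            e = solve-∀

    ~-- : ∀ {x y x′ y′} → x ~ x′ → y ~ y′ → x - y ~ x′ - y′
    ~-- {x} {y} {x′} {y′} (mk~ z) (mk~ z′) = mk~ (Z-≡ (e x y x′ y′) (∣m∣n⇒∣m-n z z′))
      where e : ∀ x y x′ y′ → (x - x′) - (y - y′) ≡ (x - y) - (x′ - y′)
            e = solve-∀

    ~-* : ∀ i {x y} → x ~ y → i * x ~ i * y
    ~-* i {x} {y} (mk~ z) = mk~ (Z-≡ (e i x y) (∣n⇒∣m*n i z))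
      where e : ∀ i x y → i * (x - y) ≡ i * x - i * y
            e = solve-∀

    Z⇒~0 : ∀ {x} → Z x → x ~ 0ℤ
    Z⇒~0 {x} z = mk~ (Z-≡ (sym (ℤ.+-identityʳ x)) z)

    ~0⇒Z : ∀ {x} → x ~ 0ℤ → Z x
    ~0⇒Z {x} (mk~ z) = Z-≡ (ℤ.+-identityʳ x) z

    Z-resp : ∀ {x y} → x ~ y → Z x → Z y
    Z-resp x~y z = ~0⇒Z (~-trans (~-sym x~y) (Z⇒~0 z))

    Z-cancel : ∀ {i d} → ¬ Z d → Z (i * d) → Z i
    Z-cancel {i} {d} ¬z z
      with euclidsLemma ∣ i ∣ ∣ d ∣ prime (subst (p ℕ.∣_) (ℤ.abs-* i d) (∣⇒∣ᵤ z))
    ... | inj₁ q = ∣ᵤ⇒∣ q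
    ... | inj₂ q = contradiction (∣ᵤ⇒∣ q) ¬z

    Z-small : ∀ {i} → Z i → ∣ i ∣ ℕ.< p → i ≡ 0ℤ
    Z-small {i} z i<p with ∣ i ∣ in eq | ∣⇒∣ᵤ z
    ... | zero  | _ = ℤ.∣i∣≡0⇒i≡0 eq
    ... | suc _ | q = contradiction (ℕ.∣⇒≤ q) (ℕ.<⇒≱ i<p)

    ¬Z-between : ∀ {n} → 0 ℕ.< n → n ℕ.< p → ¬ Z (+ n)
    ¬Z-between 0<n n<p z = ℕ.<⇒≢ 0<n (sym (ℤ.+-injective (Z-small z n<p)))

    ¬Z-between-p-2p : ∀ {n} → p ℕ.< n → n ℕ.< p ℕ.+ p → ¬ Z (+ n)
    ¬Z-between-p-2p {n} p<n n<2p z = ¬Z-between (ℕ.m<n⇒0<n∸m p<n) (ℕ.+-cancelˡ-< p _ _ (subst (ℕ._< p ℕ.+ p) (sym n≡) n<2p))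
      (Z-≡ (trans (cong (λ k → + k - + p) (sym n≡)) (e (+ p) (+ (n ℕ.∸ p)))) (∣m∣n⇒∣m-n z Z-p))
      where n≡ : p ℕ.+ (n ℕ.∸ p) ≡ n
            n≡ = ℕ.m+[n∸m]≡n (ℕ.<⇒≤ p<n)
            e : ∀ p k → p + k - p ≡ k
            e = solve-∀

    ~⇒≡ : ∀ {i j} → i ℕ.< p → j ℕ.< p → + i ~ + j → i ≡ j
    ~⇒≡ {i} {j} i<p j<p (mk~ z) = ℤ.+-injective (ℤ.i-j≡0⇒i≡j (+ i) (+ j) (Z-small z
      (subst (λ x → ∣ x ∣ ℕ.< p) (sym (ℤ.m-n≡m⊖n i j))
        (ℕ.≤-<-trans (ℤ.∣m⊝n∣≤m⊔n i j) (ℕ.⊔-lub i<p j<p)))))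

    2*-cancel : 2 ℕ.< p → ∀ {x y} → + 2 * x ~ + 2 * y → x ~ y
    2*-cancel 2<p {x} {y} (mk~ z) = mk~ (Z-cancel {x - y} {+ 2} (¬Z-between (s≤s z≤n) 2<p) (Z-≡ (e x y) z))
      where e : ∀ x y → + 2 * x - + 2 * y ≡ (x - y) * + 2
            e = solve-∀

    ~-multiple : ∀ {d i j} → ¬ Z d → i * d ~ j * d → i ~ j
    ~-multiple {d} {i} {j} ¬z (mk~ z) = mk~ (Z-cancel {i - j} ¬z (Z-≡ (e i j d) z))
      where e : ∀ i j d → i * d - j * d ≡ (i - j) * d
            e = solve-∀

    multiple-inj : ∀ {d i j} → ¬ Z d → i ℕ.< p → j ℕ.< p → + i * d ~ + j * d → i ≡ j
    multiple-inj {d} {i} {j} ¬z i<p j<p z = ~⇒≡ i<p j<p (~-multiple {d} {+ i} {+ j} ¬z z)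

    residue : ∀ x → ∃[ s ] s ℕ.< p × x ~ + s
    residue x = x %ℕ p , n%ℕd<d x p , mk~ (divides (x /ℕ p)
      (trans (cong (_- + (x %ℕ p)) (a≡a%ℕn+[a/ℕn]*n x p)) (e (+ (x %ℕ p)) ((x /ℕ p) * + p))))
      where e : ∀ a b → a + b - a ≡ b
            e = solve-∀

    inverse : ∀ {d} → ¬ Z d → ∃[ u ] u * d ~ + 1
    inverse {d} ¬z with residue d
    ... | zero , _ , d~0 = contradiction (~0⇒Z d~0) ¬z
    ... | s@(suc _) , s<p , d~s with coprime-Bézout (prime⇒coprime prime s<p)
    ... | Bézout.+- x y eq = - + y , ~-trans (~-* (- + y) d~s) (mk~ (divides (- + x) (trans (cong (λ w → w - + 1)
            (sym (ℤ.neg-distribˡ-* (+ y) (+ s)))) (trans (e (+ y * + s))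
            (trans (cong (-_) (trans (cong (_+_ (+ 1)) (sym (ℤ.pos-* y s))) (trans (cong +_ eq) (ℤ.pos-* x p))))
              (ℤ.neg-distribˡ-* (+ x) (+ p)))))))
      where e : ∀ a → - a - + 1 ≡ - (+ 1 + a)
            e = solve-∀
    ... | Bézout.-+ x y eq = + y , ~-trans (~-* (+ y) d~s) (mk~ (divides (+ x) (trans (cong (λ w → w - + 1)
            (trans (sym (ℤ.pos-* y s)) (trans (cong +_ (sym eq)) (cong (_+_ (+ 1)) (ℤ.pos-* x p))))) (e (+ x * + p)))))
      where e : ∀ a → (+ 1 + a) - + 1 ≡ a
            e = solve-∀

    -- This is where primality enters the counting: any nonzero term d can serve as the unit in
    -- which all other terms are measured.
    multiple : ∀ {d} → ¬ Z d → ∀ x → ∃[ s ] s ℕ.< p × x ~ + s * d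
    multiple {d} ¬z x with inverse ¬z
    ... | u , mk~ ud~1 with residue (x * u)
    ... | s , s<p , mk~ xu~s = s , s<p , mk~ (Z-≡ (e x u d (+ s)) (∣m∣n⇒∣m-n (∣n⇒∣m*n d xu~s) (∣n⇒∣m*n x ud~1)))
      where e : ∀ x u d s → d * (x * u - s) - x * (u * d - + 1) ≡ x - s * d
            e = solve-∀

    Distinct : List ℤ → Set
    Distinct = AllPairs (λ x y → ¬ x ~ y)

    Distinct⇒length≤p : ∀ {L} → Distinct L → length L ℕ.≤ p
    Distinct⇒length≤p {L} distinct = pigeonhole-list {P = λ x i → x ~ + i} L distinct
      (All.universal residue L) (λ x~i y~i → ~-trans x~i (~-sym y~i))

    data SubsetSum : List ℤ → ℤ → Set where
      done : ∀ {x} → Z x → SubsetSum [] x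
      skip : ∀ {u U x} → SubsetSum U x → SubsetSum (u ∷ U) x
      take : ∀ {u U x} → SubsetSum U (x - u) → SubsetSum (u ∷ U) x

    -- Decidability is what makes the search for exits possible and what removes the double negation
    -- in `full`.
    SubsetSum? : ∀ U x → Dec (SubsetSum U x)
    SubsetSum? []      x = map′ done (λ { (done z) → z }) (Z? x)
    SubsetSum? (u ∷ U) x = map′ [ skip , take ]′ (λ { (skip s) → inj₁ s ; (take s) → inj₂ s }) (SubsetSum? U x ⊎-dec SubsetSum? U (x - u))

    SubsetSum-resp : ∀ U {x y} → x ~ y → SubsetSum U x → SubsetSum U y
    SubsetSum-resp []      x~y (done z) = done (Z-resp x~y z)
    SubsetSum-resp (u ∷ U) x~y (skip s) = skip (SubsetSum-resp U x~y s)
    SubsetSum-resp (u ∷ U) x~y (take s) = take (SubsetSum-resp U (~-- x~y ~-refl) s)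

    SubsetSum-≡ : ∀ U {x y} → x ≡ y → SubsetSum U x → SubsetSum U y
    SubsetSum-≡ U = subst (SubsetSum U)

    SubsetSum-0 : ∀ U → SubsetSum U 0ℤ
    SubsetSum-0 []      = done Z-0
    SubsetSum-0 (u ∷ U) = skip (SubsetSum-0 U)

    SubsetSum-↭ : ∀ {U V} → U ↭ V → ∀ {x} → SubsetSum U x → SubsetSum V x
    SubsetSum-↭ ↭.refl         s        = s
    SubsetSum-↭ (prep u π)     (skip s) = skip (SubsetSum-↭ π s)
    SubsetSum-↭ (prep u π)     (take s) = take (SubsetSum-↭ π s)
    SubsetSum-↭ (swap u v π)   (skip (skip s)) = skip (skip (SubsetSum-↭ π s))
    SubsetSum-↭ (swap u v π)   (skip (take s)) = take (skip (SubsetSum-↭ π s))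
    SubsetSum-↭ (swap u v π)   (take (skip s)) = skip (take (SubsetSum-↭ π s))
    SubsetSum-↭ (swap {ys = V} u v π) {x} (take (take s)) = take (take (SubsetSum-≡ V (e x u v) (SubsetSum-↭ π s)))
      where e : ∀ x u v → x - u - v ≡ x - v - u
            e = solve-∀
    SubsetSum-↭ (↭.trans π π′) s = SubsetSum-↭ π′ (SubsetSum-↭ π s)

    SubsetSum-++ : ∀ U V {x y} → SubsetSum U x → SubsetSum V y → SubsetSum (U ++ V) (x + y)
    SubsetSum-++ [] V {x} {y} (done z) s = SubsetSum-resp V (~-sym (mk~ (Z-≡ (e x y) z))) s
      where e : ∀ x y → x ≡ x + y - y
            e = solve-∀
    SubsetSum-++ (u ∷ U) V (skip s) t = skip (SubsetSum-++ U V s t)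
    SubsetSum-++ (u ∷ U) V {x} {y} (take s) t = take (SubsetSum-≡ (U ++ V) (e x y u) (SubsetSum-++ U V s t))
      where e : ∀ x y u → x - u + y ≡ x + y - u
            e = solve-∀

    SubsetSum-++ˡ : ∀ U V {x} → SubsetSum U x → SubsetSum (U ++ V) x
    SubsetSum-++ˡ U V {x} s = SubsetSum-≡ (U ++ V) (ℤ.+-identityʳ x) (SubsetSum-++ U V s (SubsetSum-0 V))

    SubsetSum-++⁻ : ∀ U V {x} → SubsetSum (U ++ V) x → ∃[ y ] SubsetSum U y × SubsetSum V (x - y)
    SubsetSum-++⁻ [] V {x} s = 0ℤ , done Z-0 , SubsetSum-≡ V (sym (ℤ.+-identityʳ x)) s
    SubsetSum-++⁻ (u ∷ U) V (skip s) = let y , s , t = SubsetSum-++⁻ U V s in y , skip s , t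
    SubsetSum-++⁻ (u ∷ U) V {x} (take s) = let y , s , t = SubsetSum-++⁻ U V s in
      y + u , take (SubsetSum-≡ U (e y u) s) , SubsetSum-≡ V (e′ x y u) t
      where e : ∀ y u → y ≡ y + u - u
            e = solve-∀
            e′ : ∀ x y u → x - u - y ≡ x - (y + u)
            e′ = solve-∀

    -- Exchange the taken and the skipped terms.
    SubsetSum-complement : ∀ U {x} → SubsetSum U x → SubsetSum U (total U - x)
    SubsetSum-complement [] {x} (done z) = done (Z-≡ (sym (ℤ.+-identityˡ (- x))) (∣m⇒∣-m z))
    SubsetSum-complement (u ∷ U) {x} (skip s) = take (SubsetSum-≡ U (e u (total U) x) (SubsetSum-complement U s))
      where e : ∀ u t x → t - x ≡ u + t - x - u
            e = solve-∀
    SubsetSum-complement (u ∷ U) {x} (take s) = skip (SubsetSum-≡ U (e u (total U) x) (SubsetSum-complement U s))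
      where e : ∀ u t x → t - (x - u) ≡ u + t - x
            e = solve-∀

    SubsetSum-sublist : ∀ U {x} → SubsetSum U x → ∃₂ λ V W → (V ++ W) ↭ U × total V ~ x
    SubsetSum-sublist [] {x} (done z) = [] , [] , ↭-refl , ~-sym (Z⇒~0 z)
    SubsetSum-sublist (u ∷ U) (skip s) = let V , W , π , q = SubsetSum-sublist U s in
      V , u ∷ W , ↭-trans (↭.shift u V W) (prep u π) , q
    SubsetSum-sublist (u ∷ U) {x} (take s) = let V , W , π , q = SubsetSum-sublist U s in
      u ∷ V , W , prep u π , mk~ (Z-≡ (e u (total V) x) (un~ q))
      where e : ∀ u t x → t - (x - u) ≡ u + t - x
            e = solve-∀

    SubsetSum-replicate : ∀ k d {j} → j ℕ.≤ k → SubsetSum (replicate k d) (+ j * d)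
    SubsetSum-replicate k d {zero}  _ = SubsetSum-≡ (replicate k d) (sym (ℤ.*-zeroˡ d)) (SubsetSum-0 (replicate k d))
    SubsetSum-replicate (suc k) d {suc j} (s≤s j≤k) = take (SubsetSum-≡ (replicate k d)
      (e (+ j) d) (SubsetSum-replicate k d j≤k))
      where e : ∀ j d → j * d ≡ (+ 1 + j) * d - d
            e = solve-∀

    SubsetSum-replicate⁻ : ∀ k d {x} → SubsetSum (replicate k d) x → ∃[ j ] j ℕ.≤ k × x ~ + j * d
    SubsetSum-replicate⁻ zero    d {x} (done z) = 0 , z≤n , mk~ (Z-≡ (e x d) z)
      where e : ∀ x d → x ≡ x - + 0 * d
            e = solve-∀
    SubsetSum-replicate⁻ (suc k) d (skip s) = let j , j≤k , q = SubsetSum-replicate⁻ k d s in j , ℕ.m≤n⇒m≤1+n j≤k , q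
    SubsetSum-replicate⁻ (suc k) d {x} (take s) = let j , j≤k , q = SubsetSum-replicate⁻ k d s in
      suc j , s≤s j≤k , mk~ (Z-≡ (e x d (+ j)) (un~ q))
      where e : ∀ x d j → x - d - j * d ≡ x - (+ 1 + j) * d
            e = solve-∀

  replicate-+ : ∀ {A : Set} m n (x : A) → replicate (m ℕ.+ n) x ≡ replicate m x ++ replicate n x
  replicate-+ zero    n x = refl
  replicate-+ (suc m) n x = cong (x ∷_) (replicate-+ m n x)

  replicate-split : ∀ {A : Set} {m n} (x : A) → m ℕ.≤ n → replicate n x ≡ replicate m x ++ replicate (n ℕ.∸ m) x
  replicate-split {m = m} {n} x m≤n =
    trans (cong (λ k → replicate k x) (sym (ℕ.m+[n∸m]≡n m≤n))) (replicate-+ m (n ℕ.∸ m) x)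

  -- The explicit slack `k` turns a contradictory inequality into an equation that the ring solver
  -- can settle.
  ≤-absurd : ∀ {a b k} → a ℕ.≤ b → a ≡ suc (b ℕ.+ k) → ⊥
  ≤-absurd {a} {b} {k} a≤b eq = ℕ.m+1+n≰m b (subst (ℕ._≤ b) (trans eq (sym (ℕ.+-suc b k))) a≤b)

  module _ {P : ℕ → Set} (P? : ∀ i → Dec (P i)) where

    first-failure : ∀ n → (∀ {i} → i ℕ.≤ n → P i) ⊎
      (∃[ m ] m ℕ.< n × (∀ {i} → i ℕ.≤ m → P i) × ¬ P (suc m)) ⊎ ¬ P 0
    first-failure zero with P? 0
    ... | yes P0 = inj₁ λ { z≤n → P0 }
    ... | no ¬P0 = inj₂ (inj₂ ¬P0)
    first-failure (suc n) with first-failure n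
    ... | inj₂ (inj₁ (m , m<n , r)) = inj₂ (inj₁ (m , ℕ.m<n⇒m<1+n m<n , r))
    ... | inj₂ (inj₂ ¬P0)           = inj₂ (inj₂ ¬P0)
    ... | inj₁ below with P? (suc n)
    ...   | no ¬Psn = inj₂ (inj₁ (n , ℕ.≤-refl , below , ¬Psn))
    ...   | yes Psn = inj₁ λ {i} i≤sn → case ℕ.m≤n⇒m<n∨m≡n i≤sn of λ where
              (inj₁ i<sn) → below (ℕ.≤-pred i<sn)
              (inj₂ refl) → Psn

    failure-after-0 : ∀ n → P 0 → ¬ P n → ∃[ m ] m ℕ.< n × (∀ {i} → i ℕ.≤ m → P i) × ¬ P (suc m)
    failure-after-0 n P0 ¬Pn with first-failure n
    ... | inj₁ below         = contradiction (below ℕ.≤-refl) ¬Pn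
    ... | inj₂ (inj₁ found)  = found
    ... | inj₂ (inj₂ ¬P0)    = contradiction P0 ¬P0

  failure-between : ∀ {P : ℕ → Set} (P? : ∀ i → Dec (P i)) s n → s ℕ.≤ n → P s → ¬ P n →
    ∃[ m ] s ℕ.≤ m × m ℕ.< n × P m × ¬ P (suc m)
  failure-between {P} P? s n s≤n Ps ¬Pn =
    let m , m<n∸s , below , ¬Psm = failure-after-0 (λ i → P? (s ℕ.+ i)) (n ℕ.∸ s)
          (subst P (sym (ℕ.+-identityʳ s)) Ps) (¬Pn ∘ subst P (ℕ.m+[n∸m]≡n s≤n))
    in s ℕ.+ m , ℕ.m≤m+n s m
     , subst (s ℕ.+ m ℕ.<_) (ℕ.m+[n∸m]≡n s≤n) (ℕ.+-monoʳ-< s m<n∸s)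
     , below ℕ.≤-refl , (¬Psm ∘ subst P (sym (ℕ.+-suc s m)))

  -- How one more term increases the number of subset sums.

  module SumGrowth (p : ℕ) (prime : Prime p) where

    open Residues p prime

    -- What the combinatorial part uses of an unsplittable sequence, stated for its integer
    -- coefficients. In `minimal` the patterns `u ∷ U` and `r ∷ R` make both parts nonempty; `full`
    -- says that splitting `k` into - x and k + x fails for every x; `canonical` reflects that the
    -- representatives are chosen in 1, ..., p.
    record Unsplittableᶻ (K : List ℤ) : Set where
      field
        zero-sum  : Z (total K)
        minimal   : ∀ u U r R → (u ∷ U) ++ (r ∷ R) ↭ K → ¬ Z (total (u ∷ U))
        full      : ∀ k T → k ∷ T ↭ K → ∀ x → SubsetSum T x
        canonical : ∀ {x y} → x ∈ K → y ∈ K → x ~ y → x ≡ y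
        size      : p ≡ 1 ℕ.+ 2 ℕ.* length K

    record ManySums (U : List ℤ) (n : ℕ) : Set where
      constructor many-sums
      field
        sums     : List ℤ
        many     : n ℕ.≤ length sums
        distinct : Distinct sums
        areSums  : All (SubsetSum U) sums

    -- Each listed x yields the sum x + r of `r ∷ U`, which is not a sum of `U`. The number of exits
    -- therefore bounds from below the gain of adding r.
    record Exits (r : ℤ) (U : List ℤ) (n : ℕ) : Set where
      constructor exits
      field
        sums     : List ℤ
        many     : n ℕ.≤ length sums
        distinct : Distinct sums
        areSums  : All (SubsetSum U) sums
        leave    : All (λ x → ¬ SubsetSum U (x + r)) sums

    ManySums-[] : ManySums [] 1
    ManySums-[] = many-sums (0ℤ ∷ []) ℕ.≤-refl ([] ∷ []) (done Z-0 ∷ [])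

    shift-cancel : ∀ {x y r} → x + r ~ y + r → x ~ y
    shift-cancel {x} {y} {r} (mk~ z) = mk~ (Z-≡ (e x y r) z)
      where e : ∀ x y r → x + r - (y + r) ≡ x - y
            e = solve-∀

    ManySums-∷ : ∀ {r U m n} → Exits r U m → ManySums U n → ManySums (r ∷ U) (m ℕ.+ n)
    ManySums-∷ {r} {U} {m} {n} (exits E m≤ dE sE leave) (many-sums L n≤ dL sL) =
      many-sums (List.map (_+ r) E ++ L)
        (subst (m ℕ.+ n ℕ.≤_)
          (sym (trans (List.length-++ (List.map (_+ r) E)) (cong (ℕ._+ length L) (List.length-map (_+ r) E))))
          (ℕ.+-mono-≤ m≤ n≤))
        (AllPairs.++⁺ (AllPairs.map⁺ (AllPairs.map (λ x≁y → x≁y ∘ shift-cancel) dE)) dL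
          (All.map⁺ (All.map (λ {x} ∉U → All.map (λ {l} l∈U x+r~l → ∉U (SubsetSum-resp U (~-sym x+r~l) l∈U)) sL) leave)))
        (All.++⁺ (All.map⁺ (All.map (λ {x} s → take (SubsetSum-≡ U (e x r) s)) sE)) (All.map skip sL))
      where e : ∀ x r → x ≡ x + r - r
            e = solve-∀

    record Progression (d : ℤ) (U : List ℤ) : Set where
      constructor progression
      field
        last    : ℕ
        last<p  : suc last ℕ.< p
        inside  : ∀ {x} → SubsetSum U x → ∃[ i ] i ℕ.≤ last × x ~ + i * d
        onto    : ∀ {i} → i ℕ.≤ last → SubsetSum U (+ i * d)

    progression-size : ∀ {d U n} (pr : Progression d U) → ManySums U n → n ℕ.≤ suc (Progression.last pr)
    progression-size {d} (progression B _ inside _) (many-sums L n≤ dL sL) = ℕ.≤-trans n≤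
      (pigeonhole-list {P = λ x i → x ~ + i * d} L dL
        (All.map (λ s → let i , i≤B , q = inside s in i , s≤s i≤B , q) sL)
        (λ p q → ~-trans p (~-sym q)))

    -- The partial multiples 0, d, 2d, … of d leave the set of subset sums before reaching
    -- -d; a subset sum outside this first run starts a second run, which also has an exit.
    exits-or-progression : ∀ d U → ¬ Z d → ¬ SubsetSum U (- d) → Exits d U 2 ⊎ Progression d U
    exits-or-progression d U ¬Zd -d∉ = result (failure-after-0 P? n (SubsetSum-≡ U (sym (ℤ.*-zeroˡ d)) (SubsetSum-0 U)) ¬Pn)
      where
      n = ℕ.pred p
      p≡ : p ≡ suc n
      p≡ = sym (ℕ.suc-pred p)
      P : ℕ → Set
      P i = SubsetSum U (+ i * d)
      P? : ∀ i → Dec (P i)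
      P? i = SubsetSum? U (+ i * d)
      ¬Pn : ¬ P n
      ¬Pn s = -d∉ (SubsetSum-resp U (mk~ (Z-≡ (trans (ℤ.*-comm d (+ p)) (trans (cong (λ k → + k * d) p≡) (e (+ n) d))) (∣n⇒∣m*n d Z-p))) s)
        where e : ∀ n d → (+ 1 + n) * d ≡ n * d - - d
              e = solve-∀
      step : ∀ i → + i * d + d ≡ + suc i * d
      step i = e (+ i) d
        where e : ∀ i d → i * d + d ≡ (+ 1 + i) * d
              e = solve-∀
      leaves : ∀ i → ¬ P (suc i) → ¬ SubsetSum U (+ i * d + d)
      leaves i ¬P s = ¬P (SubsetSum-≡ U (step i) s)
      result : (∃[ B ] B ℕ.< n × (∀ {i} → i ℕ.≤ B → P i) × ¬ P (suc B)) → Exits d U 2 ⊎ Progression d U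
      result (B , B<n , below , ¬PsB) with ℕ.anyUpTo? (λ s → (suc B ℕ.<? s) ×-dec P? s) n
      ... | yes (s , s<n , B<s , Ps) =
        let t , s≤t , t<n , Pt , ¬Pst = failure-between P? s n (ℕ.<⇒≤ s<n) Ps ¬Pn in
        inj₁ (exits (+ B * d ∷ + t * d ∷ []) ℕ.≤-refl
          (((λ q → ℕ.<⇒≢ (ℕ.<-≤-trans (ℕ.<-trans (ℕ.n<1+n B) B<s) s≤t)
               (multiple-inj {d} {B} {t} ¬Zd (ℕ.<-trans B<n n<p) (ℕ.<-trans t<n n<p) q)) ∷ []) ∷ [] ∷ [])
          (below ℕ.≤-refl ∷ Pt ∷ []) (leaves B ¬PsB ∷ leaves t ¬Pst ∷ []))
        where n<p : n ℕ.< p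
              n<p = ℕ.≤-reflexive (sym p≡)
      ... | no none = inj₂ (progression B (subst (suc B ℕ.<_) (sym p≡) (s≤s B<n)) inside below)
        where
        inside : ∀ {x} → SubsetSum U x → ∃[ i ] i ℕ.≤ B × x ~ + i * d
        inside {x} Ux = let s , s<p , x~sd = multiple {d} ¬Zd x in s , near s<p (SubsetSum-resp U x~sd Ux) , x~sd
          where
          near : ∀ {s} → s ℕ.< p → P s → s ℕ.≤ B
          near {s} s<p Ps = ℕ.≮⇒≥ λ B<s → [ far , (λ sB≡s → ¬PsB (subst P (sym sB≡s) Ps)) ]′ (ℕ.m≤n⇒m<n∨m≡n B<s)
            where
            far : ¬ suc B ℕ.< s
            far sB<s = [ (λ s<n → none (s , s<n , sB<s , Ps)) , (λ s≡n → ¬Pn (subst P s≡n Ps)) ]′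
              (ℕ.m≤n⇒m<n∨m≡n (ℕ.≤-pred (subst (s ℕ.<_) p≡ s<p)))

  -- From a surplus of subset sums to a contradiction.

  extract : ∀ {A : Set} {P : A → Set} {L : List A} → Any.Any P L → ∃₂ λ x M → P x × x ∷ M ↭ L
  extract (here {x = x} {xs} px) = x , xs , px , ↭-refl
  extract (there {x = y} i) = let x , M , px , π = extract i in
    x , y ∷ M , px , ↭-trans (swap x y ↭-refl) (prep y π)

  all-equal : ∀ {A : Set} {x : A} {L} → All (_≡ x) L → L ≡ replicate (length L) x
  all-equal []           = refl
  all-equal (refl ∷ eqs) = cong (_ ∷_) (all-equal eqs)

  module Unsplittable (p : ℕ) (prime : Prime p) (K : List ℤ)
    (unsplittable : SumGrowth.Unsplittableᶻ p prime K) where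

    open Residues p prime
    open SumGrowth p prime
    open Unsplittableᶻ unsplittable

    nonzero : ∀ {q r R} → q ∷ r ∷ R ↭ K → ¬ Z q
    nonzero {q} {r} {R} π z = minimal q [] r R π (Z-≡ (sym (ℤ.+-identityʳ q)) z)

    -- The part of `U` with the opposite sum would complete `q ∷ Q` to a zero-sum subsequence, a
    -- proper one because `r` is left over.
    no-negative : ∀ q Q U r W → (q ∷ Q) ++ U ++ (r ∷ W) ↭ K → ¬ SubsetSum U (- total (q ∷ Q))
    no-negative q Q U r W π s = let V , X , ρ , mk~ tV = SubsetSum-sublist U s in
      minimal q (Q ++ V) r (X ++ W)
        (↭-trans (Perm.solve 6 (λ q Q V r X W → ((q ⊕ Q) ⊕ V) ⊕ (r ⊕ (X ⊕ W)) ⊜ (q ⊕ Q) ⊕ ((V ⊕ X) ⊕ (r ⊕ W)))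
            ↭-refl [ q ] Q V [ r ] X W)
          (↭-trans (↭.++⁺ˡ (q ∷ Q) (↭.++⁺ʳ (r ∷ W) ρ)) π))
        (Z-≡ (trans (e (total V) (total (q ∷ Q))) (sym (total-++ (q ∷ Q) V))) tV)
      where e : ∀ v q → v - - q ≡ q + v
            e = solve-∀

    no-opposite : ∀ {q U r W} → q ∷ U ++ (r ∷ W) ↭ K → ¬ SubsetSum U (- q)
    no-opposite {q} {U} {r} {W} π s =
      no-negative q [] U r W π (SubsetSum-≡ U (cong -_ (sym (ℤ.+-identityʳ q))) s)

    no-negative-multiple : ∀ q k d U r W → (q ∷ replicate k d) ++ U ++ (r ∷ W) ↭ K → ¬ SubsetSum U (- (q + + k * d))
    no-negative-multiple q k d U r W π s =
      no-negative q (replicate k d) U r W π (SubsetSum-≡ U (cong (λ t → - (q + t)) (sym (total-replicate k d))) s)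

    distinct : ∀ {q r R} → q ∷ r ∷ R ↭ K → q ≢ r → ¬ q ~ r
    distinct π q≢r q~r = q≢r (canonical (↭.∈-resp-↭ π (here refl)) (↭.∈-resp-↭ π (there (here refl))) q~r)

    -- Splitting c = sd into d and (s - 1)d must create a proper zero-sum subsequence. If it uses
    -- the new d, then either some d of S is left over and can replace it, or all k copies
    -- are used and the complement together with s - 1 copies of d sums to zero.
    multiple-not-small : ∀ c k d U {s} → c ∷ replicate k d ++ U ↭ K → 2 ℕ.≤ s → s ℕ.≤ suc k → ¬ c ~ + s * d
    multiple-not-small c k d U {suc (suc s)} π 2≤s s≤k c~sd =
      let y , Ry , Uz = SubsetSum-++⁻ (replicate k d) U (full c _ π (- d))
          j , j≤k , y~jd = SubsetSum-replicate⁻ k d Ry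
      in [ (λ j<k → no-negative-multiple d j d U c (replicate (k ℕ.∸ suc j) d) (using-all-but j j<k)
              (SubsetSum-resp U (~-trans (~-- (~-refl { - d}) y~jd) (~-reflexive (e₁ d (+ j)))) Uz))
         , (λ j≡k → no-negative-multiple d s d U c (replicate (k ℕ.∸ suc s) d) (using-all-but s (ℕ.≤-pred s≤k))
              (SubsetSum-resp U (rest (subst (λ i → y ~ + i * d) j≡k y~jd)) (SubsetSum-complement U Uz))) ]′
         (ℕ.m≤n⇒m<n∨m≡n j≤k)
      where
      e₁ : ∀ d j → - d - j * d ≡ - (d + j * d)
      e₁ = solve-∀
      using-all-but : ∀ j → j ℕ.< k → d ∷ replicate j d ++ U ++ (c ∷ replicate (k ℕ.∸ suc j) d) ↭ K
      using-all-but j j<k = ↭-trans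
        (Perm.solve 4 (λ D U c E → D ⊕ (U ⊕ (c ⊕ E)) ⊜ c ⊕ ((D ⊕ E) ⊕ U)) ↭-refl
          (replicate (suc j) d) U [ c ] (replicate (k ℕ.∸ suc j) d))
        (subst (λ L → c ∷ L ++ U ↭ K) (replicate-split d j<k) π)
      rest : ∀ {y} → y ~ + k * d → total U - (- d - y) ~ - (d + + s * d)
      rest {y} (mk~ y~) = mk~ (Z-≡ (e₂ c (total U) y (+ k) (+ s) d)
        (∣m∣n⇒∣m-n (∣m∣n⇒∣m+n
          (Z-≡ (trans (sym (total-↭ π)) (cong (_+_ c) (trans (total-++ (replicate k d) U) (cong (_+ total U) (total-replicate k d))))) zero-sum)
          y~) (un~ c~sd)))
        where e₂ : ∀ c u y k s d → ((c + (k * d + u)) + (y - k * d)) - (c - (+ 2 + s) * d) ≡ u - (- d - y) - - (d + s * d)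
              e₂ = solve-∀
    multiple-not-small c k d U {suc zero} π (s≤s ())

    -- Here - (c + jd) is (p - s - j)d. If s + J + B were at least p, then j = J, or j = p - s when
    -- s + J already exceeds p, would put p - s - j into 0, ..., B.
    progression-beyond : ∀ {c d s U} J (P : Progression d U) → s ℕ.≤ p → c ~ + s * d →
      (∀ {j} → j ℕ.≤ J → ¬ SubsetSum U (- (c + + j * d))) → s ℕ.+ J ℕ.+ Progression.last P ℕ.< p
    progression-beyond {c} {d} {s} {U} J (progression B _ _ onto) s≤p c~sd none = ℕ.≰⇒> λ p≤ →
      case ℕ.≤-total (s ℕ.+ J) p of λ where
        (inj₁ s+J≤p) → none ℕ.≤-refl (SubsetSum-resp U (wrap J _ (ℕ.m+[n∸m]≡n s+J≤p))
          (onto (ℕ.m≤n+o⇒m∸n≤o p (s ℕ.+ J) p≤)))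
        (inj₂ p≤s+J) → none (ℕ.m≤n+o⇒m∸n≤o p s p≤s+J)
          (SubsetSum-resp U (wrap (p ℕ.∸ s) 0 (trans (ℕ.+-identityʳ _) (ℕ.m+[n∸m]≡n s≤p))) (onto z≤n))
      where
      wrap : ∀ j i → s ℕ.+ j ℕ.+ i ≡ p → + i * d ~ - (c + + j * d)
      wrap j i eq = mk~ (Z-≡ (e (+ s) (+ j) (+ i) d c)
        (∣m∣n⇒∣m+n (un~ c~sd) (∣n⇒∣m*n d (subst (λ n → Z (+ n)) (sym eq) Z-p))))
        where e : ∀ s j i d c → (c - s * d) + d * (s + j + i) ≡ i * d - - (c + j * d)
              e = solve-∀

    -- Write c = sd. Then s ≥ 2 as c is neither 0 nor d, and `progression-beyond` keeps s + B below
    -- p. Adding c to the last two sums Bd and (B - 1)d thus overshoots the progression without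
    -- wrapping around.
    progression-exits : ∀ {c d g R U n} → (c ∷ d ∷ g ∷ R) ++ U ↭ K → c ≢ d → (P : Progression d U) →
      ManySums U (2 ℕ.+ n) → Exits c U 2
    progression-exits {c} {d} {g} {R} {U} {n} π c≢d P L = result P
      (ℕ.≤-pred (ℕ.≤-trans (s≤s (s≤s z≤n)) (progression-size P L)))
      (multiple {d} d≢0 c) (λ {s} → progression-beyond {s = s} 1 P)
      where
      d≢0 : ¬ Z d
      d≢0 = nonzero (↭-trans (swap d c ↭-refl) π)
      none : ∀ {j} → j ℕ.≤ 1 → ¬ SubsetSum U (- (c + + j * d))
      none z≤n = no-negative-multiple c 0 d U d (g ∷ R)
        (↭-trans (Perm.solve 3 (λ c U R → c ⊕ (U ⊕ R) ⊜ (c ⊕ R) ⊕ U) ↭-refl [ c ] U (d ∷ g ∷ R)) π)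
      none (s≤s z≤n) = no-negative-multiple c 1 d U g R
        (↭-trans (Perm.solve 3 (λ c U R → c ⊕ (U ⊕ R) ⊜ (c ⊕ R) ⊕ U) ↭-refl (c ∷ d ∷ []) U (g ∷ R)) π)
      result : (P : Progression d U) → 1 ℕ.≤ Progression.last P → (∃[ s ] s ℕ.< p × c ~ + s * d) →
        (∀ {s} → s ℕ.≤ p → c ~ + s * d → (∀ {j} → j ℕ.≤ 1 → ¬ SubsetSum U (- (c + + j * d))) → s ℕ.+ 1 ℕ.+ Progression.last P ℕ.< p) →
        Exits c U 2
      result _ _ (0 , _ , c~0) _ =
        contradiction (Z-≡ (e c d) (un~ c~0)) (nonzero π)
        where e : ∀ c d → c - + 0 * d ≡ c
              e = solve-∀
      result _ _ (1 , _ , c~d) _ =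
        contradiction (~-trans c~d (~-reflexive (ℤ.*-identityˡ d))) (distinct π c≢d)
      result (progression (suc B) B<p inside onto) _ (suc (suc s) , s<p , c~sd) beyond =
        exits (+ suc B * d ∷ + B * d ∷ []) ℕ.≤-refl
          (((λ q → ℕ.1+n≢n (multiple-inj {d} {suc B} {B} d≢0 (ℕ.<-trans (ℕ.n<1+n _) B<p)
              (ℕ.<-trans (ℕ.n<1+n _) (ℕ.<-trans (ℕ.n<1+n _) B<p)) q)) ∷ []) ∷ [] ∷ [])
          (onto ℕ.≤-refl ∷ onto (ℕ.n≤1+n B) ∷ [])
          (leaves ℕ.≤-refl (s≤s (s≤s (ℕ.≤-trans (ℕ.n≤1+n B) (ℕ.m≤n+m (suc B) s)))) ∷ leaves (ℕ.n≤1+n B) (s≤s (s≤s (ℕ.m≤n+m B s))) ∷ [])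
        where
        leaves : ∀ {t} → t ℕ.≤ suc B → suc (suc B) ℕ.≤ suc (suc s) ℕ.+ t → ¬ SubsetSum U (+ t * d + c)
        leaves {t} t≤B B<s+t st∈U = let i , i≤B , q = inside st∈U in
          ℕ.<⇒≱ B<s+t (subst (ℕ._≤ suc B)
            (multiple-inj {d} {i} {suc (suc s) ℕ.+ t} d≢0 (ℕ.≤-<-trans i≤B (ℕ.<-trans (ℕ.n<1+n _) B<p))
              (ℕ.≤-<-trans (ℕ.≤-trans (ℕ.+-monoʳ-≤ (suc (suc s)) t≤B) (ℕ.+-monoˡ-≤ (suc B) (ℕ.m≤m+n (suc (suc s)) 1)))
                (beyond (ℕ.<⇒≤ s<p) c~sd none))
              (~-trans (~-sym q) (mk~ (Z-≡ (e c (+ s) (+ t) d) (un~ c~sd)))))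
            i≤B)
          where e : ∀ c s t d → c - (+ 2 + s) * d ≡ t * d + c - (+ 2 + s + t) * d
                e = solve-∀

    ManySums-≡ : ∀ {U m n} → m ≡ n → ManySums U m → ManySums U n
    ManySums-≡ = subst (ManySums _)

    ManySums-weaken : ∀ {U m n} → m ℕ.≤ n → ManySums U n → ManySums U m
    ManySums-weaken m≤n (many-sums L many dL sL) = many-sums L (ℕ.≤-trans m≤n many) dL sL

    grow : ∀ {r U} → Exits r U 2 → ManySums U (4 ℕ.+ 2 ℕ.* length U) → ManySums (r ∷ U) (4 ℕ.+ 2 ℕ.* length (r ∷ U))
    grow {U = U} E L = ManySums-≡ (e (length U)) (ManySums-∷ E L)
      where e : ∀ u → 2 ℕ.+ (4 ℕ.+ 2 ℕ.* u) ≡ 4 ℕ.+ 2 ℕ.* suc u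
            e = ℕ-Ring.solve-∀

    -- Write c = sd and let {0, d, …, Bd} be the sums of U. Then s ≥ k + 4 by multiple-not-small, and
    -- s + k + 1 + B < p since no -(c + jd) is a sum of U; but B + 1 ≥ 2|U| + 4 = p - 2k - 3.
    stuck : ∀ {U c d} k → (c ∷ replicate (2 ℕ.+ k) d) ++ U ↭ K → c ≢ d → Progression d U →
      ¬ ManySums U (4 ℕ.+ 2 ℕ.* length U)
    stuck {U} {c} {d} k π c≢d P L = result (multiple {d} d≢0 c)
      where
      B = Progression.last P
      d≢0 : ¬ Z d
      d≢0 = nonzero (↭-trans (swap d c ↭-refl) π)
      none : ∀ {j} → j ℕ.≤ suc k → ¬ SubsetSum U (- (c + + j * d))
      none {j} j≤ = no-negative-multiple c j d U d (replicate (suc k ℕ.∸ j) d)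
        (↭-trans (Perm.solve 4 (λ c J U D → (c ⊕ J) ⊕ (U ⊕ D) ⊜ c ⊕ ((J ⊕ D) ⊕ U)) ↭-refl
            [ c ] (replicate j d) U (replicate (suc (suc k ℕ.∸ j)) d))
          (subst (λ M → c ∷ M ++ U ↭ K) (trans (cong (λ m → replicate m d) (split j≤)) (replicate-+ j _ d)) π))
        where split : ∀ {j} → j ℕ.≤ suc k → 2 ℕ.+ k ≡ j ℕ.+ suc (suc k ℕ.∸ j)
              split {j} j≤ = sym (trans (ℕ.+-suc j _) (cong suc (ℕ.m+[n∸m]≡n j≤)))
      p≡ : p ≡ 7 ℕ.+ 2 ℕ.* (k ℕ.+ length U)
      p≡ = trans size (trans (cong (λ n → 1 ℕ.+ 2 ℕ.* n)
        (trans (sym (↭.↭-length π)) (cong suc (trans (List.length-++ (replicate (2 ℕ.+ k) d))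
          (cong (ℕ._+ length U) (List.length-replicate (2 ℕ.+ k) {d}))))))
        (e k (length U)))
        where e : ∀ k u → 1 ℕ.+ 2 ℕ.* suc (2 ℕ.+ k ℕ.+ u) ≡ 7 ℕ.+ 2 ℕ.* (k ℕ.+ u)
              e = ℕ-Ring.solve-∀
      result : (∃[ s ] s ℕ.< p × c ~ + s * d) → ⊥
      result (s , s<p , c~sd) with s ℕ.≤? 3 ℕ.+ k
      ... | yes s≤ = small s s≤ c~sd
        where
        small : ∀ s → s ℕ.≤ 3 ℕ.+ k → ¬ c ~ + s * d
        small 0 _ c~0 = contradiction (Z-≡ (e c d) (un~ c~0)) (nonzero π)
          where e : ∀ c d → c - + 0 * d ≡ c
                e = solve-∀
        small 1 _ c~d = distinct π c≢d (~-trans c~d (~-reflexive (ℤ.*-identityˡ d)))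
        small (suc (suc s)) s≤ = multiple-not-small c (2 ℕ.+ k) d U π (s≤s (s≤s z≤n)) s≤
      ... | no s≰ = ≤-absurd {k = 1} (ℕ.+-mono-≤ (ℕ.+-mono-≤ (progression-beyond {s = s} (suc k) P (ℕ.<⇒≤ s<p) c~sd none)
                      (ℕ.≰⇒> s≰)) (progression-size P L))
          (trans (cong (λ q → suc (s ℕ.+ suc k ℕ.+ B) ℕ.+ (4 ℕ.+ k) ℕ.+ (4 ℕ.+ 2 ℕ.* length U)) p≡)
            (trans (e s B k (length U)) (cong (λ q → suc (q ℕ.+ s ℕ.+ suc B ℕ.+ 1)) (sym p≡))))
        where e : ∀ s B k u → suc (s ℕ.+ suc k ℕ.+ B) ℕ.+ (4 ℕ.+ k) ℕ.+ (4 ℕ.+ 2 ℕ.* u)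
                              ≡ suc (7 ℕ.+ 2 ℕ.* (k ℕ.+ u) ℕ.+ s ℕ.+ suc B ℕ.+ 1)
              e = ℕ-Ring.solve-∀

    -- If U has at least 2|U| + 4 subset sums (counting 0) and two different terms are left
    -- over, then U can be enlarged, each new term contributing at least two further
    -- sums, until there are more sums than residue classes.
    excess-absurd : ∀ n U c d R → length R ≡ n → (c ∷ d ∷ R) ++ U ↭ K → c ≢ d → ¬ ManySums U (4 ℕ.+ 2 ℕ.* length U)
    -- The classes - c and - d are not sums of `U`: for each of the two terms the other one is left
    -- over, so `no-opposite` applies.
    excess-absurd zero U c d [] _ π c≢d (many-sums L many dL sL) =
      ≤-absurd {k = 0} (ℕ.≤-trans (ℕ.+-monoʳ-≤ 2 many) (Distinct⇒length≤p {(- c) ∷ (- d) ∷ L}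
        ((((λ q → distinct π c≢d (neg-inj q))) ∷ outside (no-opposite (↭-trans
            (Perm.solve 3 (λ c U d → c ⊕ (U ⊕ d) ⊜ (c ⊕ d) ⊕ U) ↭-refl [ c ] U [ d ]) π)))
          ∷ outside (no-opposite (↭-trans (Perm.solve 3 (λ c U d → d ⊕ (U ⊕ c) ⊜ (c ⊕ d) ⊕ U) ↭-refl [ c ] U [ d ]) π))
          ∷ dL)))
        (trans (e (length U)) (sym (cong suc (trans (ℕ.+-identityʳ p) (trans size (cong (λ k → 1 ℕ.+ 2 ℕ.* k) (sym (↭.↭-length π))))))))
      where
      e : ∀ u → 2 ℕ.+ (4 ℕ.+ 2 ℕ.* u) ≡ suc (1 ℕ.+ 2 ℕ.* (2 ℕ.+ u))
      e = ℕ-Ring.solve-∀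
      neg-inj : ∀ {c d} → - c ~ - d → c ~ d
      neg-inj {c} {d} (mk~ z) = mk~ (Z-≡ (e′ c d) (∣m⇒∣-m z))
        where e′ : ∀ c d → - (- c - - d) ≡ c - d
              e′ = solve-∀
      outside : ∀ {x} → ¬ SubsetSum U x → All (λ y → ¬ x ~ y) L
      outside {x} x∉ = All.map (λ s x~y → x∉ (SubsetSum-resp U (~-sym x~y) s)) sL
    excess-absurd (suc n) U c d (f ∷ R) len π c≢d L =
      [ (λ E → excess-absurd n (f ∷ U) c d R len′
            (↭-trans (Perm.solve 4 (λ C f R U → (C ⊕ R) ⊕ (f ⊕ U) ⊜ (C ⊕ f ⊕ R) ⊕ U) ↭-refl (c ∷ d ∷ []) [ f ] R U) π)
            c≢d (grow E L))
      , cases ]′ (exits-or-progression f U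
          (nonzero (↭-trans (Perm.solve 4 (λ f c X U → f ⊕ c ⊕ X ⊕ U ⊜ (c ⊕ X ⊕ U ⊕ f)) ↭-refl [ f ] [ c ] [ d ] (R ++ U)) π-rot))
          (no-opposite (↭-trans (Perm.solve 4 (λ f U C R → f ⊕ U ⊕ C ⊕ R ⊜ (C ⊕ f ⊕ R) ⊕ U) ↭-refl [ f ] U (c ∷ d ∷ []) R) π)))
      where
      len′ : length R ≡ n
      len′ = ℕ.suc-injective len
      π-rot : c ∷ d ∷ (R ++ U) ++ [ f ] ↭ K
      π-rot = ↭-trans (Perm.solve 4 (λ C f R U → C ⊕ ((R ⊕ U) ⊕ f) ⊜ (C ⊕ f ⊕ R) ⊕ U) ↭-refl (c ∷ d ∷ []) [ f ] R U) π
      repeated : ∀ c d → (c ∷ d ∷ d ∷ R) ++ U ↭ K → c ≢ d → ¬ Progression d U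
      repeated c d π c≢d P with Any.any? (λ r → ¬? (r ℤ.≟ d)) R
      -- A third value r remains beside the copies of d: c is added to `U`, and r and d are the two
      -- different terms that stay outside.
      ... | yes i = let r , M , r≢d , ρ = extract i in
        excess-absurd n (c ∷ U) r d (d ∷ M) (trans (↭.↭-length ρ) len′)
          (↭-trans (Perm.solve 5 (λ r D M c U → (r ⊕ (D ⊕ M)) ⊕ (c ⊕ U) ⊜ c ⊕ D ⊕ ((r ⊕ M) ⊕ U)) ↭-refl [ r ] (d ∷ d ∷ []) M [ c ] U)
            (↭-trans (↭.++⁺ˡ (c ∷ d ∷ d ∷ []) (↭.++⁺ʳ U ρ)) π))
          r≢d (grow (progression-exits {R = R} π c≢d P L) L)
      -- Outside `U` there are only c and copies of d, so adding c would leave no two different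
      -- terms.
      ... | no none = stuck n (subst (λ M → (c ∷ d ∷ d ∷ M) ++ U ↭ K)
              (trans (all-equal (All.map (λ {x} → decidable-stable (x ℤ.≟ d)) (All.¬Any⇒All¬ R none))) (cong (λ k → replicate k d) len′)) π)
              c≢d P L
      cases : ¬ Progression f U
      cases P with c ℤ.≟ f | d ℤ.≟ f
      ... | yes refl | _ = repeated d c (↭-trans (Perm.solve 3 (λ c d X → d ⊕ c ⊕ c ⊕ X ⊜ c ⊕ d ⊕ c ⊕ X) ↭-refl [ c ] [ d ] (R ++ U)) π) (c≢d ∘ sym) P
      ... | no _ | yes refl = repeated c d π c≢d P
      -- The difference f of the progression is neither c nor d, so c has two exits; f takes its
      -- place among the two different terms.
      ... | no c≢f | no d≢f = excess-absurd n (c ∷ U) d f R len′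
            (↭-trans (Perm.solve 5 (λ c d f R U → (d ⊕ f ⊕ R) ⊕ (c ⊕ U) ⊜ (c ⊕ d ⊕ f ⊕ R) ⊕ U) ↭-refl [ c ] [ d ] [ f ] R U) π)
            d≢f (grow (progression-exits {R = R} (↭-trans (Perm.solve 4 (λ c d f X → c ⊕ f ⊕ d ⊕ X ⊜ c ⊕ d ⊕ f ⊕ X) ↭-refl [ c ] [ d ] [ f ] (R ++ U)) π) c≢f P L) L)

  -- A value of high multiplicity or many distinct values.

  collect : ∀ (x : ℤ) L → ∃₂ λ m R → replicate m x ++ R ↭ L × All (_≢ x) R
  collect x []      = 0 , [] , ↭-refl , []
  collect x (y ∷ L) with collect x L | y ℤ.≟ x
  ... | m , R , π , ≢x | yes refl = suc m , R , prep x π , ≢x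
  ... | m , R , π , ≢x | no y≢x   = m , y ∷ R , ↭-trans (↭.shift y (replicate m x) R) (prep y π) , y≢x ∷ ≢x

  Repeated : ℕ → List ℤ → Set
  Repeated n L = ∃[ a ] ∃₂ λ m R → n ℕ.≤ m × replicate m a ++ R ↭ L × All (_≢ a) R

  -- Removing all copies of one value, if there are at most n of them, preserves the bound with v
  -- lowered by one and contributes one distinct value.
  repeated-or-distinct : ∀ n v L → n ℕ.* v ℕ.< length L → Repeated (suc n) L ⊎
    (∃₂ λ V W → V ++ W ↭ L × length V ≡ suc v × AllPairs _≢_ V)
  repeated-or-distinct n zero    (x ∷ L) _ = inj₂ (x ∷ [] , L , ↭-refl , refl , [] ∷ [])
  repeated-or-distinct n (suc v) (x ∷ L) nv<∣L∣ with collect x L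
  ... | m , R , π , ≢x with n ℕ.≤? m
  ...   | yes n≤m = inj₁ (x , suc m , R , s≤s n≤m , prep x π , ≢x)
  ...   | no n≰m with repeated-or-distinct n v R (ℕ.+-cancelˡ-< n _ _ (ℕ.<-≤-trans
            (subst (ℕ._< suc (length L)) (ℕ.*-suc n v) nv<∣L∣)
            (subst (ℕ._≤ n ℕ.+ length R) (cong suc (trans (trans (cong (ℕ._+ length R) (sym (List.length-replicate m {x})))
              (sym (List.length-++ (replicate m x)))) (↭.↭-length π))) (ℕ.+-monoˡ-≤ (length R) (ℕ.≰⇒> n≰m)))))
  ...     | inj₂ (V , W , ρ , len , distinct) = inj₂ (x ∷ V , W ++ replicate m x
              , prep x (↭-trans (Perm.solve 3 (λ V W M → V ⊕ (W ⊕ M) ⊜ M ⊕ (V ⊕ W)) ↭-refl V W (replicate m x)) (↭-trans (↭.++⁺ˡ (replicate m x) ρ) π))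
              , cong suc len , All.map (λ y≢x x≡y → y≢x (sym x≡y)) (All.++⁻ˡ V (↭.All-resp-↭ (↭-sym ρ) ≢x)) ∷ distinct)
  ...     | inj₁ (a , suc k , R′ , n<k , ρ , ≢a) = inj₁ (a , suc k , x ∷ replicate m x ++ R′ , n<k
              , ↭-trans (Perm.solve 3 (λ A X R → A ⊕ (X ⊕ R) ⊜ X ⊕ (A ⊕ R)) ↭-refl (replicate (suc k) a) (replicate (suc m) x) R′)
                  (prep x (↭-trans (↭.++⁺ˡ (replicate m x) ρ) π))
              , All.++⁺ {xs = replicate (suc m) x} (All.replicate⁺ (suc m) (λ x≡a → All.head (↭.All-resp-↭ (↭-sym ρ) ≢x) (sym x≡a))) ≢a)

  AllPairs-↭ : ∀ {A : Set} {R : A → A → Set} → (∀ {x y} → R x y → R y x) →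
    ∀ {L M} → L ↭ M → AllPairs R L → AllPairs R M
  AllPairs-↭ R-sym ↭.refl         rs                     = rs
  AllPairs-↭ R-sym (prep x π)     (r ∷ rs)               = ↭.All-resp-↭ π r ∷ AllPairs-↭ R-sym π rs
  AllPairs-↭ R-sym (swap x y π)   ((rxy ∷ rx) ∷ ry ∷ rs) =
    (R-sym rxy ∷ ↭.All-resp-↭ π ry) ∷ ↭.All-resp-↭ π rx ∷ AllPairs-↭ R-sym π rs
  AllPairs-↭ R-sym (↭.trans π π′) rs                     = AllPairs-↭ R-sym π′ (AllPairs-↭ R-sym π rs)

  -- Differences of subset sums, and sequences with many distinct values.

  data Trit : Set where
    ⊝ ⊙ ⊞ : Trit

  trit : Trit → ℤ
  trit ⊝ = - + 1
  trit ⊙ = + 0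
  trit ⊞ = + 1

  dot : ∀ {k} → Vec Trit k → Vec ℤ k → ℤ
  dot []      []      = 0ℤ
  dot (τ ∷ ts) (u ∷ U) = trit τ * u + dot ts U

  module SignedSums (p : ℕ) (prime : Prime p) where

    open Residues p prime
    open SumGrowth p prime

    SubsetSum-difference : ∀ {k} (U : Vec ℤ k) {x y} → SubsetSum (toList U) x → SubsetSum (toList U) y → ∃[ τ ] y - x ~ dot τ U
    SubsetSum-difference [] {x} {y} (done s) (done t) = [] , Z⇒~0 (∣m∣n⇒∣m-n t s)
    SubsetSum-difference (u ∷ U) {x} {y} (skip s) (skip t) = let τ , mk~ q = SubsetSum-difference U s t in
      ⊙ ∷ τ , mk~ (Z-≡ (e x y u (dot τ U)) q)
      where e : ∀ x y u d → y - x - d ≡ y - x - (+ 0 * u + d)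
            e = solve-∀
    SubsetSum-difference (u ∷ U) {x} {y} (skip s) (take t) = let τ , mk~ q = SubsetSum-difference U s t in
      ⊞ ∷ τ , mk~ (Z-≡ (e x y u (dot τ U)) q)
      where e : ∀ x y u d → y - u - x - d ≡ y - x - (+ 1 * u + d)
            e = solve-∀
    SubsetSum-difference (u ∷ U) {x} {y} (take s) (skip t) = let τ , mk~ q = SubsetSum-difference U s t in
      ⊝ ∷ τ , mk~ (Z-≡ (e x y u (dot τ U)) q)
      where e : ∀ x y u d → y - (x - u) - d ≡ y - x - (- + 1 * u + d)
            e = solve-∀
    SubsetSum-difference (u ∷ U) {x} {y} (take s) (take t) = let τ , mk~ q = SubsetSum-difference U s t in
      ⊙ ∷ τ , mk~ (Z-≡ (e x y u (dot τ U)) q)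
      where e : ∀ x y u d → y - u - (x - u) - d ≡ y - x - (+ 0 * u + d)
            e = solve-∀

    -- If r is no difference of two sums of `U`, every sum of `U` is an exit.
    ManySums-double : ∀ {k} (U : Vec ℤ k) {r n} → (∀ τ → ¬ r ~ dot τ U) → ManySums (toList U) n → ManySums (r ∷ toList U) (n ℕ.+ n)
    ManySums-double U {r} ¬r~ L@(many-sums sums many dL sL) = ManySums-∷ (exits sums many dL sL (All.map leave sL)) L
      where
      leave : ∀ {x} → SubsetSum (toList U) x → ¬ SubsetSum (toList U) (x + r)
      leave {x} s t = let τ , mk~ q = SubsetSum-difference U s t in ¬r~ τ (mk~ (Z-≡ (e x r (dot τ U)) q))
        where e : ∀ x r d → x + r - x - d ≡ r - d
              e = solve-∀

    -- Were every element of `V` congruent to an entry of `B`, two of them would share an entry and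
    -- hence be congruent.
    pick : ∀ B V → Distinct V → length B ℕ.< length V → ∃₂ λ v V′ → v ∷ V′ ↭ V × Distinct (v ∷ V′) × All (λ b → ¬ v ~ b) B
    pick B V distinct B<V with Any.any? (λ v → All.all? (λ b → ¬? (v ~? b)) B) V
    ... | yes i = let v , V′ , good , π = extract i in
        v , V′ , π , AllPairs-↭ (λ x≁y y~x → x≁y (~-sym y~x)) (↭-sym π) distinct , good
    ... | no none = contradiction (pigeonhole-list {P = λ v i → ∃[ j ] toℕ {length B} j ≡ i × v ~ lookup B j} V distinct
          (All.map hit (All.¬Any⇒All¬ V none)) same) (ℕ.<⇒≱ B<V)
      where
      hit : ∀ {v} → ¬ All (λ b → ¬ v ~ b) B → ∃[ i ] i ℕ.< length B × ∃[ j ] toℕ {length B} j ≡ i × v ~ lookup B j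
      hit {v} ¬all = let i = All.¬All⇒Any¬ (λ b → ¬? (v ~? b)) B ¬all; j = Any.index i in
        toℕ j , Fin.toℕ<n j , j , refl , decidable-stable (v ~? lookup B j) (Any.lookup-index i)
      same : ∀ {x y i} → (∃[ j ] toℕ {length B} j ≡ i × x ~ lookup B j) → (∃[ j ] toℕ {length B} j ≡ i × y ~ lookup B j) → x ~ y
      same {x} {y} (j , eq , q) (j′ , eq′ , q′) =
        ~-trans q (~-sym (subst (λ k → y ~ lookup B k) (Fin.toℕ-injective (trans eq′ (sym eq))) q′))

    minus : Bool → Bool → Trit
    minus false false = ⊙
    minus false true  = ⊝
    minus true  false = ⊞
    minus true  true  = ⊙

    _⊖ᵇ_ : ∀ {k} → Vec Bool k → Vec Bool k → Vec Trit k
    _⊖ᵇ_ = Vec.zipWith minus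

    pos neg : ∀ {k} → Vec Bool k → Vec Trit k
    pos = Vec.map (λ b → minus b false)
    neg = Vec.map (λ b → minus false b)

    SubsetSum-pos : ∀ {k} (U : Vec ℤ k) β → SubsetSum (toList U) (dot (pos β) U)
    SubsetSum-pos []      []          = done Z-0
    SubsetSum-pos (u ∷ U) (false ∷ β) = skip (SubsetSum-≡ (toList U) (e u (dot (pos β) U)) (SubsetSum-pos U β))
      where e : ∀ u d → d ≡ + 0 * u + d
            e = solve-∀
    SubsetSum-pos (u ∷ U) (true ∷ β)  = take (SubsetSum-≡ (toList U) (e u (dot (pos β) U)) (SubsetSum-pos U β))
      where e : ∀ u d → d ≡ + 1 * u + d - u
            e = solve-∀

    neg-pos : ∀ {k} (U : Vec ℤ k) β → dot (neg β) U ≡ - dot (pos β) U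
    neg-pos []      []          = refl
    neg-pos (u ∷ U) (false ∷ β) = trans (cong (_+_ (+ 0 * u)) (neg-pos U β)) (e u (dot (pos β) U))
      where e : ∀ u d → + 0 * u + - d ≡ - (+ 0 * u + d)
            e = solve-∀
    neg-pos (u ∷ U) (true ∷ β)  = trans (cong (_+_ (- + 1 * u)) (neg-pos U β)) (e u (dot (pos β) U))
      where e : ∀ u d → - + 1 * u + - d ≡ - (+ 1 * u + d)
            e = solve-∀

    ≁-neg : ∀ {k} (U : Vec ℤ k) {r} → ¬ SubsetSum (toList U) (- r) → ∀ β → ¬ r ~ dot (neg β) U
    ≁-neg U {r} -r∉U β (mk~ z) = -r∉U (SubsetSum-resp (toList U)
      (mk~ (Z-≡ (trans (cong (_-_ r) (neg-pos U β)) (e r (dot (pos β) U))) z)) (SubsetSum-pos U β))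
      where e : ∀ r d → r - - d ≡ d - - r
            e = solve-∀

    -- For a fixed sum, chosen by β, adding r fails to leave the set of sums only if r is one of the
    -- 2^k differences ε - β. Prescribing β keeps the list of values to be avoided short.
    SubsetSum-pos+ : ∀ {k} (U : Vec ℤ k) β {r} → SubsetSum (toList U) (dot (pos β) U + r) → ∃[ ε ] r ~ dot (ε ⊖ᵇ β) U
    SubsetSum-pos+ [] [] {r} (done z) = [] , mk~ (Z-≡ (e r) z)
      where e : ∀ r → + 0 + r ≡ r - + 0
            e = solve-∀
    SubsetSum-pos+ (u ∷ U) (b ∷ β) {r} (skip s) =
      let ε , mk~ q = SubsetSum-pos+ U β {t * u + r} (SubsetSum-≡ (toList U) (e t u (dot (pos β) U) r) s) in
      false ∷ ε , mk~ (Z-≡ (trans (e′ t u (dot (ε ⊖ᵇ β) U) r) (cong (λ t → r - (t * u + dot (ε ⊖ᵇ β) U)) (-b b))) q)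
      where
      t = trit (minus b false)
      -b : ∀ b → - trit (minus b false) ≡ trit (minus false b)
      -b false = refl
      -b true  = refl
      e : ∀ t u d r → t * u + d + r ≡ d + (t * u + r)
      e = solve-∀
      e′ : ∀ t u d r → t * u + r - d ≡ r - (- t * u + d)
      e′ = solve-∀
    SubsetSum-pos+ (u ∷ U) (b ∷ β) {r} (take s) =
      let ε , mk~ q = SubsetSum-pos+ U β {t * u + r - u} (SubsetSum-≡ (toList U) (e t u (dot (pos β) U) r) s) in
      true ∷ ε , mk~ (Z-≡ (trans (e′ t u (dot (ε ⊖ᵇ β) U) r) (cong (λ t → r - (t * u + dot (ε ⊖ᵇ β) U)) (1-b b))) q)
      where
      t = trit (minus b false)
      1-b : ∀ b → + 1 - trit (minus b false) ≡ trit (minus true b)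
      1-b false = refl
      1-b true  = refl
      e : ∀ t u d r → t * u + d + r - u ≡ d + (t * u + r - u)
      e = solve-∀
      e′ : ∀ t u d r → t * u + r - u - d ≡ r - ((+ 1 - t) * u + d)
      e′ = solve-∀

  module Diverse (p : ℕ) (prime : Prime p) (K : List ℤ) (unsplittable : SumGrowth.Unsplittableᶻ p prime K) where

    open Residues p prime
    open SumGrowth p prime
    open Unsplittableᶻ unsplittable
    open Unsplittable p prime K unsplittable
    open SignedSums p prime

    ≁-zero : ∀ {q k} (U : Vec ℤ k) → ¬ Z q → ¬ q ~ dot (Vec.replicate k ⊙) U
    ≁-zero []      q≢0 q~0 = q≢0 (~0⇒Z q~0)
    ≁-zero {q} {suc k} (u ∷ U) q≢0 (mk~ z) = ≁-zero U q≢0 (mk~ (Z-≡ (e q u (dot (Vec.replicate k ⊙) U)) z))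
      where e : ∀ q u d → q - (+ 0 * u + d) ≡ q - d
            e = solve-∀

    ~-drop : ∀ {q u x} → q ~ + 0 * u + x → q ~ x
    ~-drop {q} {u} {x} (mk~ z) = mk~ (Z-≡ (e q u x) z)
      where e : ∀ q u x → q - (+ 0 * u + x) ≡ q - x
            e = solve-∀

    ~-single : ∀ {q u k} (U : Vec ℤ k) → q ~ + 1 * u + dot (Vec.replicate k ⊙) U → q ~ u
    ~-single {q} {u} [] (mk~ z) = mk~ (Z-≡ (e q u) z)
      where e : ∀ q u → q - (+ 1 * u + + 0) ≡ q - u
            e = solve-∀
    ~-single {q} {u} {suc k} (v ∷ U) (mk~ z) = ~-single U (mk~ (Z-≡ (e q u v (dot (Vec.replicate k ⊙) U)) z))
      where e : ∀ q u v d → q - (+ 1 * u + (+ 0 * v + d)) ≡ q - (+ 1 * u + d)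
            e = solve-∀

    -- d contributes the new sums d, d + a, d + b + c, d + a + b + c unless it is one of 21 differences
    -- of sums of a, b, c; minimality and distinctness exclude eleven of these, so ten remain.
    forbiddenᶜ : ℤ → ℤ → List ℤ
    forbiddenᶜ a b = dot (⊞ ∷ ⊞ ∷ []) U ∷ dot (⊞ ∷ ⊝ ∷ []) U ∷ dot (⊝ ∷ ⊞ ∷ []) U ∷ []
      where U = b ∷ a ∷ []

    forbiddenᵈ : ℤ → ℤ → ℤ → List ℤ
    forbiddenᵈ a b c =
      dot (⊙ ∷ ⊞ ∷ ⊞ ∷ []) U
          ∷ dot (⊞ ∷ ⊙ ∷ ⊞ ∷ []) U
          ∷ dot (⊞ ∷ ⊞ ∷ ⊙ ∷ []) U
          ∷ dot (⊞ ∷ ⊞ ∷ ⊞ ∷ []) U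
          ∷ dot (⊙ ∷ ⊞ ∷ ⊝ ∷ []) U
          ∷ dot (⊞ ∷ ⊙ ∷ ⊝ ∷ []) U
          ∷ dot (⊞ ∷ ⊞ ∷ ⊝ ∷ []) U
          ∷ dot (⊝ ∷ ⊝ ∷ ⊞ ∷ []) U
          ∷ dot (⊝ ∷ ⊙ ∷ ⊞ ∷ []) U
          ∷ dot (⊙ ∷ ⊝ ∷ ⊞ ∷ []) U ∷ []
      where U = c ∷ b ∷ a ∷ []

    -- Doubling gives eight sums of a, b, c, and d adds four: 12 = 2 · 4 + 4. Only the exits 0, a, b
    -- + c and a + b + c are asked for, since making all eight sums exits would forbid sixteen
    -- values of d in place of ten.
    four-terms : ∀ a b c d r R → a ∷ b ∷ c ∷ d ∷ r ∷ R ↭ K → a ≢ b → a ≢ c → b ≢ c → a ≢ d → b ≢ d → c ≢ d →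
      All (λ x → ¬ c ~ x) (forbiddenᶜ a b) → All (λ x → ¬ d ~ x) (forbiddenᵈ a b c) → ManySums (d ∷ c ∷ b ∷ a ∷ []) 12
    four-terms a b c d r R π a≢b a≢c b≢c a≢d b≢d c≢d (c≁b+a ∷ c≁b-a ∷ c≁a-b ∷ [])
      (f₁ ∷ f₂ ∷ f₃ ∷ f₄ ∷ f₅ ∷ f₆ ∷ f₇ ∷ f₈ ∷ f₉ ∷ f₁₀ ∷ []) =
      ManySums-∷ (exits (at β₀ ∷ at β₁ ∷ at β₂ ∷ at β₃ ∷ [])
          ℕ.≤-refl
          (((a≢0 ∘ un-a) ∷ (c≁-b ∘ un-bc) ∷ (c≁-b-a ∘ un-abc) ∷ []) ∷ ((c≁a-b ∘ un-a-bc) ∷ (c≁-b ∘ un-a-abc) ∷ []) ∷ ((a≢0 ∘ un-bc-abc) ∷ []) ∷ [] ∷ [])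
          (SubsetSum-pos U β₀ ∷ SubsetSum-pos U β₁ ∷ SubsetSum-pos U β₂ ∷ SubsetSum-pos U β₃ ∷ [])
          (leave β₀ at-0 ∷ leave β₁ at-a ∷ leave β₂ at-bc ∷ leave β₃ at-abc ∷ []))
        (ManySums-double (b ∷ a ∷ []) free-c (ManySums-double (a ∷ []) free-b (ManySums-double [] free-a ManySums-[])))
      where
      U : Vec ℤ 3
      U = c ∷ b ∷ a ∷ []
      β₀ : Vec Bool 3
      β₀ = false ∷ false ∷ false ∷ []
      β₁ : Vec Bool 3
      β₁ = false ∷ false ∷ true ∷ []
      β₂ : Vec Bool 3
      β₂ = true ∷ true ∷ false ∷ []
      β₃ : Vec Bool 3
      β₃ = true ∷ true ∷ true ∷ []
      at : Vec Bool 3 → ℤ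
      at β = dot (pos β) U
      πᵇ : b ∷ a ∷ c ∷ d ∷ r ∷ R ↭ K
      πᵇ = ↭-trans (swap b a ↭-refl) π
      πᶜ : c ∷ b ∷ a ∷ d ∷ r ∷ R ↭ K
      πᶜ = ↭-trans (Perm.solve 4 (λ a b c R → c ⊕ b ⊕ a ⊕ R ⊜ a ⊕ b ⊕ c ⊕ R) ↭-refl [ a ] [ b ] [ c ] (d ∷ r ∷ R)) π
      πᵈ : d ∷ c ∷ b ∷ a ∷ r ∷ R ↭ K
      πᵈ = ↭-trans (Perm.solve 5 (λ a b c d R → d ⊕ c ⊕ b ⊕ a ⊕ R ⊜ a ⊕ b ⊕ c ⊕ d ⊕ R) ↭-refl [ a ] [ b ] [ c ] [ d ] (r ∷ R)) π
      ≁ : ∀ {x y} → x ∈ K → y ∈ K → y ≢ x → ¬ x ~ y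
      ≁ x∈ y∈ y≢x x~y = y≢x (sym (canonical x∈ y∈ x~y))
      a∈ = ↭.∈-resp-↭ πᵇ (there (here refl))
      b∈ = ↭.∈-resp-↭ πᵇ (here refl)
      c∈ = ↭.∈-resp-↭ πᶜ (here refl)
      d∈ = ↭.∈-resp-↭ πᵈ (here refl)
      a≢0 : ¬ Z a
      a≢0 = nonzero π
      free-a : ∀ τ → ¬ a ~ dot τ []
      free-a [] = a≢0 ∘ ~0⇒Z
      free-b : ∀ τ → ¬ b ~ dot τ (a ∷ [])
      free-b (⊝ ∷ []) = ≁-neg (a ∷ []) (no-opposite πᵇ) (true ∷ [])
      free-b (⊙ ∷ []) = ≁-zero (a ∷ []) (nonzero πᵇ)
      free-b (⊞ ∷ []) = ≁ b∈ a∈ a≢b ∘ ~-single []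
      opp-c : ∀ β → ¬ c ~ dot (neg β) (b ∷ a ∷ [])
      opp-c = ≁-neg (b ∷ a ∷ []) (no-opposite πᶜ)
      c≁-b = opp-c (true ∷ false ∷ [])
      c≁-b-a = opp-c (true ∷ true ∷ [])
      free-c : ∀ τ → ¬ c ~ dot τ (b ∷ a ∷ [])
      free-c (⊝ ∷ ⊝ ∷ []) = c≁-b-a
      free-c (⊝ ∷ ⊙ ∷ []) = c≁-b
      free-c (⊝ ∷ ⊞ ∷ []) = c≁a-b
      free-c (⊙ ∷ ⊝ ∷ []) = opp-c (false ∷ true ∷ [])
      free-c (⊙ ∷ ⊙ ∷ []) = ≁-zero (b ∷ a ∷ []) (nonzero πᶜ)
      free-c (⊙ ∷ ⊞ ∷ []) = ≁ c∈ a∈ a≢c ∘ ~-single [] ∘ ~-drop {c} {b}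
      free-c (⊞ ∷ ⊝ ∷ []) = c≁b-a
      free-c (⊞ ∷ ⊙ ∷ []) = ≁ c∈ b∈ b≢c ∘ ~-single (a ∷ [])
      free-c (⊞ ∷ ⊞ ∷ []) = c≁b+a
      opp : ∀ β → ¬ d ~ dot (neg β) U
      opp = ≁-neg U (no-opposite πᵈ)
      d≁0 : ¬ d ~ dot (⊙ ∷ ⊙ ∷ ⊙ ∷ []) U
      d≁0 = ≁-zero U (nonzero πᵈ)
      d≁a : ¬ d ~ dot (⊙ ∷ ⊙ ∷ ⊞ ∷ []) U
      d≁a = ≁ d∈ a∈ a≢d ∘ ~-single [] ∘ ~-drop {d} {b} ∘ ~-drop {d} {c}
      d≁b : ¬ d ~ dot (⊙ ∷ ⊞ ∷ ⊙ ∷ []) U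
      d≁b = ≁ d∈ b∈ b≢d ∘ ~-single (a ∷ []) ∘ ~-drop {d} {c}
      d≁c : ¬ d ~ dot (⊞ ∷ ⊙ ∷ ⊙ ∷ []) U
      d≁c = ≁ d∈ c∈ c≢d ∘ ~-single (b ∷ a ∷ [])
      leave : ∀ β → (∀ ε → ¬ d ~ dot (ε ⊖ᵇ β) U) → ¬ SubsetSum (toList U) (at β + d)
      leave β free s = let ε , q = SubsetSum-pos+ U β s in free ε q
      at-0 : ∀ ε → ¬ d ~ dot (ε ⊖ᵇ β₀) U
      at-0 (false ∷ false ∷ false ∷ []) = d≁0
      at-0 (false ∷ false ∷ true  ∷ []) = d≁a
      at-0 (false ∷ true  ∷ false ∷ []) = d≁b
      at-0 (false ∷ true  ∷ true  ∷ []) = f₁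
      at-0 (true  ∷ false ∷ false ∷ []) = d≁c
      at-0 (true  ∷ false ∷ true  ∷ []) = f₂
      at-0 (true  ∷ true  ∷ false ∷ []) = f₃
      at-0 (true  ∷ true  ∷ true  ∷ []) = f₄
      at-a : ∀ ε → ¬ d ~ dot (ε ⊖ᵇ β₁) U
      at-a (false ∷ false ∷ false ∷ []) = opp (false ∷ false ∷ true ∷ [])
      at-a (false ∷ false ∷ true  ∷ []) = d≁0
      at-a (false ∷ true  ∷ false ∷ []) = f₅
      at-a (false ∷ true  ∷ true  ∷ []) = d≁b
      at-a (true  ∷ false ∷ false ∷ []) = f₆
      at-a (true  ∷ false ∷ true  ∷ []) = d≁c
      at-a (true  ∷ true  ∷ false ∷ []) = f₇
      at-a (true  ∷ true  ∷ true  ∷ []) = f₃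
      at-bc : ∀ ε → ¬ d ~ dot (ε ⊖ᵇ β₂) U
      at-bc (false ∷ false ∷ false ∷ []) = opp (true ∷ true ∷ false ∷ [])
      at-bc (false ∷ false ∷ true  ∷ []) = f₈
      at-bc (false ∷ true  ∷ false ∷ []) = opp (true ∷ false ∷ false ∷ [])
      at-bc (false ∷ true  ∷ true  ∷ []) = f₉
      at-bc (true  ∷ false ∷ false ∷ []) = opp (false ∷ true ∷ false ∷ [])
      at-bc (true  ∷ false ∷ true  ∷ []) = f₁₀
      at-bc (true  ∷ true  ∷ false ∷ []) = d≁0
      at-bc (true  ∷ true  ∷ true  ∷ []) = d≁a
      at-abc : ∀ ε → ¬ d ~ dot (ε ⊖ᵇ β₃) U
      at-abc (false ∷ false ∷ false ∷ []) = opp (true ∷ true ∷ true ∷ [])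
      at-abc (false ∷ false ∷ true  ∷ []) = opp (true ∷ true ∷ false ∷ [])
      at-abc (false ∷ true  ∷ false ∷ []) = opp (true ∷ false ∷ true ∷ [])
      at-abc (false ∷ true  ∷ true  ∷ []) = opp (true ∷ false ∷ false ∷ [])
      at-abc (true  ∷ false ∷ false ∷ []) = opp (false ∷ true ∷ true ∷ [])
      at-abc (true  ∷ false ∷ true  ∷ []) = opp (false ∷ true ∷ false ∷ [])
      at-abc (true  ∷ true  ∷ false ∷ []) = opp (false ∷ false ∷ true ∷ [])
      at-abc (true  ∷ true  ∷ true  ∷ []) = d≁0
      un-a : at β₀ ~ at β₁ → Z a
      un-a (mk~ z) = Z-≡ (e a b c) (∣m⇒∣-m z)
        where e : ∀ a b c → - (+ 0 * c + (+ 0 * b + (+ 0 * a + + 0)) - (+ 0 * c + (+ 0 * b + (+ 1 * a + + 0)))) ≡ a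
              e = solve-∀
      un-bc : at β₀ ~ at β₂ → c ~ dot (⊝ ∷ ⊙ ∷ []) (b ∷ a ∷ [])
      un-bc (mk~ z) = mk~ (Z-≡ (e a b c) (∣m⇒∣-m z))
        where e : ∀ a b c → - (+ 0 * c + (+ 0 * b + (+ 0 * a + + 0)) - (+ 1 * c + (+ 1 * b + (+ 0 * a + + 0)))) ≡ c - (- + 1 * b + (+ 0 * a + + 0))
              e = solve-∀
      un-abc : at β₀ ~ at β₃ → c ~ dot (⊝ ∷ ⊝ ∷ []) (b ∷ a ∷ [])
      un-abc (mk~ z) = mk~ (Z-≡ (e a b c) (∣m⇒∣-m z))
        where e : ∀ a b c → - (+ 0 * c + (+ 0 * b + (+ 0 * a + + 0)) - (+ 1 * c + (+ 1 * b + (+ 1 * a + + 0)))) ≡ c - (- + 1 * b + (- + 1 * a + + 0))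
              e = solve-∀
      un-a-bc : at β₁ ~ at β₂ → c ~ dot (⊝ ∷ ⊞ ∷ []) (b ∷ a ∷ [])
      un-a-bc (mk~ z) = mk~ (Z-≡ (e a b c) (∣m⇒∣-m z))
        where e : ∀ a b c → - (+ 0 * c + (+ 0 * b + (+ 1 * a + + 0)) - (+ 1 * c + (+ 1 * b + (+ 0 * a + + 0)))) ≡ c - (- + 1 * b + (+ 1 * a + + 0))
              e = solve-∀
      un-a-abc : at β₁ ~ at β₃ → c ~ dot (⊝ ∷ ⊙ ∷ []) (b ∷ a ∷ [])
      un-a-abc (mk~ z) = mk~ (Z-≡ (e a b c) (∣m⇒∣-m z))
        where e : ∀ a b c → - (+ 0 * c + (+ 0 * b + (+ 1 * a + + 0)) - (+ 1 * c + (+ 1 * b + (+ 1 * a + + 0)))) ≡ c - (- + 1 * b + (+ 0 * a + + 0))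
              e = solve-∀
      un-bc-abc : at β₂ ~ at β₃ → Z a
      un-bc-abc (mk~ z) = Z-≡ (e a b c) (∣m⇒∣-m z)
        where e : ∀ a b c → - (+ 1 * c + (+ 1 * b + (+ 0 * a + + 0)) - (+ 1 * c + (+ 1 * b + (+ 1 * a + + 0)))) ≡ a
              e = solve-∀

    Distinct-sublist : ∀ {V W} → V ++ W ↭ K → AllPairs _≢_ V → Distinct V
    Distinct-sublist π []           = []
    Distinct-sublist {x ∷ V} {W} π (≢x ∷ ≢s) =
      All.tabulate (λ {y} y∈V x~y → All.lookup ≢x y∈V (canonical (↭.∈-resp-↭ π (here refl)) (↭.∈-resp-↭ π (there (∈-++⁺ˡ y∈V))) x~y))
      ∷ Distinct-sublist (↭-trans (↭.shift x V W) π) ≢s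

    -- Fourteen values suffice: after a and b, c is chosen among twelve so as to avoid three values,
    -- then d among eleven so as to avoid ten. Two of the ten values left over are the different
    -- terms that `excess-absurd` asks for.
    few-values : ∀ V W → V ++ W ↭ K → AllPairs _≢_ V → length V ℕ.< 14
    few-values V W π ≢s = ℕ.≰⇒> (many V π (Distinct-sublist π ≢s))
      where
      ≁⇒≢ : ∀ {x y} → ¬ x ~ y → x ≢ y
      ≁⇒≢ x≁y refl = x≁y ~-refl
      many : ∀ V → V ++ W ↭ K → Distinct V → ¬ 14 ℕ.≤ length V
      many (a ∷ b ∷ V) π ((a≁b ∷ a≁) ∷ b≁ ∷ V!) (s≤s (s≤s len)) =
        let c , V₁ , ρ₁ , c! , c-free = pick (forbiddenᶜ a b) V V! (ℕ.≤-trans (ℕ.m≤m+n 4 8) len)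
        in second c V₁ ρ₁ c! (subst (12 ℕ.≤_) (sym (↭.↭-length ρ₁)) len) c-free
        where
        finish : ∀ {V₁} V₂ c d → c ∷ V₁ ↭ V → d ∷ V₂ ↭ V₁ → All (λ x → ¬ c ~ x) V₁ → Distinct (d ∷ V₂) → 10 ℕ.≤ length V₂ →
          All (λ x → ¬ c ~ x) (forbiddenᶜ a b) → All (λ x → ¬ d ~ x) (forbiddenᵈ a b c) → ⊥
        finish (e ∷ f ∷ V₂) c d ρ₁ ρ₂ c≁ (_ ∷ (e≁f ∷ _) ∷ _) (s≤s (s≤s _)) c-free d-free =
          excess-absurd (length (V₂ ++ W)) (d ∷ c ∷ b ∷ a ∷ []) e f (V₂ ++ W) refl
            (↭-trans (Perm.solve 5 (λ a b c d X → X ⊕ (d ⊕ c ⊕ b ⊕ a) ⊜ a ⊕ b ⊕ c ⊕ d ⊕ X) ↭-refl [ a ] [ b ] [ c ] [ d ] (e ∷ f ∷ V₂ ++ W)) πᶠ)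
            (≁⇒≢ e≁f)
            (four-terms a b c d e (f ∷ V₂ ++ W) πᶠ (≁⇒≢ a≁b)
              (≁⇒≢ (All.head a≁′)) (≁⇒≢ (All.head b≁′)) (≁⇒≢ (All.head (↭.All-resp-↭ (↭-sym ρ₂) (All.tail a≁′))))
              (≁⇒≢ (All.head (↭.All-resp-↭ (↭-sym ρ₂) (All.tail b≁′)))) (≁⇒≢ (All.head (↭.All-resp-↭ (↭-sym ρ₂) c≁)))
              c-free d-free)
          where
          a≁′ = ↭.All-resp-↭ (↭-sym ρ₁) a≁
          b≁′ = ↭.All-resp-↭ (↭-sym ρ₁) b≁
          πᶠ : a ∷ b ∷ c ∷ d ∷ e ∷ f ∷ V₂ ++ W ↭ K
          πᶠ = ↭-trans (prep a (prep b (↭.++⁺ʳ W (↭-trans (prep c ρ₂) ρ₁)))) π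
        second : ∀ c V₁ → c ∷ V₁ ↭ V → Distinct (c ∷ V₁) → 12 ℕ.≤ length (c ∷ V₁) → All (λ x → ¬ c ~ x) (forbiddenᶜ a b) → ⊥
        second c V₁ ρ₁ (c≁ ∷ V₁!) (s≤s len₁) c-free =
          let d , V₂ , ρ₂ , d! , d-free = pick (forbiddenᵈ a b c) V₁ V₁! len₁
          in finish V₂ c d ρ₁ ρ₂ c≁ d! (ℕ.≤-pred (subst (11 ℕ.≤_) (sym (↭.↭-length ρ₂)) len₁)) c-free d-free

  -- The shape of the terms different from a frequent term a.

  data Kind : Set where
    k₋₃ k₋₁ k₃ k₅ : Kind

  value : Kind → ℤ
  value k₋₃ = - + 3
  value k₋₁ = - + 1
  value k₃  = + 3
  value k₅  = + 5

  -- These are the pairs with positive sum, because b + c is a positive multiple of a. The plain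
  -- constructors list the smaller value first.
  data Compatible : Kind → Kind → Set where
    c₃₃  : Compatible k₃ k₃
    c₃₅  : Compatible k₃ k₅
    c₅₅  : Compatible k₅ k₅
    c₋₁₃ : Compatible k₋₁ k₃
    c₋₁₅ : Compatible k₋₁ k₅
    c₋₃₅ : Compatible k₋₃ k₅
    flip : ∀ {κ κ′} → Compatible κ κ′ → Compatible κ′ κ

  module HalfMultiples (p : ℕ) (prime : Prime p) (155<p : 155 ℕ.< p)
    (K : List ℤ) (unsplittable : SumGrowth.Unsplittableᶻ p prime K) (a : ℤ) where

    open Residues p prime
    open SumGrowth p prime
    open Unsplittableᶻ unsplittable
    open Unsplittable p prime K unsplittable

    <p : ∀ {n} → n ℕ.≤ 155 → n ℕ.< p
    <p n≤ = ℕ.≤-<-trans n≤ 155<p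

    -- Half b y says b = ((p + y)/2) a, the shape of the terms other than a.
    Half : ℤ → ℤ → Set
    Half b y = + 2 * b ~ y * a

    U₅ : List ℤ
    U₅ = replicate 5 a

    a≢0 : ∀ {X} → replicate 6 a ++ X ↭ K → ¬ Z a
    a≢0 = nonzero

    signed-multiple : ∀ {n x i j} → i ℕ.≤ n → j ℕ.≤ n → x + + i * a ~ + j * a →
      (∃[ s ] s ℕ.≤ n × x ~ + s * a) ⊎ (∃[ s ] s ℕ.≤ n × + s * a ~ - x)
    signed-multiple {n} {x} {i} {j} i≤n j≤n (mk~ q) =
      [ (λ i≤j → inj₁ (j ℕ.∸ i , ℕ.≤-trans (ℕ.m∸n≤m j i) j≤n ,
          mk~ (Z-≡ (trans (cong (λ k → x + + i * a - + k * a) (sym (ℕ.m+[n∸m]≡n i≤j))) (e₁ x (+ i) (+ (j ℕ.∸ i)) a)) q)))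
      , (λ j≤i → inj₂ (i ℕ.∸ j , ℕ.≤-trans (ℕ.m∸n≤m i j) i≤n ,
          mk~ (Z-≡ (trans (cong (λ k → x + + k * a - + j * a) (sym (ℕ.m+[n∸m]≡n j≤i))) (e₂ x (+ j) (+ (i ℕ.∸ j)) a)) q)))
      ]′ (ℕ.≤-total i j)
      where
      e₁ : ∀ x i k a → x + i * a - (i + k) * a ≡ x - k * a
      e₁ = solve-∀
      e₂ : ∀ x j k a → x + (j + k) * a - j * a ≡ k * a - - x
      e₂ = solve-∀

    -- Otherwise b = sa with |s| ≤ 5: `multiple-not-small` excludes s ≥ 2, distinctness s = 1, and
    -- for s ≤ 0 the copies of a would cancel b. Hence 0, ..., 5a and its translate by b are
    -- disjoint.
    far : ∀ {b x X i j} → b ∷ replicate 6 a ++ x ∷ X ↭ K → b ≢ a → i ℕ.≤ 5 → j ℕ.≤ 5 → ¬ b + + i * a ~ + j * a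
    far {b} {x} {X} π b≢a i≤5 j≤5 q =
      [ (λ { (s , s≤5 , b~sa) → positive s (ℕ.≤-trans s≤5 (ℕ.m≤m+n 5 2)) b~sa })
      , (λ { (s , s≤5 , sa~-b) → no-opposite π (SubsetSum-resp (replicate 6 a) sa~-b (SubsetSum-replicate 6 a (ℕ.m≤n⇒m≤1+n s≤5))) })
      ]′ (signed-multiple i≤5 j≤5 q)
      where
      positive : ∀ s → s ℕ.≤ 7 → ¬ b ~ + s * a
      positive 0 _ (mk~ z) = nonzero π (Z-≡ (e₀ b a) z)
        where e₀ : ∀ b a → b - + 0 * a ≡ b
              e₀ = solve-∀
      positive 1 _ b~a = distinct π b≢a (~-trans b~a (~-reflexive (ℤ.*-identityˡ a)))
      positive (suc (suc s)) s≤7 = multiple-not-small b 6 a (x ∷ X) π (s≤s (s≤s z≤n)) s≤7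

    translates : ℤ → ℕ → List ℤ
    translates e n = applyUpTo (λ i → e + + i * a) n

    translates-distinct : ¬ Z a → ∀ e n → n ℕ.≤ p → Distinct (translates e n)
    translates-distinct a≢0 e n n≤p = AllPairs.applyUpTo⁺₁ _ n λ {i} {j} i<j j<n (mk~ z) →
      ℕ.<⇒≢ i<j (multiple-inj {a} {i} {j} a≢0 (ℕ.<-trans i<j (ℕ.<-≤-trans j<n n≤p)) (ℕ.<-≤-trans j<n n≤p)
        (mk~ (Z-≡ (eq e (+ i) (+ j) a) z)))
      where eq : ∀ e i j a → e + i * a - (e + j * a) ≡ i * a - j * a
            eq = solve-∀

    two-progressions : ∀ {U} → ¬ Z a → ∀ b m n → m ℕ.≤ p → n ℕ.≤ p →
      (∀ {i} → i ℕ.< m → SubsetSum U (+ 0 + + i * a)) → (∀ {i} → i ℕ.< n → SubsetSum U (b + + i * a)) →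
      (∀ {i j} → i ℕ.< m → j ℕ.< n → ¬ + 0 + + i * a ~ b + + j * a) → ManySums U (m ℕ.+ n)
    two-progressions a≢0 b m n m≤p n≤p ins₁ ins₂ apart = many-sums (translates (+ 0) m ++ translates b n)
      (ℕ.≤-reflexive (sym (trans (List.length-++ (translates (+ 0) m))
        (cong₂ ℕ._+_ (List.length-applyUpTo _ m) (List.length-applyUpTo _ n)))))
      (AllPairs.++⁺ (translates-distinct a≢0 (+ 0) m m≤p) (translates-distinct a≢0 b n n≤p)
        (All.applyUpTo⁺₁ _ m λ i<m → All.applyUpTo⁺₁ _ n λ j<n → apart i<m j<n))
      (All.++⁺ (All.applyUpTo⁺₁ _ m ins₁) (All.applyUpTo⁺₁ _ n ins₂))

    six-exits : ∀ {r U} → ¬ Z a → ∀ e → (∀ {i} → i ℕ.< 6 → SubsetSum U (e + + i * a)) →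
      (∀ {i} → i ℕ.< 6 → ¬ SubsetSum U (e + + i * a + r)) → Exits r U 6
    six-exits a≢0 e ins out = exits (translates e 6) ℕ.≤-refl
      (translates-distinct a≢0 e 6 (ℕ.<⇒≤ (<p (ℕ.m≤m+n 6 149))))
      (All.applyUpTo⁺₁ (λ i → e + + i * a) 6 ins) (All.applyUpTo⁺₁ (λ i → e + + i * a) 6 out)

    U₅-multiple : ∀ i {x} → i ℕ.≤ 5 → x ~ + i * a → SubsetSum U₅ x
    U₅-multiple i i≤5 q = SubsetSum-resp U₅ (~-sym q) (SubsetSum-replicate 5 a i≤5)

    0+ : ∀ i → + 0 + + i * a ~ + i * a
    0+ i = ~-reflexive (ℤ.+-identityˡ (+ i * a))

    -- Says that x is one of - 5a, ..., 5a, in the form in which it arises: 0, ..., 5a meets its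
    -- translate by x.
    Near : ℤ → Set
    Near x = ∃[ i ] i ℕ.< 6 × (∃[ j ] j ℕ.< 6 × x + + i * a ~ + j * a)

    near? : ∀ x → Dec (Near x)
    near? x = ℕ.anyUpTo? (λ i → ℕ.anyUpTo? (λ j → (x + + i * a) ~? (+ j * a)) 6) 6

    module Pair {b c f W} (π : replicate 6 a ++ b ∷ c ∷ f ∷ W ↭ K) (b≢a : b ≢ a) (c≢a : c ≢ a) (f≢a : f ≢ a) where

      πᵇ : b ∷ replicate 6 a ++ c ∷ f ∷ W ↭ K
      πᵇ = ↭-trans (Perm.solve 3 (λ A b X → b ⊕ A ⊕ X ⊜ A ⊕ b ⊕ X) ↭-refl (replicate 6 a) [ b ] (c ∷ f ∷ W)) π

      πᶜ : c ∷ replicate 6 a ++ b ∷ f ∷ W ↭ K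
      πᶜ = ↭-trans (Perm.solve 4 (λ A b c X → c ⊕ A ⊕ b ⊕ X ⊜ A ⊕ b ⊕ c ⊕ X) ↭-refl (replicate 6 a) [ b ] [ c ] (f ∷ W)) π

      farᵇ : ∀ {i j} → i ℕ.≤ 5 → j ℕ.≤ 5 → ¬ b + + i * a ~ + j * a
      farᵇ = far πᵇ b≢a

      farᶜ : ∀ {i j} → i ℕ.≤ 5 → j ℕ.≤ 5 → ¬ c + + i * a ~ + j * a
      farᶜ = far πᶜ c≢a

      -- Seven terms and 18 = 2 · 7 + 4 sums; the sixth copy of a and f are the different terms left
      -- over.
      absurd : ¬ ManySums (c ∷ b ∷ U₅) 18
      absurd = excess-absurd (length W) (c ∷ b ∷ U₅) a f W refl
        (↭-trans (Perm.solve 6 (λ a A b c f X → (a ⊕ f ⊕ X) ⊕ (c ⊕ b ⊕ A) ⊜ (a ⊕ A) ⊕ b ⊕ c ⊕ f ⊕ X) ↭-refl [ a ] U₅ [ b ] [ c ] [ f ] W) π)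
        (f≢a ∘ sym)

      ManySums-b : ManySums (b ∷ U₅) 12
      ManySums-b = ManySums-∷ (six-exits (a≢0 π) (+ 0) (λ {i} i<6 → U₅-multiple i (ℕ.≤-pred i<6) (0+ i))
          (λ {i} i<6 s → let j , j≤5 , mk~ q = SubsetSum-replicate⁻ 5 a s in
            farᵇ (ℕ.≤-pred i<6) j≤5 (mk~ (Z-≡ (e (+ i) (+ j) a b) q))))
        (many-sums (translates (+ 0) 6) ℕ.≤-refl (translates-distinct (a≢0 π) (+ 0) 6 (ℕ.<⇒≤ (<p (ℕ.m≤m+n 6 149))))
          (All.applyUpTo⁺₁ _ 6 λ {i} i<6 → U₅-multiple i (ℕ.≤-pred i<6) (0+ i)))
        where e : ∀ i j a b → + 0 + i * a + b - j * a ≡ b + i * a - j * a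
              e = solve-∀

      -- Otherwise {0, …, 5a}, b + {0, …, 5a} and b + c + {0, …, 5a} are disjoint.
      near-sum : Near (b + c)
      near-sum = decidable-stable (near? (b + c)) λ ¬near → absurd (ManySums-∷
        (six-exits (a≢0 π) b (λ {i} i<6 → take (U₅-multiple i (ℕ.≤-pred i<6) (~-reflexive (e₁ b (+ i) a))))
          (λ { {i} i<6 (skip s) → let j , j≤5 , mk~ q = SubsetSum-replicate⁻ 5 a s in
                 ¬near (i , i<6 , j , s≤s j≤5 , mk~ (Z-≡ (e₂ b c (+ i) (+ j) a) q))
             ; {i} i<6 (take s) → let j , j≤5 , mk~ q = SubsetSum-replicate⁻ 5 a s in
                 farᶜ (ℕ.≤-pred i<6) j≤5 (mk~ (Z-≡ (e₃ b c (+ i) (+ j) a) q)) }))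
        ManySums-b)
        where
        e₁ : ∀ b i a → b + i * a - b ≡ i * a
        e₁ = solve-∀
        e₂ : ∀ b c i j a → b + i * a + c - j * a ≡ b + c + i * a - j * a
        e₂ = solve-∀
        e₃ : ∀ b c i j a → b + i * a + c - b - j * a ≡ c + i * a - j * a
        e₃ = solve-∀

      -- Otherwise {0, …, 5a}, b + {0, …, 5a} and c + {0, …, 5a} are disjoint.
      near-difference : Near (c - b)
      near-difference = decidable-stable (near? (c - b)) λ ¬near → absurd (ManySums-∷
        (six-exits (a≢0 π) (+ 0) (λ {i} i<6 → skip (U₅-multiple i (ℕ.≤-pred i<6) (0+ i)))
          (λ { {i} i<6 (skip s) → let j , j≤5 , mk~ q = SubsetSum-replicate⁻ 5 a s in
                 farᶜ (ℕ.≤-pred i<6) j≤5 (mk~ (Z-≡ (e₂ c (+ i) (+ j) a) q))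
             ; {i} i<6 (take s) → let j , j≤5 , mk~ q = SubsetSum-replicate⁻ 5 a s in
                 ¬near (i , i<6 , j , s≤s j≤5 , mk~ (Z-≡ (e₃ b c (+ i) (+ j) a) q)) }))
        ManySums-b)
        where
        e₂ : ∀ c i j a → + 0 + i * a + c - j * a ≡ c + i * a - j * a
        e₂ = solve-∀
        e₃ : ∀ b c i j a → + 0 + i * a + c - b - j * a ≡ c - b + i * a - j * a
        e₃ = solve-∀

      -- By `near-sum`, b + c is sa with |s| ≤ 5. If s ≤ 0, then b, c and - s copies of a would sum
      -- to zero, with f left over.
      sum-positive : ∃[ t ] t ℕ.≤ 4 × b + c ~ + suc t * a
      sum-positive = sign near-sum
        where
        nonpositive : ∀ s → s ℕ.≤ 5 → ¬ + s * a ~ - (b + c)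
        nonpositive s s≤5 q = no-negative b [ c ] (replicate 6 a) f W
          (↭-trans (Perm.solve 4 (λ A b c X → (b ⊕ c) ⊕ A ⊕ X ⊜ A ⊕ b ⊕ c ⊕ X) ↭-refl (replicate 6 a) [ b ] [ c ] (f ∷ W)) π)
          (SubsetSum-resp (replicate 6 a) (~-trans q (~-reflexive (cong (λ c → - (b + c)) (sym (ℤ.+-identityʳ c)))))
            (SubsetSum-replicate 6 a (ℕ.m≤n⇒m≤1+n s≤5)))
        positive : ∀ s → s ℕ.≤ 5 → b + c ~ + s * a → ∃[ t ] t ℕ.≤ 4 × b + c ~ + suc t * a
        positive zero    _         (mk~ q) = ⊥-elim (nonpositive 0 z≤n (mk~ (Z-≡ (e b c a) q)))
          where e : ∀ b c a → b + c - + 0 * a ≡ + 0 * a - - (b + c)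
                e = solve-∀
        positive (suc t) (s≤s t≤4) q       = t , t≤4 , q
        sign : Near (b + c) → ∃[ t ] t ℕ.≤ 4 × b + c ~ + suc t * a
        sign (i , i<6 , j , j<6 , q) =
          [ (λ { (s , s≤5 , q) → positive s s≤5 q }) , (λ { (s , s≤5 , q) → ⊥-elim (nonpositive s s≤5 q) }) ]′
            (signed-multiple {5} {b + c} {i} {j} (ℕ.≤-pred i<6) (ℕ.≤-pred j<6) q)

      module Difference {t δ : ℕ} (t≤4 : t ℕ.≤ 4) (δ≤5 : δ ℕ.≤ 5) (sum : b + c ~ + suc t * a) (difference : c ~ b + + δ * a) where

        private
          e : ∀ b i δ a → b + i * a - b ≡ i * a
          e = solve-∀

        above : ∀ {i m n} → ¬ i ℕ.< m → i ℕ.< m ℕ.+ n → i ℕ.∸ m ℕ.< n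
        above {i} {m} {n} i≮m i<m+n = subst (i ℕ.∸ m ℕ.<_) (ℕ.m+n∸m≡n m n) (ℕ.∸-monoˡ-< i<m+n (ℕ.≮⇒≥ i≮m))

        -- As 2b = (1 + t - δ)a, doubling ia = b + ja gives (2i + δ)a = (1 + t + 2j)a. Both
        -- coefficients are at most 25, hence equal, so i and j differ by at most 5, against `farᵇ`.
        apart : ∀ {i j} → i ℕ.< 11 → j ℕ.< 11 → ¬ + 0 + + i * a ~ b + + j * a
        apart {i} {j} i<11 j<11 (mk~ q) =
          [ (λ j≤i → i-larger (i ℕ.∸ j) (ℕ.m+[n∸m]≡n j≤i)) , (λ i≤j → j-larger (j ℕ.∸ i) (ℕ.m+[n∸m]≡n i≤j)) ]′ (ℕ.≤-total j i)
          where
          e₁ : ∀ b c i j δ t a → + 2 * (+ 0 + i * a - (b + j * a)) - (c - (b + δ * a)) + (b + c - (+ 1 + t) * a)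
                                 ≡ (i + i + δ) * a - (+ 1 + t + j + j) * a
          e₁ = solve-∀
          double : i ℕ.+ i ℕ.+ δ ≡ suc t ℕ.+ j ℕ.+ j
          double = multiple-inj {a} {i ℕ.+ i ℕ.+ δ} {suc t ℕ.+ j ℕ.+ j} (a≢0 π)
            (ℕ.≤-<-trans (ℕ.+-mono-≤ (ℕ.+-mono-≤ (ℕ.≤-pred i<11) (ℕ.≤-pred i<11)) δ≤5) (<p (ℕ.m≤m+n 25 130)))
            (ℕ.≤-<-trans (ℕ.+-mono-≤ (ℕ.+-mono-≤ (s≤s t≤4) (ℕ.≤-pred j<11)) (ℕ.≤-pred j<11)) (<p (ℕ.m≤m+n 25 130)))
            (mk~ (Z-≡ (e₁ b c (+ i) (+ j) (+ δ) (+ t) a)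
              (∣m∣n⇒∣m+n (∣m∣n⇒∣m-n (∣n⇒∣m*n (+ 2) q) (un~ difference)) (un~ sum))))
          i-larger : ∀ k → j ℕ.+ k ≡ i → ⊥
          i-larger k refl = farᵇ {0} {k} z≤n (ℕ.≤-trans (ℕ.m≤m+n k (k ℕ.+ δ)) (subst (ℕ._≤ 5) (sym (ℕ.+-cancelˡ-≡ (j ℕ.+ j) _ _
              (trans (eq₁ j k δ) (trans double (eq₂ j t))))) (s≤s t≤4)))
            (mk~ (Z-≡ (eq₃ b (+ j) (+ k) a) (∣m⇒∣-m q)))
            where
            eq₁ : ∀ j k δ → j ℕ.+ j ℕ.+ (k ℕ.+ (k ℕ.+ δ)) ≡ j ℕ.+ k ℕ.+ (j ℕ.+ k) ℕ.+ δ
            eq₁ = ℕ-Ring.solve-∀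
            eq₂ : ∀ j t → suc t ℕ.+ j ℕ.+ j ≡ j ℕ.+ j ℕ.+ suc t
            eq₂ = ℕ-Ring.solve-∀
            eq₃ : ∀ b j k a → - (+ 0 + (j + k) * a - (b + j * a)) ≡ b + + 0 * a - k * a
            eq₃ = solve-∀
          j-larger : ∀ k → i ℕ.+ k ≡ j → ⊥
          j-larger k refl = farᵇ {k} {0} (ℕ.≤-trans (ℕ.m≤m+n k (k ℕ.+ suc t)) (subst (ℕ._≤ 5) (ℕ.+-cancelˡ-≡ (i ℕ.+ i) _ _
              (trans double (eq₂ i k t))) δ≤5)) z≤n
            (mk~ (Z-≡ (eq₃ b (+ i) (+ k) a) (∣m⇒∣-m q)))
            where
            eq₂ : ∀ i k t → suc t ℕ.+ (i ℕ.+ k) ℕ.+ (i ℕ.+ k) ≡ i ℕ.+ i ℕ.+ (k ℕ.+ (k ℕ.+ suc t))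
            eq₂ = ℕ-Ring.solve-∀
            eq₃ : ∀ b i k a → - (+ 0 + i * a - (b + (i + k) * a)) ≡ b + k * a - + 0 * a
            eq₃ = solve-∀

        Sum : ℤ → Set
        Sum = SubsetSum (c ∷ b ∷ U₅)

        -- Beyond 5a the pair b + c = (1 + t)a takes over; in `upper`, beyond b + 5a, the term c = b
        -- + δa replaces b.
        lower : ∀ i → i ℕ.< 6 ℕ.+ suc t → Sum (+ 0 + + i * a)
        lower i i<m = case i ℕ.<? 6 of λ
          { (yes i<6) → skip (skip (U₅-multiple i (ℕ.≤-pred i<6) (0+ i)))
          ; (no i≮6)  → take (take (U₅-multiple (i ℕ.∸ suc t)
            (ℕ.≤-pred (above {i} {suc t} (λ i<t → i≮6 (ℕ.<-trans i<t (s≤s (s≤s t≤4)))) (subst (i ℕ.<_) (ℕ.+-comm 6 (suc t)) i<m)))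
            (mk~ (Z-≡ (trans (e₁ b c (+ suc t) (+ (i ℕ.∸ suc t)) a)
              (cong (λ k → + 0 + + k * a - c - b - + (i ℕ.∸ suc t) * a)
                (ℕ.m+[n∸m]≡n (ℕ.≤-trans (s≤s t≤4) (ℕ.≤-trans (ℕ.n≤1+n 5) (ℕ.≮⇒≥ i≮6))))))
              (∣m⇒∣-m (un~ sum)))))) }
          where e₁ : ∀ b c t i a → - (b + c - t * a) ≡ + 0 + (t + i) * a - c - b - i * a
                e₁ = solve-∀

        upper : ∀ i → i ℕ.< 6 ℕ.+ δ → Sum (b + + i * a)
        upper i i<n = case i ℕ.<? 6 of λ
          { (yes i<6) → skip (take (U₅-multiple i (ℕ.≤-pred i<6) (~-reflexive (e b (+ i) (+ 0) a))))
          ; (no i≮6)  → take (skip (U₅-multiple (i ℕ.∸ δ)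
            (ℕ.≤-pred (above {i} {δ} (λ i<δ → i≮6 (ℕ.<-trans i<δ (s≤s δ≤5))) (subst (i ℕ.<_) (ℕ.+-comm 6 δ) i<n)))
            (mk~ (Z-≡ (trans (e₁ b c (+ δ) (+ (i ℕ.∸ δ)) a)
              (cong (λ k → b + + k * a - c - + (i ℕ.∸ δ) * a)
                (ℕ.m+[n∸m]≡n (ℕ.≤-trans δ≤5 (ℕ.≤-trans (ℕ.n≤1+n 5) (ℕ.≮⇒≥ i≮6))))))
              (∣m⇒∣-m (un~ difference)))))) }
          where e₁ : ∀ b c δ i a → - (c - (b + δ * a)) ≡ b + (δ + i) * a - c - i * a
                e₁ = solve-∀

        -- The sums include {0, …, (6 + t)a} and b + {0, …, (5 + δ)a}, which are disjoint.
        small : suc t ℕ.+ δ ℕ.≤ 5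
        small = ℕ.≮⇒≥ λ 6≤ → absurd (ManySums-weaken (subst (18 ℕ.≤_) (eq t δ) (ℕ.+-monoʳ-≤ 12 6≤))
          (two-progressions (a≢0 π) b (6 ℕ.+ suc t) (6 ℕ.+ δ)
            (ℕ.<⇒≤ (<p (ℕ.≤-trans (ℕ.+-monoʳ-≤ 6 (s≤s t≤4)) (ℕ.m≤m+n 11 144))))
            (ℕ.<⇒≤ (<p (ℕ.≤-trans (ℕ.+-monoʳ-≤ 6 δ≤5) (ℕ.m≤m+n 11 144))))
            (λ {i} → lower i) (λ {i} → upper i)
            (λ {i} {j} i< j< → apart {i} {j} (ℕ.<-≤-trans i< (ℕ.+-monoʳ-≤ 6 (s≤s t≤4))) (ℕ.<-≤-trans j< (ℕ.+-monoʳ-≤ 6 δ≤5)))))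
          where eq : ∀ t δ → 12 ℕ.+ (suc t ℕ.+ δ) ≡ 6 ℕ.+ suc t ℕ.+ (6 ℕ.+ δ)
                eq = ℕ-Ring.solve-∀

        halfᵇ : Half b (+ suc t - + δ)
        halfᵇ = mk~ (Z-≡ (e₁ b c (+ suc t) (+ δ) a) (∣m∣n⇒∣m-n (un~ sum) (un~ difference)))
          where e₁ : ∀ b c t δ a → (b + c - t * a) - (c - (b + δ * a)) ≡ + 2 * b - (t - δ) * a
                e₁ = solve-∀

        halfᶜ : Half c (+ suc t + + δ)
        halfᶜ = mk~ (Z-≡ (e₁ b c (+ suc t) (+ δ) a) (∣m∣n⇒∣m+n (un~ sum) (un~ difference)))
          where e₁ : ∀ b c t δ a → (b + c - t * a) + (c - (b + δ * a)) ≡ + 2 * c - (t + δ) * a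
                e₁ = solve-∀

        -- For even y the factor 2 cancels, and b itself is a small multiple of a.
        even : ∀ i j → i ℕ.≤ 5 → j ℕ.≤ 5 → ¬ Half b (+ 2 * (+ j - + i))
        even i j i≤5 j≤5 (mk~ q) = farᵇ i≤5 j≤5 (2*-cancel (<p (ℕ.m≤m+n 2 153)) (mk~ (Z-≡ (e₁ b (+ i) (+ j) a) q)))
          where e₁ : ∀ b i j a → + 2 * b - (+ 2 * (j - i)) * a ≡ + 2 * (b + i * a) - + 2 * (j * a)
                e₁ = solve-∀

        -- Here a = 2b, so `multiple-not-small` applies with exchanged roles: one copy of b and s =
        -- 2.
        one : ¬ Half b (+ 1)
        one q = multiple-not-small a 1 b (U₅ ++ c ∷ f ∷ W)
          (↭-trans (Perm.solve 4 (λ a A b X → a ⊕ b ⊕ A ⊕ X ⊜ a ⊕ A ⊕ b ⊕ X) ↭-refl [ a ] U₅ [ b ] (c ∷ f ∷ W)) π)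
          ℕ.≤-refl ℕ.≤-refl (~-trans (~-sym (~-reflexive (ℤ.*-identityˡ a))) (~-sym q))

        kinds : ∃₂ λ κ κ′ → Half b (value κ) × Half c (value κ′) × Compatible κ κ′
        kinds = classify t δ small halfᵇ halfᶜ
          where
          -- The two values are 1 + t - δ and 1 + t + δ. They have the same parity, so even pairs
          -- and those whose smaller value is 1 drop out.
          classify : ∀ t δ → suc t ℕ.+ δ ℕ.≤ 5 → Half b (+ suc t - + δ) → Half c (+ suc t + + δ) →
            ∃₂ λ κ κ′ → Half b (value κ) × Half c (value κ′) × Compatible κ κ′
          classify 0 0 _ hb hc = ⊥-elim (one hb)
          classify 0 1 _ hb hc = ⊥-elim (even 0 0 z≤n z≤n hb)
          classify 0 2 _ hb hc = k₋₁ , k₃ , hb , hc , c₋₁₃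
          classify 0 3 _ hb hc = ⊥-elim (even 1 0 (s≤s z≤n) z≤n hb)
          classify 0 4 _ hb hc = k₋₃ , k₅ , hb , hc , c₋₃₅
          classify 1 0 _ hb hc = ⊥-elim (even 0 1 z≤n (s≤s z≤n) hb)
          classify 1 1 _ hb hc = ⊥-elim (one hb)
          classify 1 2 _ hb hc = ⊥-elim (even 0 0 z≤n z≤n hb)
          classify 1 3 _ hb hc = k₋₁ , k₅ , hb , hc , c₋₁₅
          classify 2 0 _ hb hc = k₃ , k₃ , hb , hc , c₃₃
          classify 2 1 _ hb hc = ⊥-elim (even 0 1 z≤n (s≤s z≤n) hb)
          classify 2 2 _ hb hc = ⊥-elim (one hb)
          classify 3 0 _ hb hc = ⊥-elim (even 0 2 z≤n (s≤s (s≤s z≤n)) hb)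
          classify 3 1 _ hb hc = k₃ , k₅ , hb , hc , c₃₅
          classify 4 0 _ hb hc = k₅ , k₅ , hb , hc , c₅₅
          classify 0 (suc (suc (suc (suc (suc δ))))) (s≤s (s≤s (s≤s (s≤s (s≤s ())))))
          classify 1 (suc (suc (suc (suc δ)))) (s≤s (s≤s (s≤s (s≤s (s≤s ())))))
          classify 2 (suc (suc (suc δ))) (s≤s (s≤s (s≤s (s≤s (s≤s ())))))
          classify 3 (suc (suc δ)) (s≤s (s≤s (s≤s (s≤s (s≤s ())))))
          classify 4 (suc δ) (s≤s (s≤s (s≤s (s≤s (s≤s ())))))
          classify (suc (suc (suc (suc (suc t))))) δ (s≤s (s≤s (s≤s (s≤s (s≤s ())))))

    kinds : ∀ {b c f W} → replicate 6 a ++ b ∷ c ∷ f ∷ W ↭ K → b ≢ a → c ≢ a → f ≢ a →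
      ∃₂ λ κ κ′ → Half b (value κ) × Half c (value κ′) × Compatible κ κ′
    kinds {b} {c} {f} {W} π b≢a c≢a f≢a = conclude near-difference sum-positive
      where
      open Pair π b≢a c≢a f≢a
      e₁ : ∀ b c δ a → c - b - δ * a ≡ c - (b + δ * a)
      e₁ = solve-∀
      e₂ : ∀ b c δ a → - (δ * a - - (c - b)) ≡ b - (c + δ * a)
      e₂ = solve-∀
      Result : Set
      Result = ∃₂ λ κ κ′ → Half b (value κ) × Half c (value κ′) × Compatible κ κ′
      swapped : (∃₂ λ κ κ′ → Half c (value κ) × Half b (value κ′) × Compatible κ κ′) → Result
      swapped (κ , κ′ , hc , hb , κ∥κ′) = κ′ , κ , hb , hc , flip κ∥κ′
      conclude : Near (c - b) → (∃[ t ] t ℕ.≤ 4 × b + c ~ + suc t * a) → Result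
      conclude (i , i<6 , j , j<6 , near) (t , t≤4 , sum) =
        [ (λ { (δ , δ≤5 , mk~ q) → Difference.kinds {t} {δ} t≤4 δ≤5 sum (mk~ (Z-≡ (e₁ b c (+ δ) a) q)) })
        , (λ { (δ , δ≤5 , mk~ q) → swapped (Pair.Difference.kinds {c} {b} {f} {W}
                  (↭-trans (↭.++⁺ˡ (replicate 6 a) (swap c b ↭-refl)) π) c≢a b≢a f≢a {t} {δ} t≤4 δ≤5
                  (~-trans (~-reflexive (ℤ.+-comm c b)) sum) (mk~ (Z-≡ (e₂ b c (+ δ) a) (∣m⇒∣-m q)))) })
        ]′ (signed-multiple {5} {c - b} {i} {j} (ℕ.≤-pred i<6) (ℕ.≤-pred j<6) near)

  -- The multiplicities of the remaining terms.

  module Structure (p : ℕ) (prime : Prime p) (155<p : 155 ℕ.< p)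
    (K : List ℤ) (unsplittable : SumGrowth.Unsplittableᶻ p prime K) where

    open Residues p prime
    open SumGrowth p prime
    open Unsplittableᶻ unsplittable
    open Unsplittable p prime K unsplittable

    double-total : ∀ {a y L} → All (λ x → + 2 * x ~ y * a) L → + 2 * total L ~ (+ length L * y) * a
    double-total {a} {y} {[]} [] = ~-reflexive (e y a)
      where e : ∀ y a → + 2 * + 0 ≡ (+ 0 * y) * a
            e = solve-∀
    double-total {a} {y} {x ∷ L} (mk~ h ∷ hs) =
      mk~ (Z-≡ (e x (total L) (+ length L) y a) (∣m∣n⇒∣m+n h (un~ (double-total hs))))
      where e : ∀ x t l y a → (+ 2 * x - y * a) + (+ 2 * t - (l * y) * a) ≡ + 2 * (x + t) - ((+ 1 + l) * y) * a
            e = solve-∀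

    module Frequent (a : ℤ) (m : ℕ) (6≤m : 6 ℕ.≤ m) where

      open HalfMultiples p prime 155<p K unsplittable a

      A : List ℤ
      A = replicate m a

      with-six : ∀ {X} → A ++ X ↭ K → replicate 6 a ++ X ++ replicate (m ℕ.∸ 6) a ↭ K
      with-six {X} π = ↭-trans
        (Perm.solve 3 (λ A B X → A ⊕ X ⊕ B ⊜ (A ⊕ B) ⊕ X) ↭-refl (replicate 6 a) (replicate (m ℕ.∸ 6) a) X)
        (subst (λ L → L ++ X ↭ K) (replicate-split a 6≤m) π)

      p≡ : ∀ {X} → A ++ X ↭ K → p ≡ 1 ℕ.+ 2 ℕ.* (m ℕ.+ length X)
      p≡ {X} π = trans size (cong (λ n → 1 ℕ.+ 2 ℕ.* n)
        (trans (sym (↭.↭-length π)) (trans (List.length-++ A) (cong (ℕ._+ length X) (List.length-replicate m)))))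

      a≢0ᴬ : ∀ {X} → A ++ X ↭ K → ¬ Z a
      a≢0ᴬ π = a≢0 (with-six π)

      zero-sumᴬ : ∀ {X} → A ++ X ↭ K → Z (+ m * a + total X)
      zero-sumᴬ {X} π = Z-≡ (trans (sym (total-↭ π)) (trans (total-++ A X) (cong (_+ total X) (total-replicate m a)))) zero-sum

      only-a : ¬ (A ++ [] ↭ K)
      only-a π = ¬Z-between {m} (ℕ.≤-trans (s≤s z≤n) 6≤m)
        (subst (m ℕ.<_) (sym (p≡ π)) (s≤s (ℕ.≤-trans (ℕ.m≤m+n m 0) (ℕ.m≤m+n _ _))))
        (Z-cancel {+ m} (a≢0ᴬ π) (Z-≡ (ℤ.+-identityʳ (+ m * a)) (zero-sumᴬ π)))

      -- Without b only 0, a, ..., ma are sums, and - a is missing since m + 1 < p.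
      one-other : ∀ {b} → ¬ (A ++ b ∷ [] ↭ K)
      one-other {b} π = covered (SubsetSum-replicate⁻ m a (full b A (↭-trans (↭.++-comm [ b ] A) π) (- a)))
        where
        covered : ¬ (∃[ j ] j ℕ.≤ m × - a ~ + j * a)
        covered (j , j≤m , mk~ q) = ¬Z-between {suc j} (s≤s z≤n)
          (ℕ.≤-<-trans (ℕ.≤-trans (s≤s j≤m) (ℕ.≤-reflexive (ℕ.+-comm 1 m))) (subst (m ℕ.+ 1 ℕ.<_) (sym (p≡ π)) (s≤s (ℕ.m≤m+n _ _))))
          (Z-cancel {+ suc j} (a≢0ᴬ π) (Z-≡ (e (+ j) a) (∣m⇒∣-m q)))
          where e : ∀ j a → - (- a - j * a) ≡ (+ 1 + j) * a
                e = solve-∀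

      large-multiple : ∀ {b x X s} → b ∷ A ++ x ∷ X ↭ K → b ≢ a → b ~ + s * a → 2 ℕ.+ m ℕ.≤ s
      large-multiple {b} {x} {X} {s} π b≢a b~sa = ℕ.≮⇒≥ λ s< → small s (ℕ.≤-pred s<) b~sa
        where
        small : ∀ s → s ℕ.≤ suc m → ¬ b ~ + s * a
        small 0 _ (mk~ z) = no-opposite π (SubsetSum-resp A (mk~ (Z-≡ (e b a) z)) (SubsetSum-0 A))
          where e : ∀ b a → b - + 0 * a ≡ + 0 - - b
                e = solve-∀
        small 1 _ b~a = b≢a (canonical (↭.∈-resp-↭ π (here refl)) (↭.∈-resp-↭ π (there (a∈A m 6≤m)))
            (~-trans b~a (~-reflexive (ℤ.*-identityˡ a))))
          where a∈A : ∀ m → 6 ℕ.≤ m → a ∈ replicate m a ++ x ∷ X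
                a∈A (suc m) _ = here refl
        small (suc (suc s)) s≤ = multiple-not-small b m a (x ∷ X) π (s≤s (s≤s z≤n)) s≤

      -- Otherwise - b = (p - s)a would be among 0, ..., ma.
      bounded-multiple : ∀ {b x X s} → b ∷ A ++ x ∷ X ↭ K → s ℕ.≤ p → b ~ + s * a → s ℕ.+ m ℕ.< p
      bounded-multiple {b} {x} {X} {s} π s≤p (mk~ q) = ℕ.≰⇒> λ p≤s+m → no-opposite π (SubsetSum-resp A
        (mk~ (Z-≡ (e b (+ s) (+ (p ℕ.∸ s)) a)
          (∣m∣n⇒∣m+n q (∣n⇒∣m*n a (subst (λ n → Z (+ n)) (sym (ℕ.m+[n∸m]≡n s≤p)) Z-p)))))
        (SubsetSum-replicate m a {p ℕ.∸ s} (ℕ.m≤n+o⇒m∸n≤o p s p≤s+m)))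
        where e : ∀ b s i a → (b - s * a) + a * (s + i) ≡ i * a - - b
              e = solve-∀

      -- With b = sa and c = ua, the two preceding bounds and p = 2m + 5 put s and u between m + 2
      -- and m + 4. The coefficient m + s + u of the total then lies strictly between p and 2p.
      two-others : ∀ {b c} → b ≢ a → c ≢ a → ¬ (A ++ b ∷ c ∷ [] ↭ K)
      two-others {b} {c} b≢a c≢a π = count (multiple {a} (a≢0ᴬ π) b) (multiple {a} (a≢0ᴬ π) c)
        where
        πᵇ : b ∷ A ++ c ∷ [] ↭ K
        πᵇ = ↭-trans (Perm.solve 3 (λ A b c → b ⊕ A ⊕ c ⊜ A ⊕ b ⊕ c) ↭-refl A [ b ] [ c ]) π
        πᶜ : c ∷ A ++ b ∷ [] ↭ K
        πᶜ = ↭-trans (Perm.solve 3 (λ A b c → c ⊕ A ⊕ b ⊜ A ⊕ b ⊕ c) ↭-refl A [ b ] [ c ]) π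
        count : (∃[ s ] s ℕ.< p × b ~ + s * a) → ¬ (∃[ u ] u ℕ.< p × c ~ + u * a)
        count (s , s<p , b~) (u , u<p , c~) = ¬Z-between-p-2p p<n n<2p
          (Z-cancel {+ (m ℕ.+ (s ℕ.+ u))} (a≢0ᴬ π) (Z-≡ (e b c (+ s) (+ u) (+ m) a)
            (∣m∣n⇒∣m-n (∣m∣n⇒∣m-n (zero-sumᴬ π) (un~ b~)) (un~ c~))))
          where
          e : ∀ b c s u m a → m * a + (b + (c + + 0)) - (b - s * a) - (c - u * a) ≡ (m + (s + u)) * a
          e = solve-∀
          p₂ : p ≡ 5 ℕ.+ 2 ℕ.* m
          p₂ = trans (p≡ π) (eq m)
            where eq : ∀ m → 1 ℕ.+ 2 ℕ.* (m ℕ.+ 2) ≡ 5 ℕ.+ 2 ℕ.* m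
                  eq = ℕ-Ring.solve-∀
          at-most : ∀ {s} → s ℕ.+ m ℕ.< p → s ℕ.≤ 4 ℕ.+ m
          at-most {s} s+m<p = ℕ.+-cancelʳ-≤ m s (4 ℕ.+ m) (ℕ.≤-trans (ℕ.≤-pred (subst (s ℕ.+ m ℕ.<_) p₂ s+m<p)) (ℕ.≤-reflexive (eq m)))
            where eq : ∀ m → 4 ℕ.+ 2 ℕ.* m ≡ 4 ℕ.+ m ℕ.+ m
                  eq = ℕ-Ring.solve-∀
          p<n : p ℕ.< m ℕ.+ (s ℕ.+ u)
          p<n = ℕ.≤-trans (ℕ.≤-reflexive (trans (cong suc p₂) (eq₁ m)))
            (ℕ.≤-trans (ℕ.+-monoˡ-≤ (2 ℕ.* m ℕ.+ 4) (ℕ.≤-trans (ℕ.m≤m+n 2 4) 6≤m))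
              (ℕ.≤-trans (ℕ.≤-reflexive (eq₂ m))
                (ℕ.+-monoʳ-≤ m (ℕ.+-mono-≤ (large-multiple {s = s} πᵇ b≢a b~) (large-multiple {s = u} πᶜ c≢a c~)))))
            where eq₁ : ∀ m → 6 ℕ.+ 2 ℕ.* m ≡ 2 ℕ.+ (2 ℕ.* m ℕ.+ 4)
                  eq₁ = ℕ-Ring.solve-∀
                  eq₂ : ∀ m → m ℕ.+ (2 ℕ.* m ℕ.+ 4) ≡ m ℕ.+ (2 ℕ.+ m ℕ.+ (2 ℕ.+ m))
                  eq₂ = ℕ-Ring.solve-∀
          n<2p : m ℕ.+ (s ℕ.+ u) ℕ.< p ℕ.+ p
          n<2p = ℕ.≤-<-trans (ℕ.+-monoʳ-≤ m (ℕ.+-mono-≤ (at-most (bounded-multiple {s = s} πᵇ (ℕ.<⇒≤ s<p) b~))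
              (at-most (bounded-multiple {s = u} πᶜ (ℕ.<⇒≤ u<p) c~))))
            (subst (λ q → m ℕ.+ (4 ℕ.+ m ℕ.+ (4 ℕ.+ m)) ℕ.< q) (trans (eq m) (cong₂ ℕ._+_ (sym p₂) (sym p₂)))
              (s≤s (ℕ.m≤m+n (m ℕ.+ (4 ℕ.+ m ℕ.+ (4 ℕ.+ m))) (1 ℕ.+ m))))
            where eq : ∀ m → suc (m ℕ.+ (4 ℕ.+ m ℕ.+ (4 ℕ.+ m)) ℕ.+ (1 ℕ.+ m)) ≡ 5 ℕ.+ 2 ℕ.* m ℕ.+ (5 ℕ.+ 2 ℕ.* m)
                  eq = ℕ-Ring.solve-∀

      Positive : ℤ → Set
      Positive x = Half x (+ 3) ⊎ Half x (+ 5)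

      positive? : ∀ x → Dec (Positive x)
      positive? x = (+ 2 * x ~? + 3 * a) ⊎-dec (+ 2 * x ~? + 5 * a)

      pair-sum : ∀ {b c} → Positive b → Positive c → ∃[ t ] 3 ℕ.≤ t × t ℕ.≤ 5 × b + c ~ + t * a
      pair-sum {b} {c} pb pc = combine pb pc
        where
        add : ∀ y y′ t → y + y′ ≡ + 2 * + t → Half b y → Half c y′ → b + c ~ + t * a
        add y y′ t eq (mk~ hb) (mk~ hc) = 2*-cancel (<p (ℕ.m≤m+n 2 153)) (mk~ (Z-≡
          (trans (e b c y y′ a) (trans (cong (λ z → + 2 * (b + c) - z * a) eq) (e′ (b + c) (+ t) a))) (∣m∣n⇒∣m+n hb hc)))
          where e : ∀ b c y y′ a → + 2 * b - y * a + (+ 2 * c - y′ * a) ≡ + 2 * (b + c) - (y + y′) * a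
                e = solve-∀
                e′ : ∀ x t a → + 2 * x - (+ 2 * t) * a ≡ + 2 * x - + 2 * (t * a)
                e′ = solve-∀
        3≤ : ∀ {n} → 3 ℕ.≤ 3 ℕ.+ n
        3≤ = s≤s (s≤s (s≤s z≤n))
        combine : Positive b → Positive c → ∃[ t ] 3 ℕ.≤ t × t ℕ.≤ 5 × b + c ~ + t * a
        combine (inj₁ hb) (inj₁ hc) = 3 , 3≤ , ℕ.m≤m+n 3 2 , add (+ 3) (+ 3) 3 refl hb hc
        combine (inj₁ hb) (inj₂ hc) = 4 , 3≤ , ℕ.m≤m+n 4 1 , add (+ 3) (+ 5) 4 refl hb hc
        combine (inj₂ hb) (inj₁ hc) = 4 , 3≤ , ℕ.m≤m+n 4 1 , add (+ 5) (+ 3) 4 refl hb hc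
        combine (inj₂ hb) (inj₂ hc) = 5 , 3≤ , ℕ.≤-refl , add (+ 5) (+ 5) 5 refl hb hc

      Covers : List ℤ → ℕ → Set
      Covers U n = ∀ i → i ℕ.≤ n → SubsetSum U (+ i * a)

      -- The intervals 0, ..., n and t, ..., t + n leave no gap as t ≤ n + 1.
      covers-pair : ∀ {U n b c t} → Covers U n → t ℕ.≤ suc n → b + c ~ + t * a → Covers (b ∷ c ∷ U) (t ℕ.+ n)
      covers-pair {U} {n} {b} {c} {t} covers t≤ (mk~ sum) i i≤ = case i ℕ.≤? n of λ
        { (yes i≤n) → skip (skip (covers i i≤n))
        ; (no i≰n)  → take (take (SubsetSum-resp U (mk~ (Z-≡ (trans (e b c (+ t) (+ (i ℕ.∸ t)) a)
              (cong (λ k → + (i ℕ.∸ t) * a - (+ k * a - b - c)) (ℕ.m+[n∸m]≡n (ℕ.≤-trans t≤ (ℕ.≰⇒> i≰n))))) (∣m⇒∣-m (∣m⇒∣-m sum))))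
            (covers (i ℕ.∸ t) (ℕ.m≤n+o⇒m∸n≤o i t i≤)))) }
        where e : ∀ b c t i a → - - (b + c - t * a) ≡ i * a - ((t + i) * a - b - c)
              e = solve-∀

      -- Each of the pairs c₂, c₃ and c₄, c₅ sums to at least 3a, so together with a^5 they cover 0,
      -- ..., 11a. The translate by c₁ is disjoint from this by parity after doubling: ten terms and
      -- 24 = 2 · 10 + 4 sums.
      five-positive : ∀ {c₁ c₂ c₃ c₄ c₅ f W} → A ++ c₁ ∷ c₂ ∷ c₃ ∷ c₄ ∷ c₅ ∷ f ∷ W ↭ K → f ≢ a →
        ¬ All Positive (c₁ ∷ c₂ ∷ c₃ ∷ c₄ ∷ c₅ ∷ [])
      five-positive {c₁} {c₂} {c₃} {c₄} {c₅} {f} {W} π f≢a (p₁ ∷ p₂ ∷ p₃ ∷ p₄ ∷ p₅ ∷ []) =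
        build p₁ (pair-sum p₂ p₃) (pair-sum p₄ p₅)
        where
        V : List ℤ
        V = c₂ ∷ c₃ ∷ c₄ ∷ c₅ ∷ U₅
        apart : ∀ {y i j} → Half c₁ (+ suc (2 ℕ.* y)) → y ℕ.≤ 2 → i ℕ.< 12 → j ℕ.< 12 → ¬ + 0 + + i * a ~ c₁ + + j * a
        apart {y} {i} {j} (mk~ h) y≤2 i<12 j<12 (mk~ q) = ℕ.even≢odd i (y ℕ.+ j)
          (multiple-inj {a} {2 ℕ.* i} {suc (2 ℕ.* (y ℕ.+ j))} (a≢0ᴬ π)
            (ℕ.≤-<-trans (ℕ.*-monoʳ-≤ 2 (ℕ.≤-pred i<12)) (<p (ℕ.m≤m+n 22 133)))
            (ℕ.≤-<-trans (s≤s (ℕ.*-monoʳ-≤ 2 (ℕ.+-mono-≤ y≤2 (ℕ.≤-pred j<12)))) (<p (ℕ.m≤m+n 27 128)))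
            (mk~ (Z-≡ (trans (e c₁ (+ i) (+ j) (+ suc (2 ℕ.* y)) a)
                (cong₂ (λ u v → u * a - v * a) (sym (ℤ.pos-* 2 i)) (trans (cong (_+_ (+ suc (2 ℕ.* y))) (sym (ℤ.pos-* 2 j))) (cong +_ (eq y j)))))
              (∣m∣n⇒∣m+n (∣n⇒∣m*n (+ 2) q) h))))
          where e : ∀ c i j y a → + 2 * (+ 0 + i * a - (c + j * a)) + (+ 2 * c - y * a) ≡ + 2 * i * a - (y + + 2 * j) * a
                e = solve-∀
                eq : ∀ y j → suc (2 ℕ.* y) ℕ.+ 2 ℕ.* j ≡ suc (2 ℕ.* (y ℕ.+ j))
                eq = ℕ-Ring.solve-∀
        build : Positive c₁ → (∃[ t ] 3 ℕ.≤ t × t ℕ.≤ 5 × c₂ + c₃ ~ + t * a) → ¬ (∃[ t ] 3 ℕ.≤ t × t ℕ.≤ 5 × c₄ + c₅ ~ + t * a)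
        build p₁ (t , 3≤t , t≤5 , sum) (t′ , 3≤t′ , t′≤5 , sum′) =
          excess-absurd (length (W ++ replicate (m ℕ.∸ 6) a)) (c₁ ∷ V) a f (W ++ replicate (m ℕ.∸ 6) a) refl
            (↭-trans (Perm.solve 6 (λ a A c f W B → (a ⊕ f ⊕ W ⊕ B) ⊕ (c ⊕ A) ⊜ (a ⊕ A) ⊕ (c ⊕ f ⊕ W) ⊕ B) ↭-refl
                [ a ] U₅ (c₁ ∷ c₂ ∷ c₃ ∷ c₄ ∷ c₅ ∷ []) [ f ] W (replicate (m ℕ.∸ 6) a))
              (with-six π))
            (f≢a ∘ sym)
            (two-progressions (a≢0ᴬ π) c₁ 12 12 12≤p 12≤p
              (λ {i} i< → skip (SubsetSum-resp V (~-sym (0+ i)) (covered i (ℕ.≤-pred i<))))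
              (λ {i} i< → take (SubsetSum-≡ V (e c₁ (+ i) a) (covered i (ℕ.≤-pred i<))))
              (odd p₁))
          where
          12≤p = ℕ.<⇒≤ (<p (ℕ.m≤m+n 12 143))
          e : ∀ c i a → i * a ≡ c + i * a - c
          e = solve-∀
          covered : Covers V 11
          covered i i≤11 = covers-pair {n = t′ ℕ.+ 5}
            (covers-pair {U₅} {5} (λ i i≤5 → SubsetSum-replicate 5 a i≤5) (ℕ.≤-trans t′≤5 (ℕ.n≤1+n 5)) sum′)
            (ℕ.≤-trans t≤5 (ℕ.m≤n⇒m≤1+n (ℕ.m≤n+m 5 t′))) sum i
            (ℕ.≤-trans i≤11 (ℕ.+-mono-≤ 3≤t (ℕ.+-monoˡ-≤ 5 3≤t′)))
          odd : Positive c₁ → ∀ {i j} → i ℕ.< 12 → j ℕ.< 12 → ¬ + 0 + + i * a ~ c₁ + + j * a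
          odd (inj₁ h) {i} {j} = apart {1} {i} {j} h (s≤s z≤n)
          odd (inj₂ h) {i} {j} = apart {2} {i} {j} h ℕ.≤-refl

      few-positive : ∀ L Y → A ++ L ++ Y ↭ K → All (_≢ a) L → All Positive L → length L ℕ.≤ 5
      few-positive (c₁ ∷ c₂ ∷ c₃ ∷ c₄ ∷ c₅ ∷ f ∷ W) Y π (_ ∷ _ ∷ _ ∷ _ ∷ _ ∷ f≢a ∷ _) (p₁ ∷ p₂ ∷ p₃ ∷ p₄ ∷ p₅ ∷ _) =
        ⊥-elim (five-positive {W = W ++ Y} π f≢a (p₁ ∷ p₂ ∷ p₃ ∷ p₄ ∷ p₅ ∷ []))
      few-positive []                             _ _ _ _ = z≤n
      few-positive (_ ∷ [])                       _ _ _ _ = ℕ.m≤m+n 1 4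
      few-positive (_ ∷ _ ∷ [])                   _ _ _ _ = ℕ.m≤m+n 2 3
      few-positive (_ ∷ _ ∷ _ ∷ [])               _ _ _ _ = ℕ.m≤m+n 3 2
      few-positive (_ ∷ _ ∷ _ ∷ _ ∷ [])           _ _ _ _ = ℕ.m≤m+n 4 1
      few-positive (_ ∷ _ ∷ _ ∷ _ ∷ _ ∷ [])       _ _ _ _ = ℕ.≤-refl

      record Sorted (L : List ℤ) : Set where
        constructor sorted
        field
          threes fives : List ℤ
          perm         : threes ++ fives ↭ L
          are-threes   : All (λ x → Half x (+ 3)) threes
          are-fives    : All (λ x → Half x (+ 5)) fives

        -- With i threes and j fives this is 3i + 5j - 2(i + j), the quantity that `balance`
        -- determines modulo p.
        count : ℕ
        count = length threes ℕ.+ 3 ℕ.* length fives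

        length≡ : length L ≡ length threes ℕ.+ length fives
        length≡ = trans (sym (↭.↭-length perm)) (List.length-++ threes)

        double : + 2 * total L ~ (+ length threes * + 3 + + length fives * + 5) * a
        double = mk~ (Z-≡ (trans (e (total threes) (total fives) (+ length threes) (+ length fives) a)
            (cong (λ t → + 2 * t - (+ length threes * + 3 + + length fives * + 5) * a) (trans (sym (total-++ threes fives)) (total-↭ perm))))
          (∣m∣n⇒∣m+n (un~ (double-total {a} {+ 3} are-threes)) (un~ (double-total {a} {+ 5} are-fives))))
          where e : ∀ t u i j a → + 2 * t - (i * + 3) * a + (+ 2 * u - (j * + 5) * a) ≡ + 2 * (t + u) - (i * + 3 + j * + 5) * a
                e = solve-∀

        count<p : length L ℕ.≤ 5 → count ℕ.< p
        count<p ≤5 = ℕ.≤-<-trans (ℕ.+-monoˡ-≤ _ (ℕ.m≤n*m (length threes) 3))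
          (ℕ.≤-<-trans (ℕ.≤-reflexive (sym (ℕ.*-distribˡ-+ 3 (length threes) (length fives))))
            (ℕ.≤-<-trans (ℕ.*-monoʳ-≤ 3 (subst (ℕ._≤ 5) length≡ ≤5)) (<p (ℕ.m≤m+n 15 140))))

      sort : ∀ {L} → All Positive L → Sorted L
      sort [] = sorted [] [] ↭-refl [] []
      sort {x ∷ _} (inj₁ h ∷ ps) = let sorted T F π ts fs = sort ps in sorted (x ∷ T) F (prep x π) (h ∷ ts) fs
      sort {x ∷ _} (inj₂ h ∷ ps) = let sorted T F π ts fs = sort ps in
        sorted T (x ∷ F) (↭-trans (↭.shift x T F) (prep x π)) ts (h ∷ fs)

      -- Doubling the zero sum gives 2m + y ≡ 0, and - 2m ≡ p - 2m = 1 + 2|R|.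
      balance : ∀ {R y} → A ++ R ↭ K → + 2 * total R ~ y * a → y ~ + (1 ℕ.+ 2 ℕ.* length R)
      balance {R} {y} π (mk~ h) = mk~ (Z-≡ (trans (cong (λ q → + 2 * + m + y - + q) (p≡ π))
          (trans (cong (λ q → + 2 * + m + y - (+ 1 + q)) (ℤ.pos-* 2 (m ℕ.+ length R)))
            (trans (e₂ (+ m) (+ length R) y) (cong (λ q → y - (+ 1 + q)) (sym (ℤ.pos-* 2 (length R)))))))
        (∣m∣n⇒∣m-n (Z-cancel {+ 2 * + m + y} (a≢0ᴬ π)
          (Z-≡ (e₁ (+ m) a (total R) y) (∣m∣n⇒∣m-n (∣n⇒∣m*n (+ 2) (zero-sumᴬ π)) h))) Z-p))
        where e₁ : ∀ m a t y → + 2 * (m * a + t) - (+ 2 * t - y * a) ≡ (+ 2 * m + y) * a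
              e₁ = solve-∀
              e₂ : ∀ m r y → + 2 * m + y - (+ 1 + + 2 * (m + r)) ≡ y - (+ 1 + + 2 * r)
              e₂ = solve-∀

      -- The balance would read i + 3j = 1, although i + j ≥ 3. The bound of five terms allows the
      -- congruence to be read as an equation.
      not-all-positive : ∀ R → A ++ R ↭ K → All (_≢ a) R → 3 ℕ.≤ length R → ¬ All Positive R
      not-all-positive R π ≢a 3≤ pos = ℕ.<⇒≢ (ℕ.≤-trans (s≤s (s≤s z≤n)) (ℕ.≤-trans 3≤ length≤count)) (sym count≡1)
        where
        S = sort pos
        open Sorted S
        few : length R ℕ.≤ 5
        few = few-positive R [] (subst (λ X → A ++ X ↭ K) (sym (List.++-identityʳ R)) π) ≢a pos
        length≤count : length R ℕ.≤ count
        length≤count = ℕ.≤-trans (ℕ.≤-reflexive length≡) (ℕ.+-monoʳ-≤ (length threes) (ℕ.m≤n*m (length fives) 3))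
        count≡1 : count ≡ 1
        count≡1 = ~⇒≡ (count<p few) (<p (ℕ.m≤m+n 1 154)) (mk~ (Z-≡
          (trans (cong (λ q → + length threes * + 3 + + length fives * + 5 - (+ 1 + q))
              (trans (ℤ.pos-* 2 (length R)) (cong (λ q → + 2 * + q) length≡)))
            (trans (e (+ length threes) (+ length fives)) (cong (λ q → + length threes + q - + 1) (sym (ℤ.pos-* 3 (length fives))))))
          (un~ (balance {y = + length threes * + 3 + + length fives * + 5} π double))))
          where e : ∀ i j → i * + 3 + j * + 5 - (+ 1 + + 2 * (i + j)) ≡ i + + 3 * j - + 1
                e = solve-∀

      same : ∀ z {x y} → x ∈ K → y ∈ K → Half x z → Half y z → x ≡ y
      same z x∈K y∈K hx hy = canonical x∈K y∈K (2*-cancel (<p (ℕ.m≤m+n 2 153)) (~-trans hx (~-sym hy)))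

      Form : Set
      Form = (∃₂ λ h k → A ++ replicate 4 h ++ k ∷ [] ↭ K × Half h (+ 3) × Half k (- + 1))
           ⊎ (∃₂ λ h k → A ++ replicate 2 h ++ k ∷ [] ↭ K × Half h (+ 5) × Half k (- + 3))

      pair-kinds : ∀ {x y W} → 1 ℕ.≤ length W → A ++ x ∷ y ∷ W ↭ K → All (_≢ a) (x ∷ y ∷ W) →
        ∃₂ λ κ κ′ → Half x (value κ) × Half y (value κ′) × Compatible κ κ′
      pair-kinds {W = f ∷ W} _ π (x≢a ∷ y≢a ∷ f≢a ∷ _) = kinds (with-six π) x≢a y≢a f≢a

      Partner : ℤ → ℤ → Set
      Partner x y = (Half x (- + 1) × Positive y) ⊎ (Half x (- + 3) × Half y (+ 5))

      partner : ∀ {x y} → ¬ Positive x → (∃₂ λ κ κ′ → Half x (value κ) × Half y (value κ′) × Compatible κ κ′) → Partner x y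
      partner {x} {y} ¬pos (κ , κ′ , hx , hy , κ∥κ′) = go κ κ′ hx hy κ∥κ′
        where
        left : ∀ κ κ′ → Compatible κ κ′ → Half x (value κ) → Half y (value κ′) → Partner x y
        right : ∀ κ κ′ → Compatible κ κ′ → Half y (value κ) → Half x (value κ′) → Partner x y
        left  _ _ c₃₃  hx hy = contradiction (inj₁ hx) ¬pos
        left  _ _ c₃₅  hx hy = contradiction (inj₁ hx) ¬pos
        left  _ _ c₅₅  hx hy = contradiction (inj₂ hx) ¬pos
        left  _ _ c₋₁₃ hx hy = inj₁ (hx , inj₁ hy)
        left  _ _ c₋₁₅ hx hy = inj₁ (hx , inj₂ hy)
        left  _ _ c₋₃₅ hx hy = inj₂ (hx , hy)
        left  _ _ (flip κ∥κ′) hx hy = right _ _ κ∥κ′ hy hx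
        right _ _ c₃₃  hy hx = contradiction (inj₁ hx) ¬pos
        right _ _ c₃₅  hy hx = contradiction (inj₂ hx) ¬pos
        right _ _ c₅₅  hy hx = contradiction (inj₂ hx) ¬pos
        right _ _ c₋₁₃ hy hx = contradiction (inj₁ hx) ¬pos
        right _ _ c₋₁₅ hy hx = contradiction (inj₂ hx) ¬pos
        right _ _ c₋₃₅ hy hx = contradiction (inj₂ hx) ¬pos
        right _ _ (flip κ∥κ′) hy hx = left _ _ κ∥κ′ hx hy
        go : ∀ κ κ′ → Half x (value κ) → Half y (value κ′) → Compatible κ κ′ → Partner x y
        go κ κ′ hx hy κ∥κ′ = left κ κ′ κ∥κ′ hx hy

      partners : ∀ {x R} → ¬ Positive x → A ++ x ∷ R ↭ K → All (_≢ a) (x ∷ R) → 2 ℕ.≤ length R → All (Partner x) R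
      partners {x} {R} ¬pos π ≢a 2≤ = All.tabulate λ y∈R → with-partner (extract y∈R)
        where
        with-partner : ∀ {y} → (∃₂ λ y′ W → y ≡ y′ × y′ ∷ W ↭ R) → Partner x y
        with-partner {y} (_ , W , refl , ρ) = partner ¬pos (pair-kinds (ℕ.≤-pred (subst (2 ℕ.≤_) (sym (↭.↭-length ρ)) 2≤))
          (↭-trans (↭.++⁺ˡ A (prep x ρ)) π) (↭.All-resp-↭ (prep x (↭-sym ρ)) ≢a))

      others∈K : ∀ {R} → A ++ R ↭ K → All (_∈ K) R
      others∈K π = All.tabulate λ y∈R → ↭.∈-resp-↭ π (∈-++⁺ʳ A y∈R)

      all-same : ∀ z {L h} → h ∈ K → Half h z → All (_∈ K) L → All (λ x → Half x z) L → L ≡ replicate (length L) h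
      all-same z h∈K hh ∈Ks hs = all-equal (All.zipWith (λ (x∈K , hx) → same z x∈K h∈K hx hh) (∈Ks , hs))

      -- This excludes the third solution of the balance, with one term each of y = - 1, 3, 5.
      -- Without k, the element (m + 2)a is not a sum: after doubling and subtracting any choice of
      -- x and h, the coefficient is 2m + 4, 2m + 1, 2m + 5 or 2m + 2, while copies of a supply only
      -- 2i ≤ 2m, and p = 2m + 7.
      not-minus-three-five : ∀ {x h k} → A ++ x ∷ h ∷ k ∷ [] ↭ K → Half x (- + 1) → Half h (+ 3) → ⊥
      not-minus-three-five {x} {h} {k} π (mk~ hx) (mk~ hh) = missing (full k (x ∷ h ∷ A)
          (↭-trans (Perm.solve 4 (λ A x h k → k ⊕ x ⊕ h ⊕ A ⊜ A ⊕ x ⊕ h ⊕ k) ↭-refl A [ x ] [ h ] [ k ]) π) v)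
        where
        v : ℤ
        v = + (2 ℕ.+ m) * a
        p₃ : p ≡ 7 ℕ.+ 2 ℕ.* m
        p₃ = trans (p≡ π) (eq m)
          where eq : ∀ m → 1 ℕ.+ 2 ℕ.* (m ℕ.+ 3) ≡ 7 ℕ.+ 2 ℕ.* m
                eq = ℕ-Ring.solve-∀
        2i<p : ∀ {i} → i ℕ.≤ m → 2 ℕ.* i ℕ.< p
        2i<p {i} i≤m = subst (2 ℕ.* i ℕ.<_) (sym p₃) (ℕ.≤-<-trans (ℕ.*-monoʳ-≤ 2 i≤m) (s≤s (ℕ.m≤n+m (2 ℕ.* m) 6)))
        equal : ∀ e {i} → 2 ℕ.* m ℕ.+ e ℕ.< p → i ℕ.≤ m → Z ((+ 2 * + m + + e - + 2 * + i) * a) → 2 ℕ.* m ℕ.+ e ≡ 2 ℕ.* i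
        equal e {i} e<p i≤m z = ~⇒≡ e<p (2i<p i≤m) (mk~ (Z-≡
          (cong₂ (λ u w → u + + e - w) (sym (ℤ.pos-* 2 m)) (sym (ℤ.pos-* 2 i)))
          (Z-cancel {+ 2 * + m + + e - + 2 * + i} (a≢0ᴬ π) z)))
        bound : ∀ e → e ℕ.≤ 6 → 2 ℕ.* m ℕ.+ e ℕ.< p
        bound e e≤6 = subst (2 ℕ.* m ℕ.+ e ℕ.<_) (sym p₃)
          (s≤s (ℕ.≤-trans (ℕ.+-monoʳ-≤ (2 ℕ.* m) e≤6) (ℕ.≤-reflexive (ℕ.+-comm (2 ℕ.* m) 6))))
        too-large : ∀ e {i} → i ℕ.≤ m → 2 ℕ.* m ℕ.+ suc e ≢ 2 ℕ.* i
        too-large e i≤m eq = ℕ.<⇒≱ (ℕ.m<m+n (2 ℕ.* m) (s≤s z≤n)) (subst (ℕ._≤ 2 ℕ.* m) (sym eq) (ℕ.*-monoʳ-≤ 2 i≤m))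
        missing : ¬ SubsetSum (x ∷ h ∷ A) v
        missing (skip (skip s)) = let i , i≤m , q = SubsetSum-replicate⁻ m a s in
          too-large 3 i≤m (equal 4 (bound 4 (ℕ.m≤m+n 4 2)) i≤m (Z-≡ (e (+ m) (+ i) a) (∣n⇒∣m*n (+ 2) (un~ q))))
          where e : ∀ m i a → + 2 * ((+ 2 + m) * a - i * a) ≡ (+ 2 * m + + 4 - + 2 * i) * a
                e = solve-∀
        missing (skip (take s)) = let i , i≤m , q = SubsetSum-replicate⁻ m a s in
          too-large 0 i≤m (equal 1 (bound 1 (ℕ.m≤m+n 1 5)) i≤m (Z-≡ (e (+ m) (+ i) a h) (∣m∣n⇒∣m+n (∣n⇒∣m*n (+ 2) (un~ q)) hh)))
          where e : ∀ m i a h → + 2 * ((+ 2 + m) * a - h - i * a) + (+ 2 * h - + 3 * a) ≡ (+ 2 * m + + 1 - + 2 * i) * a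
                e = solve-∀
        missing (take (skip s)) = let i , i≤m , q = SubsetSum-replicate⁻ m a s in
          too-large 4 i≤m (equal 5 (bound 5 (ℕ.m≤m+n 5 1)) i≤m (Z-≡ (e (+ m) (+ i) a x) (∣m∣n⇒∣m+n (∣n⇒∣m*n (+ 2) (un~ q)) hx)))
          where e : ∀ m i a x → + 2 * ((+ 2 + m) * a - x - i * a) + (+ 2 * x - (- + 1) * a) ≡ (+ 2 * m + + 5 - + 2 * i) * a
                e = solve-∀
        missing (take (take s)) = let i , i≤m , q = SubsetSum-replicate⁻ m a s in
          too-large 1 i≤m (equal 2 (bound 2 (ℕ.m≤m+n 2 4)) i≤m (Z-≡ (e (+ m) (+ i) a x h) (∣m∣n⇒∣m+n (∣m∣n⇒∣m+n (∣n⇒∣m*n (+ 2) (un~ q)) hx) hh)))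
          where e : ∀ m i a x h → + 2 * ((+ 2 + m) * a - x - h - i * a) + (+ 2 * x - (- + 1) * a) + (+ 2 * h - + 3 * a) ≡ (+ 2 * m + + 2 - + 2 * i) * a
                e = solve-∀

      few-partners : ∀ {x R} → A ++ x ∷ R ↭ K → All (_≢ a) (x ∷ R) → All Positive R → length R ℕ.≤ 5
      few-partners {x} {R} π (_ ∷ ≢a) = few-positive R (x ∷ [])
        (↭-trans (Perm.solve 3 (λ A x R → A ⊕ R ⊕ x ⊜ A ⊕ x ⊕ R) ↭-refl A [ x ] R) π) ≢a

      with-minus-one : ∀ {x R} → A ++ x ∷ R ↭ K → All (_≢ a) (x ∷ R) → All Positive R → Half x (- + 1) → Form
      with-minus-one {x} {R} π ≢a pos (mk~ hx) = shape threes fives perm are-threes are-fives count≡4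
        where
        open Sorted (sort pos)
        -- From - 1 + 3i + 5j = 1 + 2(1 + i + j) one gets i + 3j = 4, so i = 4 and j = 0, or i = j =
        -- 1.
        count≡4 : count ≡ 4
        count≡4 = ~⇒≡ (count<p (few-partners π ≢a pos)) (<p (ℕ.m≤m+n 4 151)) (mk~ (Z-≡
          (trans (cong (λ q → - + 1 + (+ length threes * + 3 + + length fives * + 5) - (+ 1 + q))
              (trans (ℤ.pos-* 2 (suc (length R))) (cong (λ q → + 2 * (+ 1 + + q)) length≡)))
            (trans (e (+ length threes) (+ length fives)) (cong (λ q → + length threes + q - + 4) (sym (ℤ.pos-* 3 (length fives))))))
          (un~ (balance {y = - + 1 + (+ length threes * + 3 + + length fives * + 5)} π
            (mk~ (Z-≡ (e′ x (total R) (+ length threes * + 3 + + length fives * + 5) a) (∣m∣n⇒∣m+n hx (un~ double))))))))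
          where e : ∀ i j → - + 1 + (i * + 3 + j * + 5) - (+ 1 + + 2 * (+ 1 + (i + j))) ≡ i + + 3 * j - + 4
                e = solve-∀
                e′ : ∀ x t y a → (+ 2 * x - (- + 1) * a) + (+ 2 * t - y * a) ≡ + 2 * (x + t) - (- + 1 + y) * a
                e′ = solve-∀
        shape : ∀ T F → T ++ F ↭ R → All (λ y → Half y (+ 3)) T → All (λ y → Half y (+ 5)) F → length T ℕ.+ 3 ℕ.* length F ≡ 4 → Form
        shape (h ∷ T) [] ρ (hh ∷ hs) _ eq = inj₁ (h , x
          , subst (λ L → A ++ L ++ x ∷ [] ↭ K)
              (trans (all-same (+ 3) (All.head ∈Ks) hh ∈Ks (hh ∷ hs)) (cong (λ n → replicate n h) (trans (sym (ℕ.+-identityʳ _)) eq)))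
              (↭-trans (Perm.solve 3 (λ A x R → A ⊕ R ⊕ x ⊜ A ⊕ x ⊕ R) ↭-refl A [ x ] (h ∷ T)) πᵀ)
          , hh , mk~ hx)
          where
          πᵀ : A ++ x ∷ h ∷ T ↭ K
          πᵀ = ↭-trans (↭.++⁺ˡ A (prep x (subst (_↭ R) (List.++-identityʳ (h ∷ T)) ρ))) π
          ∈Ks : All (_∈ K) (h ∷ T)
          ∈Ks = All.tail (others∈K πᵀ)
        shape (h ∷ []) (k ∷ []) ρ (hh ∷ []) _ _ = ⊥-elim (not-minus-three-five (↭-trans (↭.++⁺ˡ A (prep x ρ)) π) (mk~ hx) hh)
        shape [] [] _ _ _ ()
        shape [] (_ ∷ []) _ _ _ ()
        shape (_ ∷ _ ∷ []) (_ ∷ []) _ _ _ ()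
        shape (_ ∷ _ ∷ _ ∷ []) (_ ∷ []) _ _ _ ()
        shape (_ ∷ _ ∷ _ ∷ _ ∷ _) (_ ∷ F) _ _ _ eq = contradiction (ℕ.suc-injective (ℕ.suc-injective (ℕ.suc-injective (ℕ.suc-injective eq))))
          λ eq → ℕ.1+n≢0 (trans (sym (ℕ.+-suc _ _)) eq)
        shape T (_ ∷ _ ∷ F) _ _ _ eq = ⊥-elim (≤-absurd {6} {4} {1} (ℕ.≤-trans (ℕ.*-monoʳ-≤ 3 (s≤s (s≤s (z≤n {length F}))))
          (ℕ.≤-trans (ℕ.m≤n+m _ (length T)) (ℕ.≤-reflexive eq))) refl)

      -- With r terms of value 5 the balance is - 3 + 5r = 1 + 2(1 + r), hence r = 2.
      with-minus-three : ∀ {x R} → A ++ x ∷ R ↭ K → All (_≢ a) (x ∷ R) → All (λ y → Half y (+ 5)) R → Half x (- + 3) → Form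
      with-minus-three {x} {R} π ≢a fives (mk~ hx) = shape R π fives
          (ℕ.*-cancelˡ-≡ (length R) 2 3 (~⇒≡ (ℕ.≤-<-trans (ℕ.*-monoʳ-≤ 3 (few-partners π ≢a (All.map inj₂ fives))) (<p (ℕ.m≤m+n 15 140)))
            (<p (ℕ.m≤m+n 6 149)) (mk~ (Z-≡
              (trans (cong (λ q → - + 3 + + length R * + 5 - (+ 1 + q)) (ℤ.pos-* 2 (suc (length R))))
                (trans (e (+ length R)) (cong (_- + 6) (sym (ℤ.pos-* 3 (length R))))))
              (un~ (balance {y = - + 3 + + length R * + 5} π
                (mk~ (Z-≡ (e′ x (total R) (+ length R * + 5) a) (∣m∣n⇒∣m+n hx (un~ (double-total {a} {+ 5} fives)))))))))))
        where
        e : ∀ r → - + 3 + r * + 5 - (+ 1 + + 2 * (+ 1 + r)) ≡ + 3 * r - + 6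
        e = solve-∀
        e′ : ∀ x t y a → (+ 2 * x - (- + 3) * a) + (+ 2 * t - y * a) ≡ + 2 * (x + t) - (- + 3 + y) * a
        e′ = solve-∀
        shape : ∀ R → A ++ x ∷ R ↭ K → All (λ y → Half y (+ 5)) R → length R ≡ 2 → Form
        shape (h ∷ R) π (hh ∷ hs) eq = inj₂ (h , x
          , subst (λ L → A ++ L ++ x ∷ [] ↭ K) (trans (all-same (+ 5) (All.head ∈Ks) hh ∈Ks (hh ∷ hs)) (cong (λ n → replicate n h) eq))
              (↭-trans (Perm.solve 3 (λ A x R → A ⊕ R ⊕ x ⊜ A ⊕ x ⊕ R) ↭-refl A [ x ] (h ∷ R)) π)
          , hh , mk~ hx)
          where
          ∈Ks : All (_∈ K) (h ∷ R)
          ∈Ks = All.tail (others∈K π)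

      -- Since `kinds` asks for a third term different from a, up to two other terms are treated
      -- separately. Once some term is not positive, its partners all are.
      form : ∀ R → A ++ R ↭ K → All (_≢ a) R → Form
      form []           π _                   = ⊥-elim (only-a π)
      form (b ∷ [])     π _                   = ⊥-elim (one-other π)
      form (b ∷ c ∷ []) π (b≢a ∷ c≢a ∷ [])    = ⊥-elim (two-others b≢a c≢a π)
      form R@(_ ∷ _ ∷ _ ∷ _) π ≢a = split (All.all? positive? R)
        where
        3≤ : 3 ℕ.≤ length R
        3≤ = s≤s (s≤s (s≤s z≤n))
        choose : ∀ {x M} → A ++ x ∷ M ↭ K → All (_≢ a) (x ∷ M) → Dec (Half x (- + 1)) → All (Partner x) M → 2 ℕ.≤ length M → Form
        choose π ≢a (yes h)  ps _ = with-minus-one π ≢a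
          (All.map [ proj₂ , inj₂ ∘ proj₂ ]′ ps) h
        choose {x} {y ∷ M} π ≢a (no ¬h) ps@(p₀ ∷ _) _ = with-minus-three π ≢a
          (All.map [ (λ (h , _) → contradiction h ¬h) , proj₂ ]′ ps) ([ (λ (h , _) → contradiction h ¬h) , proj₁ ]′ p₀)
        negative : (∃₂ λ x M → ¬ Positive x × x ∷ M ↭ R) → Form
        negative (x , M , ¬pos , ρ) = choose πˣ ≢aˣ ((+ 2 * x) ~? (- + 1 * a)) (partners ¬pos πˣ ≢aˣ 2≤) 2≤
          where
          πˣ : A ++ x ∷ M ↭ K
          πˣ = ↭-trans (↭.++⁺ˡ A ρ) π
          ≢aˣ : All (_≢ a) (x ∷ M)
          ≢aˣ = ↭.All-resp-↭ (↭-sym ρ) ≢a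
          2≤ : 2 ℕ.≤ length M
          2≤ = ℕ.≤-pred (subst (3 ℕ.≤_) (sym (↭.↭-length ρ)) 3≤)
        split : Dec (All Positive R) → Form
        split (yes pos) = ⊥-elim (not-all-positive R π ≢a 3≤ pos)
        split (no ¬pos) = negative (extract (All.¬All⇒Any¬ positive? R ¬pos))

    -- More than 65 = 5 · 13 terms with at most 13 values force a sixfold repetition.
    frequent : ∃[ a ] ∃₂ λ m R → 6 ℕ.≤ m × replicate m a ++ R ↭ K × All (_≢ a) R
    frequent = [ (λ r → r) , (λ (V , W , π , len , V!) → contradiction (subst (14 ℕ.≤_) (sym len) ℕ.≤-refl)
        (ℕ.<⇒≱ (Diverse.few-values p prime K unsplittable V W π V!))) ]′
      (repeated-or-distinct 5 13 K (ℕ.*-cancelˡ-< 2 65 (length K)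
        (ℕ.<-≤-trans (ℕ.m≤m+n 131 24) (ℕ.≤-pred (subst (155 ℕ.<_) size 155<p)))))

  -- Coordinates on a cyclic group of order p.

  module MultiplesInGroup {c ℓ} (G : AbelianGroup c ℓ) (p : ℕ) (prime : Prime p) where

    open ZeroSum G renaming (_↭_ to _↭ᴳ_; _∈_ to _∈ᴳ_; _∣_ to _∣ᴳ_)
    private module G = AbelianGroup G
    module ↭ᴳ = Permutationᴳ setoid
    module ↭ᴾ = PermutationPropertiesᴳ setoid
    open Mult G.monoid using (×-homo-+; ×-assocˡ; ×-congʳ; ×-homo-1)
    open ≈-Reasoning setoid
    open Residues p prime

    ·-zero : ∀ q {x} → x ≈ 0ᴳ → q · x ≈ 0ᴳ
    ·-zero zero    x≈0 = G.refl
    ·-zero (suc q) x≈0 = G.trans (G.∙-cong x≈0 (·-zero q x≈0)) (G.identityˡ 0ᴳ)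

    ·-≡ : ∀ {i j} x → i ≡ j → i · x ≈ j · x
    ·-≡ x refl = G.refl

    ·-mod : ∀ {n g} .{{_ : NonZero n}} → n · g ≈ 0ᴳ → ∀ k → k · g ≈ (k ℕ.% n) · g
    ·-mod {n} {g} ng≈0 k = begin
      k · g                                   ≈⟨ ·-≡ g (ℕ.m≡m%n+[m/n]*n k n) ⟩
      (k ℕ.% n ℕ.+ (k ℕ./ n) ℕ.* n) · g       ≈⟨ ×-homo-+ g (k ℕ.% n) ((k ℕ./ n) ℕ.* n) ⟩
      (k ℕ.% n) · g +ᴳ ((k ℕ./ n) ℕ.* n) · g  ≈⟨ G.∙-congˡ (G.trans (G.sym (×-assocˡ g (k ℕ./ n) n)) (·-zero (k ℕ./ n) ng≈0)) ⟩
      (k ℕ.% n) · g +ᴳ 0ᴳ                     ≈⟨ G.identityʳ _ ⟩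
      (k ℕ.% n) · g                           ∎

    cancel-≤ : ∀ {i j g} → i ℕ.≤ j → i · g ≈ j · g → (j ℕ.∸ i) · g ≈ 0ᴳ
    cancel-≤ {i} {j} {g} i≤j eq = G.sym (∙-cancelˡ (i · g) _ _ (begin
      i · g +ᴳ 0ᴳ              ≈⟨ G.identityʳ _ ⟩
      i · g                    ≈⟨ eq ⟩
      j · g                    ≈⟨ ·-≡ g (sym (ℕ.m+[n∸m]≡n i≤j)) ⟩
      (i ℕ.+ (j ℕ.∸ i)) · g    ≈⟨ ×-homo-+ g i (j ℕ.∸ i) ⟩
      i · g +ᴳ (j ℕ.∸ i) · g   ∎))
      where open GroupProperties G.group using (∙-cancelˡ)

    record Order-p (g : Carrier) : Set ℓ where
      field
        p·g≈0   : p · g ≈ 0ᴳ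
        p∣-kernel : ∀ k → k · g ≈ 0ᴳ → p ℕ.∣ k

    module WithGenerator (cyclic : CyclicOfOrder p) where

      γ : Carrier
      γ = cyclic .proj₁ .proj₁

      private module B = Bijection (cyclic .proj₂)

      index : Carrier → Fin p
      index x = B.strictlySurjective x .proj₁

      to-index : ∀ x → B.to (index x) ≈ x
      to-index x = B.strictlySurjective x .proj₂

      index-≈ : ∀ {x y} → index x ≡ index y → x ≈ y
      index-≈ {x} {y} eq = G.trans (G.sym (to-index x)) (G.trans (G.reflexive (cong B.to eq)) (to-index y))

      finite-order : ∃[ n ] 1 ℕ.≤ n × n ℕ.≤ p × n · γ ≈ 0ᴳ
      finite-order with Fin.pigeonhole (ℕ.n<1+n p) (λ i → index (toℕ i · γ))
      ... | i , j , i<j , eq = toℕ j ℕ.∸ toℕ i , ℕ.m<n⇒0<n∸m i<j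
            , ℕ.≤-trans (ℕ.m∸n≤m (toℕ j) (toℕ i)) (ℕ.≤-pred (Fin.toℕ<n j)) , cancel-≤ (ℕ.<⇒≤ i<j) (index-≈ eq)

      -- Natural multiples suffice because γ has finite order: if (n + 1)γ = 0, then the negative of
      -- iγ is (in)γ.
      multiples : ∀ {n} → 1 ℕ.≤ n → n · γ ≈ 0ᴳ → ∀ {h} → ⟨ γ ⟩₁ h → ∃[ k ] h ≈ k · γ
      multiples 1≤n nγ≈0 (incl (here h≈γ)) = 1 , G.trans h≈γ (G.sym (×-homo-1 γ))
      multiples 1≤n nγ≈0 zer = 0 , G.refl
      multiples 1≤n nγ≈0 (add u v) =
        let i , x≈ = multiples 1≤n nγ≈0 u ; j , y≈ = multiples 1≤n nγ≈0 v in
        i ℕ.+ j , G.trans (G.∙-cong x≈ y≈) (G.sym (×-homo-+ γ i j))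
      multiples {suc n} 1≤n nγ≈0 (neg {x} u) = let i , x≈ = multiples 1≤n nγ≈0 u in
        i ℕ.* n , G.sym (inverseʳ-unique x _ (begin
          x +ᴳ (i ℕ.* n) · γ        ≈⟨ G.∙-congʳ x≈ ⟩
          i · γ +ᴳ (i ℕ.* n) · γ    ≈⟨ ×-homo-+ γ i (i ℕ.* n) ⟨
          (i ℕ.+ i ℕ.* n) · γ       ≈⟨ ·-≡ γ (sym (ℕ.*-suc i n)) ⟩
          (i ℕ.* suc n) · γ         ≈⟨ ×-assocˡ γ i (suc n) ⟨
          i · (suc n · γ)           ≈⟨ ·-zero i nγ≈0 ⟩
          0ᴳ                        ∎))
        where open GroupProperties G.group using (inverseʳ-unique)
      multiples 1≤n nγ≈0 (resp x≈y u) = let i , x≈ = multiples 1≤n nγ≈0 u in i , G.trans (G.sym x≈y) x≈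

      -- Each of the p elements is determined by its coefficient modulo n.
      p≤order : ∀ {n} → 1 ℕ.≤ n → n · γ ≈ 0ᴳ → p ℕ.≤ n
      p≤order {n@(suc _)} 1≤n nγ≈0 = Fin.injective⇒≤ {f = λ i → fromℕ< (coefficient< i)} injective
        where
        coefficient : Fin p → ℕ
        coefficient i = multiples 1≤n nγ≈0 (cyclic .proj₁ .proj₂ (B.to i)) .proj₁
        coefficient< : ∀ i → coefficient i ℕ.% n ℕ.< n
        coefficient< i = ℕ.m%n<n (coefficient i) n
        to≈ : ∀ i → B.to i ≈ (coefficient i ℕ.% n) · γ
        to≈ i = G.trans (multiples 1≤n nγ≈0 (cyclic .proj₁ .proj₂ (B.to i)) .proj₂) (·-mod nγ≈0 (coefficient i))
        injective : ∀ {i j} → fromℕ< (coefficient< i) ≡ fromℕ< (coefficient< j) → i ≡ j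
        injective {i} {j} eq = B.injective (G.trans (to≈ i) (G.trans (·-≡ γ
          (trans (sym (Fin.toℕ-fromℕ< (coefficient< i))) (trans (cong toℕ eq) (Fin.toℕ-fromℕ< (coefficient< j))))) (G.sym (to≈ j))))

      p·γ≈0 : p · γ ≈ 0ᴳ
      p·γ≈0 = let n , 1≤n , n≤p , nγ≈0 = finite-order in
        G.trans (·-≡ γ (ℕ.≤-antisym (p≤order 1≤n nγ≈0) n≤p)) nγ≈0

      γ-order : Order-p γ
      γ-order = record { p·g≈0 = p·γ≈0 ; p∣-kernel = kernel }
        where
        kernel : ∀ k → k · γ ≈ 0ᴳ → p ℕ.∣ k
        kernel k kγ≈0 = ℕ.m%n≡0⇒n∣m k p (ℕ.n<1⇒n≡0 (ℕ.≰⇒> λ 1≤ → ℕ.<⇒≱ (ℕ.m%n<n k p)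
          (p≤order 1≤ (G.trans (G.sym (·-mod p·γ≈0 k)) kγ≈0))))

      -- The range 1, ..., p is that of the norm, so 0 gets the coefficient p.
      coordinate : ∀ h → ∃[ k ] 1 ℕ.≤ k × k ℕ.≤ p × h ≈ k · γ
      coordinate h = positive (k ℕ.% p) (ℕ.m%n<n k p) (G.trans h≈ (·-mod p·γ≈0 k))
        where
        k = multiples (ℕ.>-nonZero⁻¹ p) p·γ≈0 (cyclic .proj₁ .proj₂ h) .proj₁
        h≈ = multiples (ℕ.>-nonZero⁻¹ p) p·γ≈0 (cyclic .proj₁ .proj₂ h) .proj₂
        positive : ∀ k → k ℕ.< p → h ≈ k · γ → ∃[ k ] 1 ℕ.≤ k × k ℕ.≤ p × h ≈ k · γ
        positive zero    _   h≈0 = p , ℕ.>-nonZero⁻¹ p , ℕ.≤-refl , G.trans h≈0 (G.sym p·γ≈0)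
        positive (suc k) k<p h≈  = suc k , s≤s z≤n , ℕ.<⇒≤ k<p , h≈

      nonzero-order : ∀ {g} → ¬ g ≈ 0ᴳ → Order-p g
      nonzero-order {g} g≉0 = let k , _ , _ , g≈kγ = coordinate g in from k g≈kγ
        where
        from : ∀ k → g ≈ k · γ → Order-p g
        from k g≈kγ = record
          { p·g≈0 = begin
              p · g              ≈⟨ ×-congʳ p g≈kγ ⟩
              p · (k · γ)        ≈⟨ ×-assocˡ γ p k ⟩
              (p ℕ.* k) · γ      ≈⟨ ·-≡ γ (ℕ.*-comm p k) ⟩
              (k ℕ.* p) · γ      ≈⟨ ×-assocˡ γ k p ⟨
              k · (p · γ)        ≈⟨ ·-zero k p·γ≈0 ⟩
              0ᴳ                 ∎
          ; p∣-kernel = λ m mg≈0 → [ (λ p∣m → p∣m) , (λ p∣k → contradiction (zero-multiple p∣k) g≉0) ]′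
              (euclidsLemma m k prime (Order-p.p∣-kernel γ-order (m ℕ.* k)
                (G.trans (G.sym (×-assocˡ γ m k)) (G.trans (×-congʳ m (G.sym g≈kγ)) mg≈0))))
          }
          where
          zero-multiple : p ℕ.∣ k → g ≈ 0ᴳ
          zero-multiple (ℕ.divides q refl) = G.trans g≈kγ (G.trans (G.sym (×-assocˡ γ q p)) (·-zero q p·γ≈0))

    module Multiples {g : Carrier} (order : Order-p g) where

      open Order-p order public

      ·-~-≤ : ∀ {i j} → i ℕ.≤ j → + j ~ + i → i · g ≈ j · g
      ·-~-≤ {i} {j} i≤j (mk~ z) with ∣⇒∣ᵤ (Z-≡ (trans (ℤ.m-n≡m⊖n j i) (ℤ.⊖-≥ i≤j)) z)
      ... | ℕ.divides q eq = G.sym (begin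
        j · g                     ≈⟨ ·-≡ g (sym (ℕ.m+[n∸m]≡n i≤j)) ⟩
        (i ℕ.+ (j ℕ.∸ i)) · g     ≈⟨ ×-homo-+ g i (j ℕ.∸ i) ⟩
        i · g +ᴳ (j ℕ.∸ i) · g    ≈⟨ G.∙-congˡ (·-≡ g eq) ⟩
        i · g +ᴳ (q ℕ.* p) · g    ≈⟨ G.∙-congˡ (G.trans (G.sym (×-assocˡ g q p)) (·-zero q p·g≈0)) ⟩
        i · g +ᴳ 0ᴳ               ≈⟨ G.identityʳ _ ⟩
        i · g                     ∎)

      ·-~ : ∀ {i j} → + i ~ + j → i · g ≈ j · g
      ·-~ {i} {j} q with ℕ.≤-total i j
      ... | inj₁ i≤j = ·-~-≤ i≤j (~-sym q)
      ... | inj₂ j≤i = G.sym (·-~-≤ j≤i q)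

      -- The homomorphism x ↦ xg, taken through the residue because `_·_` forms natural multiples
      -- only.
      φ : ℤ → Carrier
      φ x = residue x .proj₁ · g

      φ-~ : ∀ {x y} → x ~ y → φ x ≈ φ y
      φ-~ {x} {y} q = ·-~ (~-trans (~-sym (residue x .proj₂ .proj₂)) (~-trans q (residue y .proj₂ .proj₂)))

      φ-+ᴺ : ∀ n → φ (+ n) ≈ n · g
      φ-+ᴺ n = ·-~ (~-sym (residue (+ n) .proj₂ .proj₂))

      φ-+ : ∀ x y → φ (x + y) ≈ φ x +ᴳ φ y
      φ-+ x y = G.trans (·-~ (~-trans (~-sym (residue (x + y) .proj₂ .proj₂))
          (~-+ (residue x .proj₂ .proj₂) (residue y .proj₂ .proj₂))))
        (×-homo-+ g (residue x .proj₁) (residue y .proj₁))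

      φ-0 : ∀ {x} → Z x → φ x ≈ 0ᴳ
      φ-0 z = G.trans (φ-~ (Z⇒~0 z)) (φ-+ᴺ 0)

      φ-0⁻ : ∀ {x} → φ x ≈ 0ᴳ → Z x
      φ-0⁻ {x} eq = Z-resp (~-sym (residue x .proj₂ .proj₂)) (∣ᵤ⇒∣ (p∣-kernel _ eq))

      φ-* : ∀ n x → φ (+ n * x) ≈ n · φ x
      φ-* zero    x = φ-0 (Z-≡ (sym (ℤ.*-zeroˡ x)) Z-0)
      φ-* (suc n) x = G.trans (φ-~ (~-reflexive (ℤ.suc-* (+ n) x))) (G.trans (φ-+ x (+ n * x)) (G.∙-congˡ (φ-* n x)))

      φ-total : ∀ U → σ (List.map φ U) ≈ φ (total U)
      φ-total []      = G.sym (φ-0 Z-0)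
      φ-total (u ∷ U) = G.trans (G.∙-congˡ (φ-total U)) (G.sym (φ-+ u (total U)))

  -- Transfer of unsplittability from the group to integer coefficients.

  module SplitSums (p : ℕ) (prime : Prime p) where

    open Residues p prime

    SubsetSum-total : ∀ U → SubsetSum U (total U)
    SubsetSum-total []      = done Z-0
    SubsetSum-total (u ∷ U) = take (SubsetSum-≡ U (e u (total U)) (SubsetSum-total U))
      where e : ∀ u t → t ≡ u + t - u
            e = solve-∀

    locate : ∀ {y : ℤ} {M} U V → U ++ V ↭ y ∷ M →
      (∃[ U′ ] y ∷ U′ ↭ U × U′ ++ V ↭ M) ⊎ (∃[ V′ ] y ∷ V′ ↭ V × U ++ V′ ↭ M)
    locate {y} {M} U V π = [ inj₁ ∘ left ∘ extract , inj₂ ∘ right ∘ extract ]′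
        (∈-++⁻ U (↭.∈-resp-↭ (↭-sym π) (here refl)))
      where
      left : (∃₂ λ y′ U′ → y ≡ y′ × y′ ∷ U′ ↭ U) → ∃[ U′ ] y ∷ U′ ↭ U × U′ ++ V ↭ M
      left (_ , U′ , refl , ρ) = U′ , ρ , ↭.drop-∷ (↭-trans (↭.++⁺ʳ V ρ) π)
      right : (∃₂ λ y′ V′ → y ≡ y′ × y′ ∷ V′ ↭ V) → ∃[ V′ ] y ∷ V′ ↭ V × U ++ V′ ↭ M
      right (_ , V′ , refl , ρ) = V′ , ρ , ↭.drop-∷ (↭-trans (↭-sym (↭.shift y U V′)) (↭-trans (↭.++⁺ˡ U ρ) π))

    module _ {K : List ℤ} (zero-sum : Z (total K))
      (minimal : ∀ u U r R → (u ∷ U) ++ (r ∷ R) ↭ K → ¬ Z (total (u ∷ U))) where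

      proper : ∀ U V → U ++ V ↭ K → 1 ℕ.≤ length U → 1 ℕ.≤ length V → ¬ Z (total U)
      proper (u ∷ U) (v ∷ V) π _ _ = minimal u U v V π

      -- A proper zero-sum part of the sequence with k split into - x and k + x either avoids or
      -- contains both new terms, against minimality, or has - x on exactly one side,
      -- and then x is a subset sum of T.
      split-minimal : ∀ {k T x} → k ∷ T ↭ K → ¬ SubsetSum T x → ∀ U V → U ++ V ↭ (- x) ∷ (k + x) ∷ T →
        1 ℕ.≤ length U → 1 ℕ.≤ length V → ¬ Z (total U)
      split-minimal {k} {T} {x} πᴷ x∉T U V π 1≤U 1≤V zU = [ in-U , in-V ]′ (locate U V π)
        where
        in-T : ∀ A B → A ++ B ↭ T → total A ~ x → ⊥
        in-T A B ρ A~x = x∉T (SubsetSum-resp T A~x (SubsetSum-↭ ρ (SubsetSum-++ˡ A B (SubsetSum-total A))))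
        total-K : ∀ A B → A ++ B ↭ T → Z (k + (total A + total B))
        total-K A B ρ = Z-≡ (trans (sym (total-↭ πᴷ)) (cong (_+_ k) (trans (sym (total-↭ ρ)) (total-++ A B)))) zero-sum
        in-U : ¬ (∃[ U′ ] (- x) ∷ U′ ↭ U × U′ ++ V ↭ (k + x) ∷ T)
        in-U (U′ , ρ , π′) = [ both , one ]′ (locate U′ V π′)
          where
          zU′ : Z (- x + total U′)
          zU′ = Z-≡ (sym (total-↭ ρ)) zU
          both : ¬ (∃[ U″ ] (k + x) ∷ U″ ↭ U′ × U″ ++ V ↭ T)
          both (U″ , ρ′ , π″) = proper (k ∷ U″) V (↭-trans (prep k π″) πᴷ) (s≤s z≤n) 1≤V
            (Z-≡ (trans (cong (_+_ (- x)) (sym (total-↭ ρ′))) (e k x (total U″))) zU′)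
            where e : ∀ k x t → - x + (k + x + t) ≡ k + t
                  e = solve-∀
          one : ¬ (∃[ V′ ] (k + x) ∷ V′ ↭ V × U′ ++ V′ ↭ T)
          one (V′ , _ , π″) = in-T U′ V′ π″ (mk~ (Z-≡ (ℤ.+-comm (- x) (total U′)) zU′))
        in-V : ¬ (∃[ V′ ] (- x) ∷ V′ ↭ V × U ++ V′ ↭ (k + x) ∷ T)
        in-V (V′ , ρ , π′) = [ one , neither ]′ (locate U V′ π′)
          where
          one : ¬ (∃[ U′ ] (k + x) ∷ U′ ↭ U × U′ ++ V′ ↭ T)
          one (U′ , ρ′ , π″) = in-T V′ U′ (↭-trans (↭.++-comm V′ U′) π″)
            (mk~ (Z-≡ (e k x (total U′) (total V′)) (∣m∣n⇒∣m-n (total-K U′ V′ π″) (Z-≡ (sym (total-↭ ρ′)) zU))))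
            where e : ∀ k x u v → k + (u + v) - (k + x + u) ≡ v - x
                  e = solve-∀
          neither : ¬ (∃[ V″ ] (k + x) ∷ V″ ↭ V′ × U ++ V″ ↭ T)
          neither (V″ , _ , π″) = proper U (k ∷ V″) (↭-trans (↭.shift k U V″) (↭-trans (prep k π″) πᴷ)) 1≤U (s≤s z≤n) zU

  module Transfer {c ℓ} (G : AbelianGroup c ℓ) (p : ℕ) (prime : Prime p) where

    open ZeroSum G renaming (_↭_ to _↭ᴳ_; _∈_ to _∈ᴳ_; _∣_ to _∣ᴳ_)
    private module G = AbelianGroup G
    open MultiplesInGroup G p prime
    open ≋ setoid using (_≋_; ≋-refl; ≋-sym; ≋-trans)
    open Residues p prime
    open SplitSums p prime

    σ-cong : ∀ {S T} → S ↭ᴳ T → σ S ≈ σ T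
    σ-cong = ↭ᴾ.foldr-commMonoid G.isCommutativeMonoid

    removal-↭ : ∀ {x S} (x∈S : x ∈ᴳ S) → x ∷ (S ─ x∈S) ↭ᴳ S
    removal-↭ {x} {y ∷ S} (here x≈y)  = ↭ᴳ.prep x≈y ↭ᴳ.↭-refl
    removal-↭ {x} {y ∷ S} (there x∈S) = ↭ᴳ.trans (↭ᴳ.swap G.refl G.refl ↭ᴳ.↭-refl) (↭ᴳ.prep G.refl (removal-↭ x∈S))

    -- Lifts a rearrangement in G to the coefficients, so that a subsequence in G becomes a sublist
    -- of integers.
    ↭-map : ∀ {φ : ℤ → Carrier} {A B} → A ↭ᴳ B → ∀ L → B ≋ List.map φ L → ∃[ M ] M ↭ L × A ≋ List.map φ M
    ↭-map (↭ᴳ.refl A≋B)   L B≋L = L , ↭-refl , ≋-trans A≋B B≋L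
    ↭-map (↭ᴳ.prep eq π)  (l ∷ L) (eq′ ∷ B≋L) = let M , ρ , A≋M = ↭-map π L B≋L in
      l ∷ M , prep l ρ , G.trans eq eq′ ∷ A≋M
    ↭-map (↭ᴳ.swap eq₁ eq₂ π) (l₁ ∷ l₂ ∷ L) (eq₁′ ∷ eq₂′ ∷ B≋L) = let M , ρ , A≋M = ↭-map π L B≋L in
      l₂ ∷ l₁ ∷ M , swap l₂ l₁ ρ , G.trans eq₁ eq₂′ ∷ G.trans eq₂ eq₁′ ∷ A≋M
    ↭-map (↭ᴳ.trans π π′) L B≋L =
      let M , ρ , A≋M = ↭-map π′ L B≋L ; M′ , ρ′ , A≋M′ = ↭-map π M A≋M in M′ , ↭-trans ρ′ ρ , A≋M′

    ≋-map-++ : ∀ {φ : ℤ → Carrier} A {B} M → A ++ B ≋ List.map φ M →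
      ∃₂ λ U V → U ++ V ≡ M × A ≋ List.map φ U × B ≋ List.map φ V
    ≋-map-++ []      M       B≋M         = [] , M , refl , [] , B≋M
    ≋-map-++ (a ∷ A) (m ∷ M) (a≈m ∷ A≋M) = let U , V , eq , A≋U , B≋V = ≋-map-++ A M A≋M in
      m ∷ U , V , cong (m ∷_) eq , a≈m ∷ A≋U , B≋V

    module _ {g : Carrier} (order : Order-p g) where

      open Multiples order

      map-φ-↭ : ∀ {U V} → U ↭ V → List.map φ U ↭ᴳ List.map φ V
      map-φ-↭ π = ↭⇒↭ₛ′ G.isEquivalence (↭.map⁺ φ π)

      minimal-zero-sum : ∀ L → Z (total L) →
        (∀ U V → U ++ V ↭ L → 1 ℕ.≤ length U → 1 ℕ.≤ length V → ¬ Z (total U)) →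
        ∀ {S} → S ↭ᴳ List.map φ L → MinimalZeroSum S
      minimal-zero-sum L zero-sum proper {S} π =
        G.trans (σ-cong π) (G.trans (φ-total L) (φ-0 zero-sum)) , minimal
        where
        minimal : ∀ T → T ∣ᴳ S → 1 ℕ.≤ length T → length T ℕ.< length S → ¬ σ T ≈ 0ᴳ
        minimal T (R , ρ) 1≤T T<S σT≈0 =
          let M , ρ′ , TR≋M = ↭-map (↭ᴳ.trans ρ π) L ≋-refl
              U , V , eq , T≋U , R≋V = ≋-map-++ T M TR≋M in
          proper U V (subst (_↭ L) (sym eq) ρ′)
            (subst (1 ℕ.≤_) (≋-length T≋U) 1≤T)
            (subst (1 ℕ.≤_) (≋-length R≋V) (ℕ.+-cancelˡ-< (length T) 0 (length R)
              (subst₂ ℕ._<_ (sym (ℕ.+-identityʳ (length T))) (trans (sym (↭ᴾ.xs↭ys⇒|xs|≡|ys| ρ)) (List.length-++ T)) T<S)))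
            (φ-0⁻ (G.trans (G.sym (φ-total U)) (G.trans (σ-cong (↭ᴳ.refl (≋-sym T≋U))) σT≈0)))
          where
          ≋-length : ∀ {A M} → A ≋ List.map φ M → length A ≡ length M
          ≋-length {M = M} A≋M = trans (Pointwise-length A≋M) (List.length-map φ M)

      module Coefficients {S : Sequence} (unsplittable : Unsplittable S) {coefficients : List ℕ}
        (represents : Pointwise (λ x s → 1 ℕ.≤ x × x ℕ.≤ p × s ≈ x · g) coefficients S)
        (size : p ≡ 1 ℕ.+ 2 ℕ.* length S) where

        K : List ℤ
        K = List.map +_ coefficients

        S↭ : S ↭ᴳ List.map φ K
        S↭ = ↭ᴳ.refl (go represents)
          where
          go : ∀ {xs S} → Pointwise (λ x s → 1 ℕ.≤ x × x ℕ.≤ p × s ≈ x · g) xs S → S ≋ List.map φ (List.map +_ xs)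
          go []                      = []
          go {x ∷ _} ((_ , _ , s≈) ∷ rs) = G.trans s≈ (G.sym (φ-+ᴺ x)) ∷ go rs

        zero-sum : Z (total K)
        zero-sum = φ-0⁻ (G.trans (G.sym (φ-total K)) (G.trans (G.sym (σ-cong S↭)) (unsplittable .proj₁ .proj₁)))

        minimal : ∀ u U r R → (u ∷ U) ++ (r ∷ R) ↭ K → ¬ Z (total (u ∷ U))
        minimal u U r R π z = unsplittable .proj₁ .proj₂ (List.map φ (u ∷ U)) (List.map φ (r ∷ R) , ρ)
            (s≤s z≤n)
            (subst (length (List.map φ (u ∷ U)) ℕ.<_) (trans (sym (List.length-++ (List.map φ (u ∷ U)))) (↭ᴾ.xs↭ys⇒|xs|≡|ys| ρ))
              (ℕ.m<m+n _ (s≤s z≤n)))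
            (G.trans (φ-total (u ∷ U)) (φ-0 z))
          where
          ρ : List.map φ (u ∷ U) ++ List.map φ (r ∷ R) ↭ᴳ S
          ρ = ↭ᴳ.trans (↭ᴳ.↭-reflexive (sym (List.map-++ φ (u ∷ U) (r ∷ R)))) (↭ᴳ.trans (map-φ-↭ π) (↭ᴳ.↭-sym S↭))

        full : ∀ k T → k ∷ T ↭ K → ∀ x → SubsetSum T x
        -- If x were not a sum of `T`, replacing φ k by φ (- x) and φ (k + x) would be a valid
        -- splitting.
        full k T π x = decidable-stable (SubsetSum? T x) λ x∉T → unsplittable .proj₂
          (φ k , k∈S , φ (- x) , φ (k + x)
          , G.trans (G.sym (φ-+ (- x) (k + x))) (φ-~ (~-reflexive (e k x)))
          , minimal-zero-sum ((- x) ∷ (k + x) ∷ T)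
              (Z-≡ (trans (sym (total-↭ π)) (e′ k x (total T))) zero-sum)
              (split-minimal zero-sum minimal π x∉T)
              (↭ᴳ.prep G.refl (↭ᴳ.prep G.refl (↭ᴾ.drop-∷ (↭ᴳ.trans (removal-↭ k∈S) S↭k)))))
          where
          S↭k : S ↭ᴳ φ k ∷ List.map φ T
          S↭k = ↭ᴳ.trans S↭ (↭ᴳ.↭-sym (map-φ-↭ π))
          k∈S : φ k ∈ᴳ S
          k∈S = ↭ᴾ.∈-resp-↭ (↭ᴳ.↭-sym S↭k) (here G.refl)
          e : ∀ k x → - x + (k + x) ≡ k
          e = solve-∀
          e′ : ∀ k x t → k + t ≡ - x + (k + x + t)
          e′ = solve-∀

        canonical : ∀ {x y} → x ∈ K → y ∈ K → x ~ y → x ≡ y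
        canonical x∈K y∈K x~y = go (All.lookup bounded x∈K) (All.lookup bounded y∈K) x~y
          where
          Bounded : ℤ → Set
          Bounded x = ∃[ n ] n ℕ.< p × x ≡ + suc n
          bounds : ∀ {xs S} → Pointwise (λ x s → 1 ℕ.≤ x × x ℕ.≤ p × s ≈ x · g) xs S → All Bounded (List.map +_ xs)
          bounds []                                = []
          bounds {suc x ∷ _} ((_ , x<p , _) ∷ rs) = (x , x<p , refl) ∷ bounds rs
          bounded : All Bounded K
          bounded = bounds represents
          go : ∀ {x y} → Bounded x → Bounded y → x ~ y → x ≡ y
          go (m , m<p , refl) (n , n<p , refl) (mk~ z) = cong (λ n → + suc n) (~⇒≡ m<p n<p (mk~ (Z-≡ (e (+ m) (+ n)) z)))
            where e : ∀ m n → + 1 + m - (+ 1 + n) ≡ m - n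
                  e = solve-∀

        unsplittableᶻ : SumGrowth.Unsplittableᶻ p prime K
        unsplittableᶻ = record
          { zero-sum  = zero-sum
          ; minimal   = minimal
          ; full      = full
          ; canonical = canonical
          ; size      = trans size (cong (λ n → 1 ℕ.+ 2 ℕ.* n) (trans (sym (Pointwise-length represents)) (sym (List.length-map +_ coefficients))))
          }

  -- The index, and the return to the group.

  fromℚᵘ-mono-≤ : ∀ {q r} → q ℚᵘ.≤ r → ℚ.fromℚᵘ q ℚ.≤ ℚ.fromℚᵘ r
  fromℚᵘ-mono-≤ {q} {r} q≤r = ℚ.toℚᵘ-cancel-≤
    (ℚᵘ.≤-trans (ℚᵘ.≤-reflexive (ℚ.toℚᵘ-fromℚᵘ q)) (ℚᵘ.≤-trans q≤r (ℚᵘ.≤-reflexive (ℚᵘ.≃-sym (ℚ.toℚᵘ-fromℚᵘ r)))))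

  2≡/ : ∀ {s n} .{{_ : NonZero n}} → s ≡ 2 ℕ.* n → (+ 2) ℚ./ 1 ≡ (+ s) ℚ./ n
  2≡/ {s} {n@(suc n-1)} refl = ℚ.fromℚᵘ-cong {mkℚᵘ (+ 2) 0} {mkℚᵘ (+ s) n-1}
    (ℚᵘ.*≡* (trans (sym (ℤ.pos-* 2 n)) (sym (ℤ.*-identityʳ (+ s)))))

  2≤/ : ∀ {s n} .{{_ : NonZero n}} → 2 ℕ.* n ℕ.≤ s → (+ 2) ℚ./ 1 ℚ.≤ (+ s) ℚ./ n
  2≤/ {s} {n@(suc n-1)} 2n≤s = fromℚᵘ-mono-≤ {mkℚᵘ (+ 2) 0} {mkℚᵘ (+ s) n-1}
    (ℚᵘ.*≤* (subst₂ ℤ._≤_ (ℤ.pos-* 2 n) (sym (ℤ.*-identityʳ (+ s))) (ℤ.+≤+ 2n≤s)))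

  sum≤length : ∀ {xs} → All (ℕ._≤ 1) xs → sum xs ℕ.≤ length xs
  sum≤length []         = z≤n
  sum≤length (x≤1 ∷ xs) = ℕ.+-mono-≤ x≤1 (sum≤length xs)

  length≤sum : ∀ {xs} → All (1 ℕ.≤_) xs → length xs ℕ.≤ sum xs
  length≤sum []         = z≤n
  length≤sum (1≤x ∷ xs) = ℕ.+-mono-≤ 1≤x (length≤sum xs)

  sum-replicate : ∀ n x → sum (replicate n x) ≡ n ℕ.* x
  sum-replicate zero    x = refl
  sum-replicate (suc n) x = cong (x ℕ.+_) (sum-replicate n x)

  total-pos : ∀ xs → total (List.map +_ xs) ≡ + sum xs
  total-pos []       = refl
  total-pos (x ∷ xs) = cong (_+_ (+ x)) (total-pos xs)

  half≡ : ∀ {x} n → x ≡ n ℕ.* 2 → x ℕ./ 2 ≡ n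
  half≡ n refl = ℕ.m*n/n≡m n 2

  odd-prime : ∀ {p} → Prime p → 2 ℕ.< p → p ≡ 1 ℕ.+ 2 ℕ.* ((p ℕ.∸ 1) ℕ./ 2)
  odd-prime {p} pr 2<p = go (p ℕ.% 2) (p ℕ./ 2) (ℕ.m%n<n p 2) (ℕ.m≡m%n+[m/n]*n p 2)
    where
    go : ∀ r q → r ℕ.< 2 → p ≡ r ℕ.+ q ℕ.* 2 → p ≡ 1 ℕ.+ 2 ℕ.* ((p ℕ.∸ 1) ℕ./ 2)
    go 0 q _ p≡ = ⊥-elim ([ (λ ()) , (λ 2≡p → ℕ.<⇒≢ 2<p 2≡p) ]′ (prime⇒irreducible pr (ℕ.divides q p≡)))
    go 1 q _ p≡ = trans p≡ (cong suc (trans (ℕ.*-comm q 2) (cong (2 ℕ.*_) (sym (half≡ {p ℕ.∸ 1} q (cong ℕ.pred p≡))))))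
    go (suc (suc r)) _ (s≤s (s≤s ())) _

  module Conclusion {c ℓ} (p : ℕ) (prime : Prime p) (155<p : 155 ℕ.< p) (G : AbelianGroup c ℓ)
    (cyclic : ZeroSum.CyclicOfOrder G p) (S : ZeroSum.Sequence G) (unsplittable : ZeroSum.Unsplittable G S)
    (∣S∣≡ : length S ≡ (p ℕ.∸ 1) ℕ./ 2) where

    open ZeroSum G renaming (_↭_ to _↭ᴳ_; _∈_ to _∈ᴳ_; _∣_ to _∣ᴳ_)
    private module G = AbelianGroup G
    open MultiplesInGroup G p prime
    open WithGenerator cyclic
    open Transfer G p prime
    open Residues p prime
    open Mult G.monoid using (×-congʳ; ×-assocˡ)

    size : p ≡ 1 ℕ.+ 2 ℕ.* length S
    size = trans (odd-prime prime (ℕ.≤-<-trans (ℕ.m≤m+n 2 153) 155<p)) (cong (λ n → 1 ℕ.+ 2 ℕ.* n) (sym ∣S∣≡))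

    Represents : Carrier → ℕ → Carrier → Set ℓ
    Represents g x s = 1 ℕ.≤ x × x ℕ.≤ p × s ≈ x · g

    as-multiple : ∀ {g} → ¬ g ≈ 0ᴳ → ∀ h → ∃[ k ] h ≈ k · g
    as-multiple {g} g≉0 h =
      let i , _ , _ , g≈ = coordinate g
          j , _ , _ , h≈ = coordinate h in
      solve i g≈ j h≈
      where
      open Multiples γ-order using (·-~)
      solve : ∀ i → g ≈ i · γ → ∀ j → h ≈ j · γ → ∃[ k ] h ≈ k · g
      solve i g≈ j h≈ = let k , _ , j~ki = multiple {+ i} i≢0 (+ j) in
        k , G.trans h≈ (G.trans (·-~ (~-trans j~ki (~-reflexive (sym (ℤ.pos-* k i)))))
          (G.trans (G.sym (×-assocˡ γ k i)) (×-congʳ k (G.sym g≈))))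
        where
        i≢0 : ¬ Z (+ i)
        i≢0 z = g≉0 (G.trans g≈ (·-~ {i} {0} (Z⇒~0 z)))

    -- In prime order every nonzero element generates, so both sides of `⟨ supp S ⟩ ≐ ⟨ g ⟩₁` are
    -- the whole group.
    generates : ∀ {P s} → P s → ¬ s ≈ 0ᴳ → ∀ h → ⟨ P ⟩ h
    generates {P} {s} Ps s≉0 h = let k , h≈ = as-multiple s≉0 h in resp (G.sym h≈) (multiples-in k)
      where
      multiples-in : ∀ k → ⟨ P ⟩ (k · s)
      multiples-in zero    = zer
      multiples-in (suc k) = add (incl Ps) (multiples-in k)

    -- A norm is an integer since S sums to zero. Were it 1, a coefficient x ≥ 2 could be split as
    -- 1 + (x - 1): the remaining coefficients have sum p - x, too small to reach p - 1.
    norm≥2 : ∀ g r → Norm S g r → (+ 2) ℚ./ 1 ℚ.≤ r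
    norm≥2 g r norm = subst ((+ 2) ℚ./ 1 ℚ.≤_) (sym (Norm.value norm))
        (2≤/ (subst (λ n → 2 ℕ.* n ℕ.≤ sum xs) (sym n≡p) 2p≤sum))
      where
      open Norm norm renaming (coefficients to xs)
      order-p : Order-p g
      order-p = nonzero-order nonzero
      n≡p : n ≡ p
      n≡p = ℕ.≤-antisym (order .proj₂ .proj₂ p (ℕ.>-nonZero⁻¹ p) (Order-p.p·g≈0 order-p))
        (ℕ.∣⇒≤ (Order-p.p∣-kernel order-p n (order .proj₂ .proj₁)))
      represents′ : Pointwise (Represents g) xs S
      represents′ = subst (λ k → Pointwise (λ x s → 1 ℕ.≤ x × x ℕ.≤ k × s ≈ x · g) xs S) n≡p represents
      K : List ℤ
      K = List.map +_ xs
      open SumGrowth.Unsplittableᶻ (Coefficients.unsplittableᶻ order-p unsplittable represents′ size) using (zero-sum; full)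
      positive : All (1 ℕ.≤_) xs
      positive = go represents′
        where
        go : ∀ {xs S} → Pointwise (Represents g) xs S → All (1 ℕ.≤_) xs
        go []                  = []
        go ((1≤x , _) ∷ rs) = 1≤x ∷ go rs
      1≤∣S∣ : 1 ℕ.≤ length S
      1≤∣S∣ = ℕ.n≢0⇒n>0 λ ∣S∣≡0 → ℕ.<⇒≱ 155<p (subst (ℕ._≤ 155) (sym (trans size (cong (λ n → 1 ℕ.+ 2 ℕ.* n) ∣S∣≡0))) (s≤s z≤n))
      ∣xs∣≡ : length xs ≡ length S
      ∣xs∣≡ = Pointwise-length represents′
      sum-bound : ∀ {v} ys → SubsetSum (List.map +_ ys) v → ∃[ k ] k ℕ.≤ sum ys × v ~ + k
      sum-bound []       (done z)     = 0 , z≤n , Z⇒~0 z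
      sum-bound (y ∷ ys) (skip s)     = let k , k≤ , q = sum-bound ys s in k , ℕ.≤-trans k≤ (ℕ.m≤n+m _ y) , q
      sum-bound {v} (y ∷ ys) (take s) = let k , k≤ , mk~ q = sum-bound ys s in
        y ℕ.+ k , ℕ.+-monoʳ-≤ y k≤ , mk~ (Z-≡ (e v (+ y) (+ k)) q)
        where e : ∀ v y k → v - y - k ≡ v - (y + k)
              e = solve-∀
      p∣sum : p ℕ.∣ sum xs
      p∣sum = ∣⇒∣ᵤ (Z-≡ (total-pos xs) zero-sum)
      sum≢p : sum xs ≢ p
      sum≢p sum≡p = large (extract (All.¬All⇒Any¬ (ℕ._≤? 1) xs λ all≤1 → ℕ.<⇒≱ ∣xs∣<p (subst (ℕ._≤ length xs) sum≡p (sum≤length all≤1))))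
        where
        ∣xs∣<p : length xs ℕ.< p
        ∣xs∣<p = subst₂ ℕ._<_ (sym ∣xs∣≡) (sym size) (s≤s (ℕ.m≤n*m (length S) 2))
        large : ¬ (∃₂ λ x ys → ¬ x ℕ.≤ 1 × x ∷ ys ↭ xs)
        large (x , ys , x≰1 , π) =
          let k , k≤ , mk~ q = sum-bound { - + 1} ys (full (+ x) (List.map +_ ys) (↭.map⁺ +_ π) (- + 1)) in
          ¬Z-between {suc k} (s≤s z≤n)
            (ℕ.<-≤-trans (s≤s (s≤s k≤)) (ℕ.≤-trans (ℕ.+-monoˡ-≤ (sum ys) (ℕ.≰⇒> x≰1)) (ℕ.≤-reflexive (trans (sum-↭ π) sum≡p))))
            (Z-≡ (e (+ k)) (∣m⇒∣-m q))
          where e : ∀ k → - (- + 1 - k) ≡ + 1 + k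
                e = solve-∀
      2p≤sum : 2 ℕ.* p ℕ.≤ sum xs
      2p≤sum = quotient p∣sum
        where
        quotient : p ℕ.∣ sum xs → 2 ℕ.* p ℕ.≤ sum xs
        quotient (ℕ.divides 0 eq) = ⊥-elim (ℕ.<⇒≱ (ℕ.≤-trans 1≤∣S∣ (ℕ.≤-reflexive (sym ∣xs∣≡))) (ℕ.≤-trans (length≤sum positive) (ℕ.≤-reflexive eq)))
        quotient (ℕ.divides 1 eq) = contradiction (trans eq (ℕ.*-identityˡ p)) sum≢p
        quotient (ℕ.divides (suc (suc q)) eq) = subst (2 ℕ.* p ℕ.≤_) (sym eq) (ℕ.*-monoˡ-≤ p (s≤s (s≤s (z≤n {q}))))

    Represents-↭ : ∀ {g xs A B} → Pointwise (Represents g) xs A → A ↭ᴳ B → ∃[ ys ] Pointwise (Represents g) ys B × sum ys ≡ sum xs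
    Represents-↭ {xs = xs} rs (↭ᴳ.refl A≋B) = xs , go rs A≋B , refl
      where
      go : ∀ {g xs A B} → Pointwise (Represents g) xs A → Pointwise _≈_ A B → Pointwise (Represents g) xs B
      go []                        []            = []
      go ((1≤x , x≤p , s≈) ∷ rs) (s≈t ∷ A≋B) = (1≤x , x≤p , G.trans (G.sym s≈t) s≈) ∷ go rs A≋B
    Represents-↭ ((1≤x , x≤p , s≈) ∷ rs) (↭ᴳ.prep {x = s} eq π) = let ys , rs′ , sum≡ = Represents-↭ rs π in
      _ ∷ ys , (1≤x , x≤p , G.trans (G.sym eq) s≈) ∷ rs′ , cong (_ ℕ.+_) sum≡
    Represents-↭ {xs = x ∷ y ∷ _} ((1≤x , x≤p , s≈) ∷ (1≤y , y≤p , t≈) ∷ rs) (↭ᴳ.swap eq₁ eq₂ π) =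
      let ys , rs′ , sum≡ = Represents-↭ rs π in
      y ∷ x ∷ ys , (1≤y , y≤p , G.trans (G.sym eq₂) t≈) ∷ (1≤x , x≤p , G.trans (G.sym eq₁) s≈) ∷ rs′
      , trans (cong (λ n → y ℕ.+ (x ℕ.+ n)) sum≡) (e x y _)
      where e : ∀ x y n → y ℕ.+ (x ℕ.+ n) ≡ x ℕ.+ (y ℕ.+ n)
            e = ℕ-Ring.solve-∀
    Represents-↭ rs (↭ᴳ.trans π π′) =
      let ys , rs′ , sum≡ = Represents-↭ rs π ; zs , rs″ , sum≡′ = Represents-↭ rs′ π′ in zs , rs″ , trans sum≡′ sum≡

    index-two : ∀ {ε xs A s} → ¬ ε ≈ 0ᴳ → ¬ s ≈ 0ᴳ → (s ∷ A) ↭ᴳ S → Pointwise (Represents ε) xs (s ∷ A) → sum xs ≡ 2 ℕ.* p → Index S ((+ 2) ℚ./ 1)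
    index-two {ε} {xs} {A} {s} ε≉0 s≉0 π rs sum≡ =
      (ε , ((λ _ → generates {supp (ε ∷ [])} (here G.refl) ε≉0 _) , (λ _ → generates {supp S} s∈S s≉0 _)) , norm)
      , λ g r _ → norm≥2 g r
      where
      s∈S : s ∈ᴳ S
      s∈S = ↭ᴾ.∈-resp-↭ π (here G.refl)
      order-p : Order-p ε
      order-p = nonzero-order ε≉0
      norm : Norm S ε ((+ 2) ℚ./ 1)
      norm = let ys , rs′ , sum≡′ = Represents-↭ rs π in record
        { nonzero = ε≉0 ; n = p
        ; order = ℕ.>-nonZero⁻¹ p , Order-p.p·g≈0 order-p
            , λ { (suc m) _ mε≈0 → ℕ.∣⇒≤ (Order-p.p∣-kernel order-p (suc m) mε≈0) }
        ; coefficients = ys ; represents = rs′ ; value = 2≡/ {sum ys} {p} (trans sum≡′ sum≡) }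

    coordinates : ∀ S → ∃[ xs ] Pointwise (Represents γ) xs S
    coordinates []      = [] , []
    coordinates (s ∷ S) = let x , r = coordinate s ; xs , rs = coordinates S in x ∷ xs , r ∷ rs

    open Multiples γ-order

    ~-above : ∀ {n j} → n ≡ p ℕ.+ j → + n ~ + j
    ~-above {j = j} refl = mk~ (Z-≡ (e (+ p) (+ j)) Z-p)
      where e : ∀ p j → p ≡ p + j - j
            e = solve-∀

    ~-below : ∀ {n j} → n ℕ.+ j ≡ p → + n ~ - + j
    ~-below {n} {j} eq = mk~ (Z-≡ (trans (cong +_ (sym eq)) (e (+ n) (+ j))) Z-p)
      where e : ∀ n j → n + j ≡ n - - j
            e = solve-∀

    half-multiple : ∀ {a x y} n → + 2 * x ~ y * a → + (n ℕ.* 2) ~ y → φ x ≈ n · φ a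
    half-multiple {a} {x} {y} n (mk~ h) (mk~ q) = G.trans (φ-~ {x} {+ n * a} (2*-cancel (ℕ.≤-<-trans (ℕ.m≤m+n 2 153) 155<p) {x} {+ n * a} (mk~ (Z-≡
        (trans (e a x y (+ (n ℕ.* 2))) (trans (cong (λ w → + 2 * x - w * a) (ℤ.pos-* n 2)) (e′ (+ 2 * x) (+ n) a)))
        (∣m∣n⇒∣m-n h (∣n⇒∣m*n a q)))))) (φ-* n a)
      where e : ∀ a x y w → + 2 * x - y * a - a * (w - y) ≡ + 2 * x - w * a
            e = solve-∀
            e′ : ∀ x n a → x - (n * + 2) * a ≡ x - + 2 * (n * a)
            e′ = solve-∀

    module FromForm {xs : List ℕ} (represents : Pointwise (Represents γ) xs S) where

      K : List ℤ
      K = List.map +_ xs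

      S↭ : S ↭ᴳ List.map φ K
      S↭ = Coefficients.S↭ γ-order unsplittable represents size

      -- In terms of the half ε of a, the sequence of type (y, z) is (2ε)^m (yε)^k (zε), so its norm
      -- with respect to ε is (2m + ky + (p + z)) / p = 2.
      module Halves {a h x : ℤ} (m k : ℕ) {y z : ℤ} (π : replicate (suc m) a ++ replicate k h ++ x ∷ [] ↭ K) (a≢0 : ¬ Z a)
        (hh : + 2 * h ~ y * a) (hx : + 2 * x ~ z * a) where

        S↭form : S ↭ᴳ replicate (suc m) (φ a) ++ replicate k (φ h) ++ φ x ∷ []
        S↭form = ↭ᴳ.trans S↭ (↭ᴳ.trans (↭ᴳ.↭-sym (map-φ-↭ γ-order π)) (↭ᴳ.↭-reflexive
          (trans (List.map-++ φ (replicate (suc m) a) (replicate k h ++ x ∷ [])) (cong₂ _++_ (List.map-replicate φ (suc m) a)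
            (trans (List.map-++ φ (replicate k h) (x ∷ [])) (cong (_++ φ x ∷ []) (List.map-replicate φ k h)))))))

        shape : ∀ n₁ n₂ → + (n₁ ℕ.* 2) ~ y → + (n₂ ℕ.* 2) ~ z →
          S ↭ᴳ replicate (suc m) (φ a) ++ replicate k (n₁ · φ a) ++ replicate 1 (n₂ · φ a)
        shape n₁ n₂ q₁ q₂ = ↭ᴳ.trans S↭form (↭ᴳ.refl (Pointwise.++⁺ (Pointwise.replicate⁺ G.refl (suc m))
          (Pointwise.++⁺ (Pointwise.replicate⁺ (half-multiple n₁ hh q₁) k) (half-multiple n₂ hx q₂ ∷ []))))

        -- The factor |S| + 1 = (p + 1)/2 is the inverse of 2 modulo p.
        a½ : ℤ
        a½ = + suc (length S) * a

        a~2a½ : a ~ + 2 * a½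
        a~2a½ = mk~ (Z-≡ (trans (cong (λ q → - (a * + q)) size) (trans (cong (λ q → - (a * (+ 1 + q))) (ℤ.pos-* 2 (length S))) (e a (+ length S))))
          (∣m⇒∣-m (∣n⇒∣m*n a Z-p)))
          where e : ∀ a l → - (a * (+ 1 + + 2 * l)) ≡ a - + 2 * ((+ 1 + l) * a)
                e = solve-∀

        ε : Carrier
        ε = φ a½

        ε≉0 : ¬ ε ≈ 0ᴳ
        ε≉0 ε≈0 = a≢0 (Z-resp (~-sym a~2a½) (∣n⇒∣m*n (+ 2) (φ-0⁻ ε≈0)))

        in-ε : ∀ {u v} n → + 2 * u ~ v * a → + n ~ v → φ u ≈ n · ε
        in-ε {u} {v} n (mk~ hu) (mk~ q) = G.trans (φ-~ {u} {+ n * a½} (2*-cancel (ℕ.≤-<-trans (ℕ.m≤m+n 2 153) 155<p) {u} {+ n * a½} (mk~ (Z-≡ (e a u v (+ n) a½)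
            (∣m∣n⇒∣m+n (∣m∣n⇒∣m-n hu (∣n⇒∣m*n a q)) (∣n⇒∣m*n (+ n) (un~ a~2a½))))))) (φ-* n a½)
          where e : ∀ a u v n b → + 2 * u - v * a - a * (n - v) + n * (a - + 2 * b) ≡ + 2 * u - + 2 * (n * b)
                e = solve-∀

        form-index : ∀ c₁ c₂ → 1 ℕ.≤ c₁ → c₁ ℕ.≤ p → 1 ℕ.≤ c₂ → c₂ ℕ.≤ p → + c₁ ~ y → + c₂ ~ z →
          suc m ℕ.* 2 ℕ.+ (k ℕ.* c₁ ℕ.+ c₂) ≡ 2 ℕ.* p → Index S ((+ 2) ℚ./ 1)
        form-index c₁ c₂ 1≤c₁ c₁≤p 1≤c₂ c₂≤p q₁ q₂ sum≡ = index-two ε≉0 (a≢0 ∘ φ-0⁻) (↭ᴳ.↭-sym S↭form)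
          (Pointwise.++⁺ (Pointwise.replicate⁺ {x = 2} (s≤s z≤n , ℕ.≤-trans (ℕ.m≤m+n 2 153) (ℕ.<⇒≤ 155<p) , in-ε {a} {+ 2} 2 ~-refl ~-refl) (suc m))
            (Pointwise.++⁺ (Pointwise.replicate⁺ (1≤c₁ , c₁≤p , in-ε c₁ hh q₁) k) ((1≤c₂ , c₂≤p , in-ε c₂ hx q₂) ∷ [])))
          (trans (sum-++ (replicate (suc m) 2) (replicate k c₁ ++ c₂ ∷ []))
            (trans (cong₂ ℕ._+_ (sum-replicate (suc m) 2) (trans (sum-++ (replicate k c₁) (c₂ ∷ []))
              (cong₂ ℕ._+_ (sum-replicate k c₁) (ℕ.+-identityʳ c₂)))) sum≡))

        p≡ : p ≡ 1 ℕ.+ 2 ℕ.* (suc m ℕ.+ (k ℕ.+ 1))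
        p≡ = trans size (cong (λ n → 1 ℕ.+ 2 ℕ.* n) (trans (↭ᴾ.xs↭ys⇒|xs|≡|ys| S↭form)
          (trans (List.length-++ (replicate (suc m) (φ a))) (cong₂ ℕ._+_ (List.length-replicate (suc m))
            (trans (List.length-++ (replicate k (φ h))) (cong (ℕ._+ 1) (List.length-replicate k)))))))

      Conclusion : Set (c ⊔ ℓ)
      Conclusion = (∃[ g ]
        ( S ↭ᴳ (replicate ((p ℕ.∸ 11) ℕ./ 2) g ++ replicate 4 (((p ℕ.+ 3) ℕ./ 2) · g) ++ replicate 1 (((p ℕ.∸ 1) ℕ./ 2) · g))
        ⊎ S ↭ᴳ (replicate ((p ℕ.∸ 7) ℕ./ 2) g ++ replicate 2 (((p ℕ.+ 5) ℕ./ 2) · g) ++ replicate 1 (((p ℕ.∸ 3) ℕ./ 2) · g))))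
        × Index S ((+ 2) ℚ./ 1)

      quotients : ∀ {k n₀ n₁ n₂ r₀ r₁ r₂ s} {g : Carrier} → r₀ ≡ n₀ → r₁ ≡ n₁ → r₂ ≡ n₂ →
        S ↭ᴳ replicate n₀ g ++ replicate k (n₁ · g) ++ replicate s (n₂ · g) →
        S ↭ᴳ replicate r₀ g ++ replicate k (r₁ · g) ++ replicate s (r₂ · g)
      quotients refl refl refl ρ = ρ

      conclude₁ : ∀ {a h x} m → replicate (suc m) a ++ replicate 4 h ++ x ∷ [] ↭ K → ¬ Z a →
        + 2 * h ~ + 3 * a → + 2 * x ~ - + 1 * a → Conclusion
      conclude₁ {a} m π a≢0 hh hx =
        (φ a , inj₁ (quotients {4} {s = 1}
          (half≡ {p ℕ.∸ 11} (suc m) (trans (cong (ℕ._∸ 11) p₁) (ℕ.*-comm 2 (suc m))))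
          (half≡ {p ℕ.+ 3} (8 ℕ.+ m) (trans (cong (ℕ._+ 3) p₁) (e₁ m)))
          (half≡ {p ℕ.∸ 1} (6 ℕ.+ m) (trans (cong (ℕ._∸ 1) p₁) (e₂ m)))
          (H.shape (8 ℕ.+ m) (6 ℕ.+ m)
            (~-above (trans (sym (e₁ m)) (cong (ℕ._+ 3) (sym p₁))))
            (~-below (trans (e₃ m) (sym p₁))))))
        -- With respect to ε the coefficients are 2 (m + 1 times), 3 (four times) and p - 1, with
        -- sum (p - 11) + 12 + (p - 1) = 2p.
        , H.form-index 3 (p ℕ.∸ 1) (s≤s z≤n) (ℕ.≤-trans (ℕ.m≤m+n 3 152) (ℕ.<⇒≤ 155<p))
            (ℕ.≤-trans (ℕ.m≤m+n 1 153) (ℕ.∸-monoˡ-≤ 1 (ℕ.<⇒≤ 155<p))) (ℕ.m∸n≤m p 1)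
            ~-refl (~-below (ℕ.m∸n+n≡m (ℕ.>-nonZero⁻¹ p)))
            (trans (cong (λ q → suc m ℕ.* 2 ℕ.+ (12 ℕ.+ (q ℕ.∸ 1))) p₁) (trans (e₄ m) (cong (2 ℕ.*_) (sym p₁))))
        where
        module H = Halves m 4 {+ 3} { - + 1} π a≢0 hh hx
        p₁ : p ≡ 11 ℕ.+ 2 ℕ.* suc m
        p₁ = trans H.p≡ (e m)
          where e : ∀ m → 1 ℕ.+ 2 ℕ.* (suc m ℕ.+ (4 ℕ.+ 1)) ≡ 11 ℕ.+ 2 ℕ.* suc m
                e = ℕ-Ring.solve-∀
        e₁ : ∀ m → 11 ℕ.+ 2 ℕ.* suc m ℕ.+ 3 ≡ (8 ℕ.+ m) ℕ.* 2
        e₁ = ℕ-Ring.solve-∀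
        e₂ : ∀ m → 10 ℕ.+ 2 ℕ.* suc m ≡ (6 ℕ.+ m) ℕ.* 2
        e₂ = ℕ-Ring.solve-∀
        e₃ : ∀ m → (6 ℕ.+ m) ℕ.* 2 ℕ.+ 1 ≡ 11 ℕ.+ 2 ℕ.* suc m
        e₃ = ℕ-Ring.solve-∀
        e₄ : ∀ m → suc m ℕ.* 2 ℕ.+ (12 ℕ.+ (10 ℕ.+ 2 ℕ.* suc m)) ≡ 2 ℕ.* (11 ℕ.+ 2 ℕ.* suc m)
        e₄ = ℕ-Ring.solve-∀

      conclude₂ : ∀ {a h x} m → replicate (suc m) a ++ replicate 2 h ++ x ∷ [] ↭ K → ¬ Z a →
        + 2 * h ~ + 5 * a → + 2 * x ~ - + 3 * a → Conclusion
      conclude₂ {a} m π a≢0 hh hx =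
        (φ a , inj₂ (quotients {2} {s = 1}
          (half≡ {p ℕ.∸ 7} (suc m) (trans (cong (ℕ._∸ 7) p₂) (ℕ.*-comm 2 (suc m))))
          (half≡ {p ℕ.+ 5} (7 ℕ.+ m) (trans (cong (ℕ._+ 5) p₂) (e₁ m)))
          (half≡ {p ℕ.∸ 3} (3 ℕ.+ m) (trans (cong (ℕ._∸ 3) p₂) (e₂ m)))
          (H.shape (7 ℕ.+ m) (3 ℕ.+ m)
            (~-above (trans (sym (e₁ m)) (cong (ℕ._+ 5) (sym p₂))))
            (~-below (trans (e₃ m) (sym p₂))))))
        -- Here the coefficients are 2 (m + 1 times), 5 (twice) and p - 3, with sum (p - 7) + 10 +
        -- (p - 3) = 2p.
        , H.form-index 5 (p ℕ.∸ 3) (s≤s z≤n) (ℕ.≤-trans (ℕ.m≤m+n 5 150) (ℕ.<⇒≤ 155<p))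
            (ℕ.≤-trans (ℕ.m≤m+n 1 151) (ℕ.∸-monoˡ-≤ 3 (ℕ.<⇒≤ 155<p))) (ℕ.m∸n≤m p 3)
            ~-refl (~-below (ℕ.m∸n+n≡m (ℕ.≤-trans (ℕ.m≤m+n 3 152) (ℕ.<⇒≤ 155<p))))
            (trans (cong (λ q → suc m ℕ.* 2 ℕ.+ (10 ℕ.+ (q ℕ.∸ 3))) p₂) (trans (e₄ m) (cong (2 ℕ.*_) (sym p₂))))
        where
        module H = Halves m 2 {+ 5} { - + 3} π a≢0 hh hx
        p₂ : p ≡ 7 ℕ.+ 2 ℕ.* suc m
        p₂ = trans H.p≡ (e m)
          where e : ∀ m → 1 ℕ.+ 2 ℕ.* (suc m ℕ.+ (2 ℕ.+ 1)) ≡ 7 ℕ.+ 2 ℕ.* suc m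
                e = ℕ-Ring.solve-∀
        e₁ : ∀ m → 7 ℕ.+ 2 ℕ.* suc m ℕ.+ 5 ≡ (7 ℕ.+ m) ℕ.* 2
        e₁ = ℕ-Ring.solve-∀
        e₂ : ∀ m → 4 ℕ.+ 2 ℕ.* suc m ≡ (3 ℕ.+ m) ℕ.* 2
        e₂ = ℕ-Ring.solve-∀
        e₃ : ∀ m → (3 ℕ.+ m) ℕ.* 2 ℕ.+ 3 ≡ 7 ℕ.+ 2 ℕ.* suc m
        e₃ = ℕ-Ring.solve-∀
        e₄ : ∀ m → suc m ℕ.* 2 ℕ.+ (10 ℕ.+ (4 ℕ.+ 2 ℕ.* suc m)) ≡ 2 ℕ.* (7 ℕ.+ 2 ℕ.* suc m)
        e₄ = ℕ-Ring.solve-∀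

      conclusion : Conclusion
      conclusion = from frequent
        where
        open Structure p prime 155<p K (Coefficients.unsplittableᶻ γ-order unsplittable represents size)
        from : (∃[ a ] ∃₂ λ m R → 6 ℕ.≤ m × replicate m a ++ R ↭ K × All (_≢ a) R) → Conclusion
        from (a , suc m , R , 6≤m , π , ≢a) = [ first , second ]′ (Frequent.form a (suc m) 6≤m R π ≢a)
          where
          a≢0 : ¬ Z a
          a≢0 = Frequent.a≢0ᴬ a (suc m) 6≤m π
          first : (∃₂ λ h x → replicate (suc m) a ++ replicate 4 h ++ x ∷ [] ↭ K × + 2 * h ~ + 3 * a × + 2 * x ~ - + 1 * a) → Conclusion
          first (_ , _ , ρ , hh , hx) = conclude₁ m ρ a≢0 hh hx
          second : (∃₂ λ h x → replicate (suc m) a ++ replicate 2 h ++ x ∷ [] ↭ K × + 2 * h ~ + 5 * a × + 2 * x ~ - + 3 * a) → Conclusion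
          second (_ , _ , ρ , hh , hx) = conclude₂ m ρ a≢0 hh hx

open import Algebra.Bundles using (AbelianGroup)
open import Data.Integer using (+_)
open import Data.List using (length; replicate; _++_)
open import Data.Nat using (ℕ; _+_; _∸_; _<_; _/_)
open import Data.Nat.Primality using (Prime)
open import Data.Product using (_×_; ∃-syntax)
open import Data.Rational as ℚ using (ℚ)
open import Data.Sum using (_⊎_)
open import Relation.Binary.PropositionalEquality using (_≡_)

theorem1p4 : ∀ {c ℓ} (p : ℕ) → Prime p → 155 < p →
  (G : AbelianGroup c ℓ) → let open ZeroSum G in
  CyclicOfOrder p →
  (S : Sequence) → Unsplittable S → length S ≡ (p ∸ 1) / 2 →
  (∃[ g ]
    ( S ↭ (replicate ((p ∸ 11) / 2) g
            ++ replicate 4 (((p + 3) / 2) · g)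
            ++ replicate 1 (((p ∸ 1) / 2) · g))
    ⊎ S ↭ (replicate ((p ∸ 7) / 2) g
            ++ replicate 2 (((p + 5) / 2) · g)
            ++ replicate 1 (((p ∸ 3) / 2) · g))))
  × Index S ((+ 2) ℚ./ 1)
theorem1p4 p pr 155<p G cyclic S unsplittable ∣S∣≡ =
  FromForm.conclusion (proj₂ (coordinates S))
  where
  open import Data.Product using (proj₂)
  open UnsplittableSequences.Conclusion p pr 155<p G cyclic S unsplittable ∣S∣≡
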